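{- Let $r \ge 2$ be a fixed integer and let $H = (V,E)$ be a hypergraph with $m$ hyperedges and maximum vertex degree $k = o(\sqrt{m})$, where each hyperedge has size at most $r$. Then $H$ has a balanced separator of size at most $(\frac12 - \epsilon_r)m + o(m)$, where $\epsilon_r = (1 - 2^{ -1/r})^r$. Furthermore, such a balanced separator can be found by a randomized algorithm in expected polynomial time, and by a deterministic algorithm in time $m^{O(1)} 2^{(1 - 2\epsilon_r^2)m + o(m)}$.
   Context: All hypergraphs are finite. The degree of a vertex is the number of hyperedges containing it. A connected component of a hypergraph $(V,E)$ is a maximal subset $S \subseteq V$ such that for every pair $u,v \in S$ there is a sequence of hyperedges $e_1,\dots,e_t$, each contained in $S$, with $u \in e_1$, $v \in e_t$ and $e_i \cap e_{i+1} \neq \emptyset$ for all $1 \le i \le t-1$ (a vertex lying in no hyperedge forms a component by itself). A balanced separator for $H=(V,E)$ is a set $R \subseteq E$ such that every connected component of $(V, E\setminus R)$ is incident to at most $|E|/2$ hyperedges of $E \setminus R$. Asymptotic notation is as $m \to \infty$ with $r$ fixed: for every fixed $r$ and every function $k(m) = o(\sqrt m)$ there is a function $g(m) = o(m)$ such that the statement holds, with $o(m)$ replaced by $g(m)$, for all hypergraphs with $m$ hyperedges of size at most $r$ and maximum degree at most $k(m)$. -}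

module Defs where

open import Data.Bool.Base using (Bool; true; false; if_then_else_; _∧_)
open import Data.Fin.Base using (Fin; toℕ)
open import Data.Fin.Subset
  using (Subset; _∈_; _∉_; _⊆_; _∩_; ∁; ∣_∣; ⁅_⁆; Nonempty)
open import Data.Fin.Subset.Properties using (_∈?_; nonempty?)
open import Data.Integer.Base as ℤ using (ℤ; +_; -[1+_])
open import Data.List.Base as List using (List; []; _∷_; foldr; filter; allFin)
open import Data.Nat.Base as ℕ using (ℕ; zero; suc; NonZero)
import Data.Nat.Properties as ℕ
open import Data.Product.Base using (_×_; ∃; ∃-syntax)
open import Data.Rational.Base as ℚ using (ℚ; 0ℚ; 1ℚ; ½)
open import Data.Sum.Base using (_⊎_)
open import Data.Vec.Base as Vec using (Vec; []; _∷_; lookup; tabulate)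
open import Function.Base using (_∘_)
open import Function.Definitions using (Injective)
open import Relation.Binary.PropositionalEquality using (_≡_)
open import Relation.Nullary.Decidable.Core using (does)
import Algebra.Definitions.RawSemiring ℚ.+-*-rawSemiring as ℚ-Exp

------------------------------------------------------------------------
-- Real numbers

-- Reals as Dedekind cuts: `lower x q` means q < x and `upper x q` means
-- x < q.  The cut laws are not carried as fields.  The operations below
-- are the usual ones on Dedekind cuts; on cuts that satisfy the laws
-- they compute the expected real number.

record Cut : Set₁ where
  field
    lower : ℚ → Set
    upper : ℚ → Set

open Cut public

rat : ℚ → Cut
rat q .lower p = p ℚ.< q
rat q .upper p = q ℚ.< p

nat : ℕ → Cut
nat n = rat (+ n ℚ./ 1)

infix  4 _≤ᶜ_
infixl 6 _+ᶜ_ _-ᶜ_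
infixl 7 _*ᶜ_
infixr 8 _^ᶜ_ 2^ᶜ_

_≤ᶜ_ : Cut → Cut → Set
x ≤ᶜ y = ∀ q → lower x q → lower y q

_+ᶜ_ : Cut → Cut → Cut
(x +ᶜ y) .lower q = ∃[ a ] ∃[ b ] lower x a × lower y b × q ℚ.< a ℚ.+ b
(x +ᶜ y) .upper q = ∃[ a ] ∃[ b ] upper x a × upper y b × a ℚ.+ b ℚ.< q

_-ᶜ_ : Cut → Cut → Cut
(x -ᶜ y) .lower q = ∃[ a ] ∃[ b ] lower x a × upper y b × q ℚ.< a ℚ.- b
(x -ᶜ y) .upper q = ∃[ a ] ∃[ b ] upper x a × lower y b × a ℚ.- b ℚ.< q

-- Interval multiplication: for a < x < b and c < y < d, the product x y
-- lies between the least and the greatest of ac, ad, bc, bd.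

_*ᶜ_ : Cut → Cut → Cut
(x *ᶜ y) .lower q = ∃[ a ] ∃[ b ] ∃[ c ] ∃[ d ]
  lower x a × upper x b × lower y c × upper y d ×
  q ℚ.< a ℚ.* c × q ℚ.< a ℚ.* d × q ℚ.< b ℚ.* c × q ℚ.< b ℚ.* d
(x *ᶜ y) .upper q = ∃[ a ] ∃[ b ] ∃[ c ] ∃[ d ]
  lower x a × upper x b × lower y c × upper y d ×
  a ℚ.* c ℚ.< q × a ℚ.* d ℚ.< q × b ℚ.* c ℚ.< q × b ℚ.* d ℚ.< q

_^ᶜ_ : Cut → ℕ → Cut
x ^ᶜ zero  = rat 1ℚ
x ^ᶜ suc n = x *ᶜ x ^ᶜ n

2^ℤ : ℤ → ℚ
2^ℤ (+ n)    = (+ 2 ℚ./ 1) ℚ-Exp.^ n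
2^ℤ -[1+ n ] = ½ ℚ-Exp.^ suc n

-- 2 ^ x for real x: a rational q ≥ 0 is below 2 ^ x iff q < 2 ^ (s / t)
-- for some rational s / t < x, and q < 2 ^ (s / t) iff q ^ t < 2 ^ s.

2^ᶜ_ : Cut → Cut
(2^ᶜ x) .lower q = q ℚ.< 0ℚ ⊎
  (∃[ s ] ∃[ t ] lower x (s ℚ./ suc t) × q ℚ-Exp.^ suc t ℚ.< 2^ℤ s)
(2^ᶜ x) .upper q = 0ℚ ℚ.< q ×
  (∃[ s ] ∃[ t ] upper x (s ℚ./ suc t) × 2^ℤ s ℚ.< q ℚ-Exp.^ suc t)

ε : (r : ℕ) .{{_ : NonZero r}} → Cut
ε r = (nat 1 -ᶜ 2^ᶜ rat (-[1+ 0 ] ℚ./ r)) ^ᶜ r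

------------------------------------------------------------------------
-- Asymptotics of functions of m

IsLittleO-m : (ℕ → ℕ) → Set
IsLittleO-m g = ∀ c → ∃[ M ] ∀ m → M ℕ.≤ m → c ℕ.* g m ℕ.≤ m

-- c · k(m) ≤ √m, squared.

IsLittleO-√m : (ℕ → ℕ) → Set
IsLittleO-√m k = ∀ c → ∃[ M ] ∀ m → M ℕ.≤ m → (c ℕ.* k m) ℕ.^ 2 ℕ.≤ m

------------------------------------------------------------------------
-- Hypergraphs on the vertex set Fin n with m hyperedges

record Hypergraph (n m : ℕ) : Set where
  field
    edge     : Fin m → Subset n
    distinct : Injective _≡_ _≡_ edge

module _ {n m : ℕ} (H : Hypergraph n m) where
  open Hypergraph H

  degree : Fin n → ℕ
  degree v = ∣ tabulate (λ e → lookup (edge e) v) ∣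

  EdgeSize≤ : ℕ → Set
  EdgeSize≤ r = ∀ e → ∣ edge e ∣ ℕ.≤ r

  MaxDegree≤ : ℕ → Set
  MaxDegree≤ k = ∀ v → degree v ℕ.≤ k

  -- Below, F ⊆ E stands for the hypergraph (V , F).

  -- Linked F S e v: there are hyperedges e = e₁, …, eₜ of F, all inside
  -- S, with consecutive ones intersecting and with v ∈ eₜ.

  data Linked (F : Subset m) (S : Subset n) (e : Fin m) (v : Fin n) : Set where
    end  : e ∈ F → edge e ⊆ S → v ∈ edge e → Linked F S e v
    step : ∀ e′ → e ∈ F → edge e ⊆ S → Nonempty (edge e ∩ edge e′) →
           Linked F S e′ v → Linked F S e v

  Connected : Subset m → Subset n → Set
  Connected F S = ∀ u v → u ∈ S → v ∈ S → ∃[ e ] u ∈ edge e × Linked F S e v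

  IsComponent : Subset m → Subset n → Set
  IsComponent F S =
    (Connected F S × (∀ S′ → S ⊆ S′ → Connected F S′ → S′ ⊆ S))
    ⊎ (∃[ v ] S ≡ ⁅ v ⁆ × (∀ e → e ∈ F → v ∉ edge e))

  incidentEdges : Subset m → Subset n → Subset m
  incidentEdges F S =
    tabulate (λ e → lookup F e ∧ does (nonempty? (edge e ∩ S)))

  IsBalancedSeparator : Subset m → Set
  IsBalancedSeparator R =
    ∀ S → IsComponent (∁ R) S → 2 ℕ.* ∣ incidentEdges (∁ R) S ∣ ℕ.≤ m

------------------------------------------------------------------------
-- Model of computation: while-programs over binary trees, with unit-cost
-- basic commands.  Atoms can only be copied and compared, so that a
-- vertex name is a single machine word whatever the number of vertices.

infixr 5 _∙_

data Value : Set where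
  atom : ℕ → Value
  _∙_  : Value → Value → Value

-- `atom 0` serves as the boolean false and as the empty list.

isTrue : Value → Bool
isTrue (atom zero)    = false
isTrue (atom (suc _)) = true
isTrue (_ ∙ _)        = true

bit : Bool → Value
bit false = atom 0
bit true  = atom 1

list : List Value → Value
list = foldr _∙_ (atom 0)

Var : Set
Var = ℕ

Store : Set
Store = Var → Value

data Expr : Set where
  var         : Var → Expr
  lit         : Value → Expr
  cons eqAtom : Expr → Expr → Expr
  hd tl       : Expr → Expr

head tail : Value → Value
head (atom _) = atom 0
head (x ∙ _)  = x
tail (atom _) = atom 0
tail (_ ∙ y)  = y

sameAtom : Value → Value → Bool
sameAtom (atom a) (atom b) = a ℕ.≡ᵇ b
sameAtom _        _        = false

eval : Expr → Store → Value
eval (var x)      σ = σ x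
eval (lit a)      σ = a
eval (cons e f)   σ = eval e σ ∙ eval f σ
eval (eqAtom e f) σ = bit (sameAtom (eval e σ) (eval f σ))
eval (hd e)       σ = head (eval e σ)
eval (tl e)       σ = tail (eval e σ)

data Mode : Set where
  deterministic randomized : Mode

infix  6 _≔_
infixr 5 _⨾_

data Program : Mode → Set where
  skip  : ∀ {M} → Program M
  _≔_   : ∀ {M} → Var → Expr → Program M
  flip  : Var → Program randomized
  _⨾_   : ∀ {M} → Program M → Program M → Program M
  if    : ∀ {M} → Expr → Program M → Program M → Program M
  while : ∀ {M} → Expr → Program M → Program M

_[_↦_] : Store → Var → Value → Store
(σ [ x ↦ a ]) y = if x ℕ.≡ᵇ y then a else σ y

-- The stack of commands still to be executed, and the store.

record Config (M : Mode) : Set where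
  constructor ⟨_,_⟩
  field
    stack : List (Program M)
    store : Store

open Config public

-- One step of computation.  Every step is offered a fresh coin, which
-- only `flip` looks at.

next : ∀ {M} → Bool → Config M → Config M
next coin ⟨ []              , σ ⟩ = ⟨ [] , σ ⟩
next coin ⟨ skip ∷ K        , σ ⟩ = ⟨ K , σ ⟩
next coin ⟨ (x ≔ e) ∷ K     , σ ⟩ = ⟨ K , σ [ x ↦ eval e σ ] ⟩
next coin ⟨ flip x ∷ K      , σ ⟩ = ⟨ K , σ [ x ↦ bit coin ] ⟩
next coin ⟨ (p ⨾ q) ∷ K     , σ ⟩ = ⟨ p ∷ q ∷ K , σ ⟩
next coin ⟨ if e p q ∷ K    , σ ⟩ =
  ⟨ (if isTrue (eval e σ) then p else q) ∷ K , σ ⟩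
next coin ⟨ while e p ∷ K   , σ ⟩ =
  ⟨ (if isTrue (eval e σ) then p ∷ while e p ∷ K else K) , σ ⟩

run : ∀ {M t} → Vec Bool t → Config M → Config M
run []      C = C
run (b ∷ ω) C = run ω (next b C)

Halted : ∀ {M} → Config M → Set
Halted C = stack C ≡ []

-- Variable 0 holds the input at the start and the output at the end.

start : ∀ {M} → Program M → Value → Config M
start p x = ⟨ p ∷ [] , (λ _ → atom 0) [ 0 ↦ x ] ⟩

output : ∀ {M} → Config M → Value
output C = store C 0

-- The number of steps made before halting, cut off at N.

steps : ∀ {M N} → Vec Bool N → Config M → ℕ
steps ω       ⟨ []    , σ ⟩ = 0
steps []      ⟨ _ ∷ _ , σ ⟩ = 0
steps (b ∷ ω) ⟨ p ∷ K , σ ⟩ = suc (steps ω (next b ⟨ p ∷ K , σ ⟩))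

sumOverCoins : ∀ N → (Vec Bool N → ℕ) → ℕ
sumOverCoins zero    f = f []
sumOverCoins (suc N) f =
  sumOverCoins N (f ∘ (false ∷_)) ℕ.+ sumOverCoins N (f ∘ (true ∷_))

-- The expected running time T is at most B iff E[min(T , N)] ≤ B for
-- all N (monotone convergence), and min(T , N) depends only on the first
-- N coins.  In particular the program then halts with probability 1.

ExpectedTime≤ : Program randomized → Value → ℕ → Set
ExpectedTime≤ p x B =
  ∀ N → sumOverCoins N (λ ω → steps ω (start p x)) ℕ.≤ B ℕ.* 2 ℕ.^ N

-- A hypergraph is given as the list of its hyperedges, each one a list
-- of vertex names; isolated vertices are not part of the input, and do
-- not contribute to its size.  A set of hyperedges is given by its
-- characteristic vector.

encodeSet : ∀ {n} → Subset n → Value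
encodeSet {n} S = list (List.map (atom ∘ toℕ) (filter (_∈? S) (allFin n)))

encodeHypergraph : ∀ {n m} → Hypergraph n m → Value
encodeHypergraph {m = m} H =
  list (List.map (encodeSet ∘ Hypergraph.edge H) (allFin m))

encodeSeparator : ∀ {m} → Subset m → Value
encodeSeparator R = list (List.map bit (Vec.toList R))

-- The output is correct on every halting run (no error is allowed).

AlwaysFinds : ∀ {M n m} → Program M → Hypergraph n m → (Subset m → Set) → Set
AlwaysFinds p H P = ∀ t (ω : Vec Bool t) →
  let C = run ω (start p (encodeHypergraph H)) in
  Halted C → ∃[ R ] output C ≡ encodeSeparator R × P R

HaltsIn : Program deterministic → Value → ℕ → Set
HaltsIn p x t = ∀ (ω : Vec Bool t) → Halted (run ω (start p x))

{-# OPTIONS --safe #-}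

-- Put every vertex inside with probability p = 2^(-1/r) and outside
-- otherwise.  An edge of size at most r is wholly inside with probability
-- at least 1/2 and wholly outside with probability at least ε_r; removing
-- the crossing edges, and the surplus over m/2 on either side, leaves no
-- component that meets more than m/2 edges.
--
-- Both expectations are attained up to o(m) by a deterministic greedy
-- process, which therefore serves as the randomized and as the
-- deterministic algorithm.  Let M and N be the conditional expectations of
-- the two counts, given the vertices placed so far.  A random placement of
-- the next vertex changes neither on average, and changes each by at most
-- the degree k, so one of the two placements increases
-- Φ = (M₀ − M)₊² + (N₀ − N)₊² by at most 2 k².  After at most r m
-- placements Φ ≤ 2 r m k² = o(m²).  The probability p is replaced by a / b
-- with b = m + 5 and a least such that a / b ≥ p; the weights are then
-- integers after scaling by b^r.

module Submission where

open import Defs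
open import Data.Product.Base using (_×_; _,_; Σ-syntax; ∃-syntax; proj₁; proj₂)
open import Data.Sum.Base using (_⊎_; inj₁; inj₂)
open import Relation.Binary.PropositionalEquality
open import Relation.Nullary using (yes; no; contradiction)

-- The bias 2^(-1/r) is the one at which the inside already receives half of the hyperedges, the
-- most that one side may keep. Squares enter because each placement must protect two counts at
-- once: a weighted sum of the expectations would let a gain on one side pay for a loss on the
-- other, whereas the linear part of the change of Φ averages to zero and only the second-order term
-- accumulates. The process is polynomial, so the exponential time bound only has to be shown to
-- dominate a polynomial. This comes down to 1 - 2 ε_r² > 0, which follows from ε_r < 1/3 for r ≥ 2.
-- Cuts come without their laws, so each inequality between cuts is proved by exhibiting rational
-- endpoints. As `≤ᶜ` compares lower cuts, the size bound rests on one sharp rational above ε_r; the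
-- other endpoints that interval multiplication asks for may be crude. Programs are assembled from
-- combinators that carry code, running time and output growth together. No combinator flips a coin,
-- so one piece of code lives in both modes.

module Powers where

  open import Data.Nat.Base using (ℕ; zero; suc; _+_; _*_; _^_; _≤_)
  open import Data.Nat.Properties
  open import Data.Nat.Tactic.RingSolver using (solve-∀)

  ^-distribʳ-* : ∀ k m n → (m * n) ^ k ≡ m ^ k * n ^ k
  ^-distribʳ-* zero    m n = refl
  ^-distribʳ-* (suc k) m n = trans (cong (m * n *_) (^-distribʳ-* k m n))
                                   ([m*n]*[o*p]≡[m*o]*[n*p] m n (m ^ k) (n ^ k))

  -- Each of the r factors grows by c, and the others are at most b, so the r-th power grows by at
  -- most c r b^(r-1); the extra factor b keeps the exponent r. With c = 3 and m ≤ b this turns the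
  -- rounding of the bias into 3 r hyperedges.
  ^-shift : ∀ r x c {b} → x + c ≤ b → b * (x + c) ^ r ≤ b * x ^ r + c * r * b ^ r
  ^-shift zero    x c       x+c≤b = m≤m+n _ _
  ^-shift (suc r) x c {b} x+c≤b = begin
    b * ((x + c) * (x + c) ^ r)                             ≡⟨ expand b x c ((x + c) ^ r) ⟩
    x * (b * (x + c) ^ r) + c * b * (x + c) ^ r             ≤⟨ +-mono-≤ (*-monoʳ-≤ x (^-shift r x c x+c≤b))
                                                                       (*-monoʳ-≤ (c * b) (^-monoˡ-≤ r x+c≤b)) ⟩
    x * (b * x ^ r + c * r * b ^ r) + c * b * b ^ r         ≡⟨ cong (_+ c * b * b ^ r) (*-distribˡ-+ x (b * x ^ r) _) ⟩
    x * (b * x ^ r) + x * (c * r * b ^ r) + c * b * b ^ r   ≤⟨ +-monoˡ-≤ (c * b * b ^ r) (+-monoʳ-≤ (x * (b * x ^ r))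
                                                                 (*-monoˡ-≤ (c * r * b ^ r) (≤-trans (m≤m+n x c) x+c≤b))) ⟩
    x * (b * x ^ r) + b * (c * r * b ^ r) + c * b * b ^ r   ≡⟨ collect′ b x c r (x ^ r) (b ^ r) ⟩
    b * (x * x ^ r) + c * suc r * (b * b ^ r)               ∎
    where
    open ≤-Reasoning
    expand : ∀ b x c p → b * ((x + c) * p) ≡ x * (b * p) + c * b * p
    expand = solve-∀
    collect′ : ∀ b x c r p q → x * (b * p) + b * (c * r * q) + c * b * q ≡ b * (x * p) + c * suc r * (b * q)
    collect′ = solve-∀

-- Cut arithmetic: rational bounds for 2^(-1/r) and ε_r, and the two final inequalities between
-- cuts.

module Cuts where

  open Powers
  open import Data.Nat.Base as ℕ using (ℕ; zero; suc; NonZero; z≤n; s≤s)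
  import Data.Nat.Properties as ℕ
  open import Data.Nat.Coprimality using (1-coprimeTo) renaming (sym to coprime-sym)
  open import Data.Nat.Tactic.RingSolver using (solve-∀)
  open import Data.Integer.Base as ℤ using (ℤ; +_; -[1+_])
  import Data.Integer.Properties as ℤ
  open import Data.Rational.Base as ℚ
    using (ℚ; mkℚ; 0ℚ; 1ℚ; ½; _+_; _*_; _-_; -_; _<_; _≤_; *<*; *≤*; Positive)
  import Data.Rational.Properties as ℚ
  open import Data.Rational.Solver
  open import Data.Rational.Unnormalised.Base as ℚᵘ using (mkℚᵘ)
  import Data.Rational.Unnormalised.Properties as ℚᵘ
  open import Relation.Nullary.Decidable using (True; toWitness)
  import Algebra.Definitions.RawSemiring ℚ.+-*-rawSemiring as ℚ-Exp

  infixr 8 _^_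
  _^_ : ℚ → ℕ → ℚ
  _^_ = ℚ-Exp._^_

  -- Rationals as quotients of natural numbers

  -- `+ n / 1` normalises through a gcd and is stuck for a variable n. Here numerator and
  -- denominator are visible, so signs and comparisons compute.
  ι : ℕ → ℚ
  ι n = mkℚ (+ n) 0 (coprime-sym (1-coprimeTo n))

  ι≡ : ∀ n → (+ n) ℚ./ 1 ≡ ι n
  ι≡ n = ℚ.↥p/↧p≡p (ι n)

  ι-+ : ∀ m n → ι m + ι n ≡ ι (m ℕ.+ n)
  ι-+ m n = trans (cong (ℚ._/ 1) (cong₂ ℤ._+_ (ℤ.*-identityʳ (+ m)) (ℤ.*-identityʳ (+ n)))) (ι≡ (m ℕ.+ n))

  ι-* : ∀ m n → ι m * ι n ≡ ι (m ℕ.* n)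
  ι-* m n = trans (cong (ℚ._/ 1) (sym (ℤ.pos-* m n))) (ι≡ (m ℕ.* n))

  ι-mono-≤ : ∀ {m n} → m ℕ.≤ n → ι m ≤ ι n
  ι-mono-≤ m≤n = *≤* (ℤ.*-monoʳ-≤-nonNeg (+ 1) (ℤ.+≤+ m≤n))

  ι-mono-< : ∀ {m n} → m ℕ.< n → ι m < ι n
  ι-mono-< m<n = *<* (ℤ.*-monoʳ-<-pos (+ 1) (ℤ.+<+ m<n))

  ι-positive : ∀ n → .{{_ : NonZero n}} → Positive (ι n)
  ι-positive (suc n) = _

  -- A fraction that need not be in lowest terms: sums, products and powers are formed by
  -- cross-multiplication with no gcd, and comparisons become inequalities in ℕ.
  record Quotient (p : ℚ) (n d : ℕ) : Set where
    constructor quotient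
    field rescale : p * ι d ≡ ι n

  open Quotient

  infixl 7 _÷_
  _÷_ : ℕ → (d : ℕ) → .{{NonZero d}} → ℚ
  n ÷ suc d = ι n * (ℚ.1/ ι (suc d))

  quotient-÷ : ∀ n d → .{{_ : NonZero d}} → Quotient (n ÷ d) n d
  quotient-÷ n (suc d) = quotient (trans (ℚ.*-assoc (ι n) (ℚ.1/ ι (suc d)) (ι (suc d)))
    (trans (cong (ι n *_) (ℚ.*-inverseˡ (ι (suc d)))) (ℚ.*-identityʳ (ι n))))

  quotient-ι : ∀ n → Quotient (ι n) n 1
  quotient-ι n = quotient (ℚ.*-identityʳ (ι n))

  module _ {p q n n′ d d′} (p≐ : Quotient p n d) (q≐ : Quotient q n′ d′) where
    open +-*-Solver
    open ≡-Reasoning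

    quotient-* : Quotient (p * q) (n ℕ.* n′) (d ℕ.* d′)
    quotient-* = quotient (begin
      p * q * ι (d ℕ.* d′)          ≡⟨ cong (p * q *_) (ι-* d d′) ⟨
      p * q * (ι d * ι d′)          ≡⟨ solve 4 (λ a b c e → a :* b :* (c :* e) := (a :* c) :* (b :* e)) refl p q (ι d) (ι d′) ⟩
      (p * ι d) * (q * ι d′)        ≡⟨ cong₂ _*_ (rescale p≐) (rescale q≐) ⟩
      ι n * ι n′                    ≡⟨ ι-* n n′ ⟩
      ι (n ℕ.* n′)                  ∎)

    quotient-+ : Quotient (p + q) (n ℕ.* d′ ℕ.+ n′ ℕ.* d) (d ℕ.* d′)
    quotient-+ = quotient (begin
      (p + q) * ι (d ℕ.* d′)                     ≡⟨ cong ((p + q) *_) (ι-* d d′) ⟨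
      (p + q) * (ι d * ι d′)                     ≡⟨ solve 4 (λ a b c e → (a :+ b) :* (c :* e) := (a :* c) :* e :+ (b :* e) :* c) refl p q (ι d) (ι d′) ⟩
      (p * ι d) * ι d′ + (q * ι d′) * ι d        ≡⟨ cong₂ (λ x y → x * ι d′ + y * ι d) (rescale p≐) (rescale q≐) ⟩
      ι n * ι d′ + ι n′ * ι d                    ≡⟨ cong₂ _+_ (ι-* n d′) (ι-* n′ d) ⟩
      ι (n ℕ.* d′) + ι (n′ ℕ.* d)                ≡⟨ ι-+ (n ℕ.* d′) (n′ ℕ.* d) ⟩
      ι (n ℕ.* d′ ℕ.+ n′ ℕ.* d)                  ∎)

    private
      p-scaled : p * ι (d ℕ.* d′) ≡ ι (n ℕ.* d′)
      p-scaled = begin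
        p * ι (d ℕ.* d′)        ≡⟨ cong (p *_) (ι-* d d′) ⟨
        p * (ι d * ι d′)        ≡⟨ ℚ.*-assoc p (ι d) (ι d′) ⟨
        p * ι d * ι d′          ≡⟨ cong (_* ι d′) (rescale p≐) ⟩
        ι n * ι d′              ≡⟨ ι-* n d′ ⟩
        ι (n ℕ.* d′)            ∎

      q-scaled : q * ι (d ℕ.* d′) ≡ ι (n′ ℕ.* d)
      q-scaled = begin
        q * ι (d ℕ.* d′)        ≡⟨ cong (λ x → q * ι x) (ℕ.*-comm d d′) ⟩
        q * ι (d′ ℕ.* d)        ≡⟨ cong (q *_) (ι-* d′ d) ⟨
        q * (ι d′ * ι d)        ≡⟨ ℚ.*-assoc q (ι d′) (ι d) ⟨
        q * ι d′ * ι d          ≡⟨ cong (_* ι d) (rescale q≐) ⟩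
        ι n′ * ι d              ≡⟨ ι-* n′ d ⟩
        ι (n′ ℕ.* d)            ∎

    quotient-< : .{{_ : NonZero d}} → .{{_ : NonZero d′}} → n ℕ.* d′ ℕ.< n′ ℕ.* d → p < q
    quotient-< lt = ℚ.*-cancelʳ-<-nonNeg (ι (d ℕ.* d′)) (subst₂ _<_ (sym p-scaled) (sym q-scaled) (ι-mono-< lt))

    quotient-≤ : .{{_ : NonZero d}} → .{{_ : NonZero d′}} → n ℕ.* d′ ℕ.≤ n′ ℕ.* d → p ≤ q
    quotient-≤ le = ℚ.*-cancelʳ-≤-pos (ι (d ℕ.* d′)) {{ι-positive (d ℕ.* d′) {{ℕ.m*n≢0 d d′}}}}
      (subst₂ _≤_ (sym p-scaled) (sym q-scaled) (ι-mono-≤ le))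

  quotient-^ : ∀ {p n d} → Quotient p n d → ∀ k → Quotient (p ^ k) (n ℕ.^ k) (d ℕ.^ k)
  quotient-^ p≐ zero    = quotient refl
  quotient-^ p≐ (suc k) = quotient-* p≐ (quotient-^ p≐ k)

  quotient-½ : Quotient ½ 1 2
  quotient-½ = quotient refl

  /-mono-< : ∀ p q c d → p ℤ.* + suc d ℤ.< q ℤ.* + suc c → p ℚ./ suc c < q ℚ./ suc d
  /-mono-< p q c d lt = ℚ.toℚᵘ-cancel-< (ℚᵘ.<-respʳ-≃ (ℚᵘ.≃-sym (ℚ.toℚᵘ-fromℚᵘ (mkℚᵘ q d)))
    (ℚᵘ.<-respˡ-≃ (ℚᵘ.≃-sym (ℚ.toℚᵘ-fromℚᵘ (mkℚᵘ p c))) (ℚᵘ.*<* lt)))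

  evidently : ∀ {p q} → {True (p ℚ.<? q)} → p < q
  evidently {p} {q} {t} = toWitness t

  -- Cuts

  +<⇒<- : ∀ {p q} r → p + q < r → p < r - q
  +<⇒<- {p} {q} r p+q<r = subst (_< r - q) (solve 2 (λ p q → p :+ q :- q := p) refl p q) (ℚ.+-monoˡ-< (- q) p+q<r)
    where open +-*-Solver

  <+⇒-< : ∀ {p q r} → p < q + r → p - r < q
  <+⇒-< {p} {q} {r} p<q+r = subst (p - r <_) (solve 2 (λ q r → q :+ r :- r := q) refl q r) (ℚ.+-monoˡ-< (- r) p<q+r)
    where open +-*-Solver

  -- The lower cut of `rat c` excludes c itself, so density supplies a rational strictly between q +
  -- a and c as the endpoint.
  lower-- : ∀ {y q a} c → upper y a → q + a < c → lower (rat c -ᶜ y) q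
  lower-- {y} {q} {a} c y<a q+a<c with ℚ.<-dense q+a<c
  ... | e , q+a<e , e<c = e , a , e<c , y<a , +<⇒<- e q+a<e

  upper-- : ∀ {y q a} c → lower y a → c < q + a → upper (rat c -ᶜ y) q
  upper-- {y} {q} {a} c a<y c<q+a with ℚ.<-dense c<q+a
  ... | e , c<e , e<q+a = e , a , c<e , a<y , <+⇒-< e<q+a

  *ᶜ-upper-mono : ∀ {x y q q′} → q ≤ q′ → upper (x *ᶜ y) q → upper (x *ᶜ y) q′
  *ᶜ-upper-mono q≤q′ (a , b , c , d , x₁ , x₂ , y₁ , y₂ , ac , ad , bc , bd) =
    a , b , c , d , x₁ , x₂ , y₁ , y₂ , weaken ac , weaken ad , weaken bc , weaken bd
    where
    weaken : ∀ {p} → p < _ → p < _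
    weaken p<q = ℚ.<-≤-trans p<q q≤q′

  neg-product : ∀ p q → (- p) * q ≡ - (p * q)
  neg-product p q = sym (ℚ.neg-distribˡ-* p q)

  _Within_ : Cut → ℚ → Set
  x Within b = lower x (- b) × upper x b

  -- For intervals symmetric about 0 the four corner products are b d or - b d, so the single
  -- inequality b d < q settles all eight conditions.
  within-* : ∀ {x y b d q} → 0ℚ < b → 0ℚ < d → x Within b → y Within d → b * d < q → (x *ᶜ y) Within q
  within-* {x} {y} {b} {d} {q} 0<b 0<d (x₁ , x₂) (y₁ , y₂) bd<q =
    (- b , b , - d , d , x₁ , x₂ , y₁ , y₂
      , subst (- q <_) (sym negneg) (ℚ.<-trans (ℚ.neg-antimono-< 0<q) 0<bd)
      , subst (- q <_) (sym (neg-product b d)) (ℚ.neg-antimono-< bd<q)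
      , subst (- q <_) (sym posneg) (ℚ.neg-antimono-< bd<q)
      , ℚ.<-trans (ℚ.neg-antimono-< 0<q) 0<bd)
    , (- b , b , - d , d , x₁ , x₂ , y₁ , y₂
      , subst (_< q) (sym negneg) bd<q
      , subst (_< q) (sym (neg-product b d)) (ℚ.<-trans (ℚ.neg-antimono-< 0<bd) 0<q)
      , subst (_< q) (sym posneg) (ℚ.<-trans (ℚ.neg-antimono-< 0<bd) 0<q)
      , bd<q)
    where
    open +-*-Solver
    negneg : (- b) * (- d) ≡ b * d
    negneg = solve 2 (λ b d → (:- b) :* (:- d) := b :* d) refl b d
    posneg : b * (- d) ≡ - (b * d)
    posneg = solve 2 (λ b d → b :* (:- d) := :- (b :* d)) refl b d
    0<bd : 0ℚ < b * d
    0<bd = subst (_< b * d) (ℚ.*-zeroʳ b) (ℚ.*-monoʳ-<-pos b {{ℚ.positive 0<b}} 0<d)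
    0<q : 0ℚ < q
    0<q = ℚ.<-trans 0<bd bd<q

  -- Powers of a cut x ∈ (0 , u) with u < 1; a strict bound for the power
  -- zero needs some v > 1.
  module _ {x : Cut} {u u′ v : ℚ} (0<x : lower x 0ℚ) (x<u : upper x u) (0<u : 0ℚ < u) (u<1 : u < 1ℚ)
           (u<u′ : u < u′) (1<v : 1ℚ < v) where
    private
      0<u′ : 0ℚ < u′
      0<u′ = ℚ.<-trans 0<u u<u′
      0<v : 0ℚ < v
      0<v = ℚ.<-trans evidently 1<v

    power-bound : ℕ → ℚ
    power-bound j = u′ ^ j * v

    private
      u′^-positive : ∀ j → Positive (u′ ^ j)
      u′^-positive zero    = _
      u′^-positive (suc j) = ℚ.pos*pos⇒pos u′ {{ℚ.positive 0<u′}} (u′ ^ j) {{u′^-positive j}}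

      bound-positive : ∀ j → 0ℚ < power-bound j
      bound-positive j = ℚ.positive⁻¹ (power-bound j)
        {{ℚ.pos*pos⇒pos (u′ ^ j) {{u′^-positive j}} v {{ℚ.positive 0<v}}}}

      u*pos : ∀ {w} → 0ℚ < w → 0ℚ < u * w
      u*pos {w} 0<w = subst (_< u * w) (ℚ.*-zeroʳ u) (ℚ.*-monoʳ-<-pos u {{ℚ.positive 0<u}} 0<w)

      u*neg : ∀ {q} → q < 0ℚ → u * q < 0ℚ
      u*neg {q} q<0 = subst (u * q <_) (ℚ.*-zeroʳ u) (ℚ.*-monoʳ-<-pos u {{ℚ.positive 0<u}} q<0)

      q<u*q : ∀ {q} → q < 0ℚ → q < u * q
      q<u*q {q} q<0 = subst (_< u * q) (ℚ.*-identityˡ q) (ℚ.*-monoˡ-<-neg q {{ℚ.negative q<0}} u<1)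

    mutual
      -- Interval multiplication asks for both endpoints of both factors, so the two bounds are
      -- proved together. Any negative q will do from below: the corners with endpoint 0 vanish, and
      -- q < u q because u < 1. The step from u to u′ provides the strictness from above.
      power-lower : ∀ j {q} → q < 0ℚ → lower (x ^ᶜ j) q
      power-lower zero    q<0 = ℚ.<-trans q<0 evidently
      power-lower (suc j) {q} q<0 = 0ℚ , u , q , power-bound j , 0<x , x<u , power-lower j q<0 , power-upper j
        , subst (q <_) (sym (ℚ.*-zeroˡ q)) q<0
        , subst (q <_) (sym (ℚ.*-zeroˡ (power-bound j))) q<0
        , q<u*q q<0
        , ℚ.<-trans q<0 (u*pos (bound-positive j))

      power-upper : ∀ j → upper (x ^ᶜ j) (power-bound j)
      power-upper zero    = subst (1ℚ <_) (sym (ℚ.*-identityˡ v)) 1<v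
      power-upper (suc j) = 0ℚ , u , - 1ℚ , power-bound j , 0<x , x<u , power-lower j evidently , power-upper j
        , positive (ℚ.*-zeroˡ (- 1ℚ))
        , positive (ℚ.*-zeroˡ (power-bound j))
        , ℚ.<-trans (u*neg evidently) (bound-positive (suc j))
        , subst (u * power-bound j <_) (sym (ℚ.*-assoc u′ (u′ ^ j) v))
            (ℚ.*-monoˡ-<-pos (power-bound j) {{ℚ.positive (bound-positive j)}} u<u′)
        where
        positive : ∀ {w} → w ≡ 0ℚ → w < power-bound (suc j)
        positive refl = bound-positive (suc j)

  -- The cut 2^(-1/r)

  -- This is (1 + 1/x)^N ≥ 1 + N/x with the denominators cleared.
  bernoulli : ∀ x N → (x ℕ.+ N) ℕ.* x ℕ.^ N ℕ.≤ x ℕ.* suc x ℕ.^ N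
  bernoulli x zero    = ℕ.≤-reflexive (cong (ℕ._* 1) (ℕ.+-identityʳ x))
  bernoulli x (suc N) = begin
    (x ℕ.+ suc N) ℕ.* (x ℕ.* x ℕ.^ N)                   ≤⟨ ℕ.m≤m+n _ (N ℕ.* x ℕ.^ N) ⟩
    (x ℕ.+ suc N) ℕ.* (x ℕ.* x ℕ.^ N) ℕ.+ N ℕ.* x ℕ.^ N ≡⟨ regroup x N (x ℕ.^ N) ⟩
    suc x ℕ.* ((x ℕ.+ N) ℕ.* x ℕ.^ N)                   ≤⟨ ℕ.*-monoʳ-≤ (suc x) (bernoulli x N) ⟩
    suc x ℕ.* (x ℕ.* suc x ℕ.^ N)                       ≡⟨ swap (suc x) x (suc x ℕ.^ N) ⟩
    x ℕ.* (suc x ℕ.* suc x ℕ.^ N)                       ∎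
    where
    open ℕ.≤-Reasoning
    regroup : ∀ x N p → (x ℕ.+ suc N) ℕ.* (x ℕ.* p) ℕ.+ N ℕ.* p ≡ suc x ℕ.* ((x ℕ.+ N) ℕ.* p)
    regroup = solve-∀
    swap : ∀ a b c → a ℕ.* (b ℕ.* c) ≡ b ℕ.* (a ℕ.* c)
    swap = solve-∀

  -- Since y ≥ x + 1, the ratio is at least (1 + 1/x)^(x+1) ≥ 1 + (x + 1)/x > 2. A strict inequality
  -- of integers thus becomes a factor 2 at an explicit exponent, as comparison with a power of 2
  -- requires.
  doubling : ∀ {x y} → x ℕ.< y → 2 ℕ.* x ℕ.^ suc x ℕ.< y ℕ.^ suc x
  doubling {zero}  {y} 0<y = ℕ.≤-trans 0<y (ℕ.≤-reflexive (sym (ℕ.*-identityʳ y)))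
  doubling {x@(suc x′)} {y} x<y = ℕ.<-≤-trans (ℕ.*-cancelˡ-< x _ _ (begin-strict
    x ℕ.* (2 ℕ.* x ℕ.^ suc x)                        <⟨ ℕ.m<m+n _ (ℕ.m^n>0 x (suc x)) ⟩
    x ℕ.* (2 ℕ.* x ℕ.^ suc x) ℕ.+ x ℕ.^ suc x        ≡⟨ regroup x (x ℕ.^ suc x) ⟩
    (x ℕ.+ suc x) ℕ.* x ℕ.^ suc x                    ≤⟨ bernoulli x (suc x) ⟩
    x ℕ.* suc x ℕ.^ suc x                            ∎)) (ℕ.^-monoˡ-≤ (suc x) x<y)
    where
    open ℕ.≤-Reasoning
    regroup : ∀ x p → x ℕ.* (2 ℕ.* p) ℕ.+ p ≡ (x ℕ.+ suc x) ℕ.* p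
    regroup = solve-∀

  module _ (r′ : ℕ) where
    private
      r = suc r′

    root : Cut
    root = 2^ᶜ rat (-[1+ 0 ] ℚ./ r)

    -- (x / b)^(r N) < 2^-(N+1) with N = 2 x^r + 1, since 2 (2 x^r)^N < (b^r)^N.
    root-lower : ∀ x b → .{{_ : NonZero b}} → x ℕ.^ r ℕ.+ x ℕ.^ r ℕ.< b ℕ.^ r → lower root (x ÷ b)
    root-lower x b 2x^r<b^r = inj₂ (-[1+ N ] , N₀ ℕ.+ r′ ℕ.* N , below , powers)
      where
      y  = x ℕ.^ r ℕ.+ x ℕ.^ r
      N₀ = y
      N  = suc N₀
      below : -[1+ N ] ℚ./ suc (N₀ ℕ.+ r′ ℕ.* N) < -[1+ 0 ] ℚ./ r
      below = /-mono-< (-[1+ N ]) (-[1+ 0 ]) (N₀ ℕ.+ r′ ℕ.* N) r′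
        (ℤ.-<- (ℕ.≤-trans (ℕ.m≤m+n _ r′) (ℕ.≤-reflexive (arith N₀ r′))))
        where
        arith : ∀ n r → suc (n ℕ.+ r ℕ.* suc n ℕ.+ 0) ℕ.+ r ≡ r ℕ.+ suc n ℕ.* suc r
        arith = solve-∀
      powers : (x ÷ b) ^ suc (N₀ ℕ.+ r′ ℕ.* N) < ½ ^ suc N
      powers = quotient-<
        (quotient-^ (quotient-÷ x b) (r ℕ.* N)) (quotient-^ quotient-½ (suc N))
        {{ℕ.m^n≢0 b (r ℕ.* N)}} {{ℕ.m^n≢0 2 (suc N)}} (begin-strict
          x ℕ.^ (r ℕ.* N) ℕ.* 2 ℕ.^ suc N              ≡⟨ cong (ℕ._* 2 ℕ.^ suc N) (ℕ.^-*-assoc x r N) ⟨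
          (x ℕ.^ r) ℕ.^ N ℕ.* (2 ℕ.* 2 ℕ.^ N)          ≡⟨ regroup ((x ℕ.^ r) ℕ.^ N) (2 ℕ.^ N) ⟩
          2 ℕ.* ((x ℕ.^ r) ℕ.^ N ℕ.* 2 ℕ.^ N)          ≡⟨ cong (2 ℕ.*_) (^-distribʳ-* N (x ℕ.^ r) 2) ⟨
          2 ℕ.* (x ℕ.^ r ℕ.* 2) ℕ.^ N                  ≡⟨ cong (λ z → 2 ℕ.* z ℕ.^ N) (double (x ℕ.^ r)) ⟩
          2 ℕ.* y ℕ.^ N                                <⟨ doubling 2x^r<b^r ⟩
          (b ℕ.^ r) ℕ.^ N                              ≡⟨ ℕ.^-*-assoc b r N ⟩
          b ℕ.^ (r ℕ.* N)                              ≡⟨ ℕ.*-identityˡ _ ⟨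
          1 ℕ.* b ℕ.^ (r ℕ.* N)                        ≡⟨ cong (ℕ._* b ℕ.^ (r ℕ.* N)) (ℕ.^-zeroˡ (suc N)) ⟨
          1 ℕ.^ suc N ℕ.* b ℕ.^ (r ℕ.* N)              ∎)
        where
        open ℕ.≤-Reasoning
        regroup : ∀ p q → p ℕ.* (2 ℕ.* q) ≡ 2 ℕ.* (p ℕ.* q)
        regroup = solve-∀
        double : ∀ p → p ℕ.* 2 ≡ p ℕ.+ p
        double = solve-∀

    -- (1 − 1/(2r+4))^(r+1) > 1/2 by Bernoulli's inequality.
    root-upper : ∃[ q ] q < 1ℚ × upper root q
    root-upper = x ÷ suc x , q<1 , 0<q , -[1+ 0 ] , r , above , powers
      where
      k = suc r
      x = suc (2 ℕ.* k)
      Y = suc x ℕ.^ k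
      q<1 : x ÷ suc x < 1ℚ
      q<1 = quotient-< (quotient-÷ x (suc x)) (quotient-ι 1)
        (ℕ.≤-reflexive (arith x))
        where
        arith : ∀ x → suc (x ℕ.* 1) ≡ 1 ℕ.* suc x
        arith = solve-∀
      0<q : 0ℚ < x ÷ suc x
      0<q = quotient-< (quotient-ι 0) (quotient-÷ x (suc x)) (s≤s z≤n)
      above : -[1+ 0 ] ℚ./ r < -[1+ 0 ] ℚ./ suc r
      above = /-mono-< (-[1+ 0 ]) (-[1+ 0 ]) r′ r (ℤ.-<- ℕ.≤-refl)
      shifted : suc x ℕ.* Y ℕ.≤ suc x ℕ.* x ℕ.^ k ℕ.+ k ℕ.* Y
      shifted = subst₂ (λ z t → suc x ℕ.* z ℕ.^ k ℕ.≤ suc x ℕ.* x ℕ.^ k ℕ.+ t ℕ.* Y)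
        (ℕ.+-comm x 1) (ℕ.*-identityˡ k) (^-shift k x 1 (ℕ.≤-reflexive (ℕ.+-comm x 1)))
      powers : ½ ^ 1 < (x ÷ suc x) ^ k
      powers = quotient-< (quotient-^ quotient-½ 1) (quotient-^ (quotient-÷ x (suc x)) k)
        {{_}} {{ℕ.m^n≢0 (suc x) k}} (ℕ.*-cancelˡ-< (suc x) _ _ (ℕ.+-cancelʳ-< (2 ℕ.* (k ℕ.* Y)) _ _ (begin-strict
          suc x ℕ.* (1 ℕ.* Y) ℕ.+ 2 ℕ.* (k ℕ.* Y)            <⟨ ℕ.m<m+n _ (ℕ.≤-trans (ℕ.m^n>0 (suc x) k) (ℕ.m≤m+n Y (Y ℕ.+ 0))) ⟩
          suc x ℕ.* (1 ℕ.* Y) ℕ.+ 2 ℕ.* (k ℕ.* Y) ℕ.+ 2 ℕ.* Y ≡⟨ regroup k Y ⟩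
          2 ℕ.* (suc x ℕ.* Y)                                ≤⟨ ℕ.*-monoʳ-≤ 2 shifted ⟩
          2 ℕ.* (suc x ℕ.* x ℕ.^ k ℕ.+ k ℕ.* Y)              ≡⟨ spread (suc x) (x ℕ.^ k) (k ℕ.* Y) ⟩
          suc x ℕ.* (x ℕ.^ k ℕ.* 2) ℕ.+ 2 ℕ.* (k ℕ.* Y)      ∎)))
        where
        open ℕ.≤-Reasoning
        regroup : ∀ k y → suc (suc (2 ℕ.* k)) ℕ.* (1 ℕ.* y) ℕ.+ 2 ℕ.* (k ℕ.* y) ℕ.+ 2 ℕ.* y ≡ 2 ℕ.* (suc (suc (2 ℕ.* k)) ℕ.* y)
        regroup = solve-∀
        spread : ∀ s p y → 2 ℕ.* (s ℕ.* p ℕ.+ y) ≡ s ℕ.* (p ℕ.* 2) ℕ.+ 2 ℕ.* y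
        spread = solve-∀

  -- The cuts in the statement

  module _ (r′ : ℕ) where
    private
      r = suc r′
      base : Cut
      base = nat 1 -ᶜ root r′

    base-positive : lower base 0ℚ
    base-positive = from (root-upper r′)
      where
      from : ∃[ q ] q < 1ℚ × upper (root r′) q → lower base 0ℚ
      from (q , q<1 , root<q) = lower-- {root r′} {0ℚ} {q} 1ℚ root<q (subst (_< 1ℚ) (sym (ℚ.+-identityˡ q)) q<1)

    base-upper : ∀ {u q} → lower (root r′) q → 1ℚ < u + q → upper base u
    base-upper {u} {q} q<root 1<u+q = upper-- {root r′} {u} {q} 1ℚ q<root 1<u+q

  -- a / b < 2^(-1/r) gives 1 − 2^(-1/r) < (a′ + 2)/b; the numerator a′ + 3 and
  -- the factor 1 + 1/b keep the bounds strict for all powers.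
  module _ (r′ a a′ b : ℕ) .{{_ : NonZero b}} (a+a′≡b : suc a ℕ.+ a′ ≡ b) (a′+3≤b : a′ ℕ.+ 3 ℕ.≤ b)
           (2a^r<b^r : a ℕ.^ suc r′ ℕ.+ a ℕ.^ suc r′ ℕ.< b ℕ.^ suc r′) where
    private
      r = suc r′
      u  = (a′ ℕ.+ 2) ÷ b
      u′ = (a′ ℕ.+ 3) ÷ b
      v  = (b ℕ.+ 1) ÷ b

      1<u+q : 1ℚ < u + a ÷ b
      1<u+q = quotient-< (quotient-ι 1)
        (quotient-+ (quotient-÷ (a′ ℕ.+ 2) b) (quotient-÷ a b)) {{_}} {{ℕ.m*n≢0 b b}} (begin-strict
          1 ℕ.* (b ℕ.* b)                             ≡⟨ ℕ.*-identityˡ (b ℕ.* b) ⟩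
          b ℕ.* b                                     <⟨ ℕ.m<m+n (b ℕ.* b) (ℕ.>-nonZero⁻¹ b) ⟩
          b ℕ.* b ℕ.+ b                               ≡⟨ cong (λ z → z ℕ.* b ℕ.+ b) a+a′≡b ⟨
          (suc a ℕ.+ a′) ℕ.* b ℕ.+ b                  ≡⟨ regroup a a′ b ⟩
          ((a′ ℕ.+ 2) ℕ.* b ℕ.+ a ℕ.* b) ℕ.* 1        ∎)
        where
        open ℕ.≤-Reasoning
        regroup : ∀ a a′ b → (suc a ℕ.+ a′) ℕ.* b ℕ.+ b ≡ ((a′ ℕ.+ 2) ℕ.* b ℕ.+ a ℕ.* b) ℕ.* 1
        regroup = solve-∀

      0<u : 0ℚ < u
      0<u = quotient-< (quotient-ι 0) (quotient-÷ (a′ ℕ.+ 2) b)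
        (ℕ.≤-trans (ℕ.≤-trans (s≤s z≤n) (ℕ.m≤n+m 2 a′)) (ℕ.≤-reflexive (sym (ℕ.*-identityʳ _))))

      u<u′ : u < u′
      u<u′ = quotient-< (quotient-÷ (a′ ℕ.+ 2) b) (quotient-÷ (a′ ℕ.+ 3) b)
        (ℕ.*-monoˡ-< b (ℕ.+-monoʳ-< a′ ℕ.≤-refl))

      u<1 : u < 1ℚ
      u<1 = quotient-< (quotient-÷ (a′ ℕ.+ 2) b) (quotient-ι 1)
        (ℕ.≤-trans (ℕ.≤-reflexive (arith a′)) (ℕ.≤-trans a′+3≤b (ℕ.≤-reflexive (sym (ℕ.*-identityˡ b)))))
        where
        arith : ∀ a → suc ((a ℕ.+ 2) ℕ.* 1) ≡ a ℕ.+ 3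
        arith = solve-∀

      1<v : 1ℚ < v
      1<v = quotient-< (quotient-ι 1) (quotient-÷ (b ℕ.+ 1) b)
        (ℕ.≤-reflexive (arith b))
        where
        arith : ∀ b → suc (1 ℕ.* b) ≡ (b ℕ.+ 1) ℕ.* 1
        arith = solve-∀

      base<u : upper (nat 1 -ᶜ root r′) u
      base<u = base-upper r′ (root-lower r′ a b 2a^r<b^r) 1<u+q

    ε-bound : ℚ
    ε-bound = u′ ^ r * v

    ε<ε-bound : upper (ε r) ε-bound
    ε<ε-bound = power-upper {x = nat 1 -ᶜ root r′} (base-positive r′) base<u 0<u u<1 u<u′ 1<v r

    quotient-ε-bound : Quotient ε-bound ((a′ ℕ.+ 3) ℕ.^ r ℕ.* (b ℕ.+ 1)) (b ℕ.^ r ℕ.* b)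
    quotient-ε-bound = quotient-* (quotient-^ (quotient-÷ (a′ ℕ.+ 3) b) r) (quotient-÷ (b ℕ.+ 1) b)

  -- 2^(-1/r) > 3/5 since r ≥ 2.
  ε-within : ∀ k → ε (suc (suc k)) Within ((+ 1) ℚ./ 3)
  ε-within k = power-lower (base-positive r′) base<u evidently evidently u<u′ 1<v r evidently
    , *ᶜ-upper-mono {nat 1 -ᶜ root r′} bound≤⅓ (power-upper (base-positive r′) base<u evidently evidently u<u′ 1<v r)
    where
    r′ = suc k
    r  = suc r′
    base : Cut
    base = nat 1 -ᶜ root r′
    u u′ v : ℚ
    -- 1 - 3/5 < 9/20 < 1/2, and 4/3 is the largest v with (1/2)^r v ≤ 1/3 at r = 2.
    u  = (+ 9) ℚ./ 20
    u′ = ½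
    v  = (+ 4) ℚ./ 3
    u<u′ : u < u′
    u<u′ = evidently
    1<v : 1ℚ < v
    1<v = evidently
    3/5<root : lower (root r′) ((+ 3) ℚ./ 5)
    -- The exponent -2/3 lies below -1/r for every r ≥ 2, and (3/5)^3 = 27/125 < 1/4.
    3/5<root = inj₂ (-[1+ 1 ] , 2 , /-mono-< (-[1+ 1 ]) (-[1+ 0 ]) 2 r′ (ℤ.-<- (s≤s (ℕ.m≤n⇒m≤o+n k (s≤s (s≤s z≤n))))) , evidently)
    base<u : upper base u
    base<u = base-upper r′ 3/5<root evidently
    v≐ : Quotient v 4 3
    v≐ = quotient refl
    ⅓≐ : Quotient ((+ 1) ℚ./ 3) 1 3
    ⅓≐ = quotient refl
    bound≤⅓ : u′ ^ r * v ≤ (+ 1) ℚ./ 3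
    bound≤⅓ = quotient-≤
      (quotient-* (quotient-^ quotient-½ r) v≐) ⅓≐
      {{ℕ.m*n≢0 (2 ℕ.^ r) 3 {{ℕ.m^n≢0 2 r}}}} (begin
        1 ℕ.^ r ℕ.* 4 ℕ.* 3                    ≡⟨ cong (λ z → z ℕ.* 4 ℕ.* 3) (ℕ.^-zeroˡ r) ⟩
        12                                     ≤⟨ ℕ.*-monoʳ-≤ 12 (ℕ.m^n>0 2 k) ⟩
        12 ℕ.* 2 ℕ.^ k                         ≡⟨ arith (2 ℕ.^ k) ⟩
        1 ℕ.* (2 ℕ.^ r ℕ.* 3)                  ∎)
      where
      open ℕ.≤-Reasoning
      arith : ∀ p → 12 ℕ.* p ≡ 1 ℕ.* (2 ℕ.* (2 ℕ.* p) ℕ.* 3)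
      arith = solve-∀

  -- Inequalities between rationals, certified by their difference.

  infixl 6 _⊞_ _⊞<_

  _⊞_ : ∀ {p q} → 0ℚ ≤ p → 0ℚ ≤ q → 0ℚ ≤ p + q
  _⊞_ {p} {q} 0≤p 0≤q = subst (_≤ p + q) (ℚ.+-identityˡ 0ℚ) (ℚ.+-mono-≤ 0≤p 0≤q)

  _⊞<_ : ∀ {p q} → 0ℚ ≤ p → 0ℚ < q → 0ℚ < p + q
  _⊞<_ {p} {q} 0≤p 0<q = subst (_< p + q) (ℚ.+-identityˡ 0ℚ) (ℚ.+-mono-≤-< 0≤p 0<q)

  0≤* : ∀ {p q} → 0ℚ ≤ p → 0ℚ ≤ q → 0ℚ ≤ p * q
  0≤* {p} {q} 0≤p 0≤q = subst (_≤ p * q) (ℚ.*-zeroʳ p) (ℚ.*-monoˡ-≤-nonNeg p {{ℚ.nonNegative 0≤p}} 0≤q)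

  ≤⇒0≤- : ∀ {p q} → p ≤ q → 0ℚ ≤ q - p
  ≤⇒0≤- {p} {q} p≤q = subst (_≤ q - p) (ℚ.+-inverseʳ p) (ℚ.+-monoˡ-≤ (- p) p≤q)

  -- The difference d is exhibited as a sum of visibly nonnegative terms, and q = p + d is left to
  -- the ring solver.
  exceeds : ∀ {p q d} → 0ℚ < d → q ≡ p + d → p < q
  exceeds {p} {q} {d} 0<d q≡ = subst₂ _<_ (ℚ.+-identityʳ p) (sym q≡) (ℚ.+-monoʳ-< p 0<d)

  reaches : ∀ {p q d} → 0ℚ ≤ d → q ≡ p + d → p ≤ q
  reaches {p} {q} {d} 0≤d q≡ = subst₂ _≤_ (ℚ.+-identityʳ p) (sym q≡) (ℚ.+-monoʳ-≤ p 0≤d)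

  0≤ι : ∀ n → 0ℚ ≤ ι n
  0≤ι n = ι-mono-≤ {0} z≤n

  nat-lower : ∀ {n q} → q < ι n → lower (nat n) q
  nat-lower {n} {q} = subst (q <_) (sym (ι≡ n))

  nat-upper : ∀ {n q} → ι n < q → upper (nat n) q
  nat-upper {n} {q} = subst (_< q) (sym (ι≡ n))

  below-ι : ∀ n → ι n - 1ℚ < ι n
  below-ι n = exceeds {d = 1ℚ} evidently (solve 1 (λ x → x := x :- con 1ℚ :+ con 1ℚ) refl (ι n))
    where open +-*-Solver

  above-ι : ∀ n → ι n < ι n + 1ℚ
  above-ι n = exceeds {d = 1ℚ} evidently refl

  rational : ℕ → ℚ
  rational n = + n ℚ./ 1

  -- `V` is the rational above ε_r. The small `β` makes α = ½ - V - β lie strictly below ½ - e, and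
  -- β m ≤ 1 keeps its cost to one hyperedge. Since only the lower cut of the bound matters, one
  -- rational below (½ - e) m suffices, provided that it is below all four corners of the product.
  module SizeBound
    (e : Cut) {V β : ℚ} (e<V : upper e V) (-1/3<e : lower e (- ((+ 1) ℚ./ 3)))
    (0≤V : 0ℚ ≤ V) (V≤2 : V ≤ rational 2) (0<β : 0ℚ < β) (β≤1 : β ≤ 1ℚ)
    (m R kI kO s t : ℕ) (βm≤1 : β * ι m ≤ 1ℚ) (Vm≤ : V * ι m ≤ ι (kO ℕ.+ s ℕ.+ t ℕ.+ 2))
    (partition : R ℕ.+ (kI ℕ.+ kO) ≡ m) (half : m ℕ.≤ 2 ℕ.* kI ℕ.+ 1 ℕ.+ 2 ℕ.* s)
    where
    open +-*-Solver

    private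
      α c d lowest : ℚ
      α = ½ - V - β
      c = ι m - 1ℚ
      d = ι m + 1ℚ
      -- With V ≤ 2 and β ≤ 1, α can be as low as -5/2, so the corner α d = α c + 2 α may fall short
      -- of α c by 5; subtracting 6 stays strictly below every corner.
      lowest = α * c - rational 6

      0≤2-V : 0ℚ ≤ rational 2 - V
      0≤2-V = ≤⇒0≤- V≤2
      0≤1-β : 0ℚ ≤ 1ℚ - β
      0≤1-β = ≤⇒0≤- β≤1

      y : Cut
      y = rat ½ -ᶜ e

      α<y : lower y α
      α<y = lower-- {e} {α} {V} ½ e<V (exceeds 0<β (solve 3 (λ h v b → h := h :- v :- b :+ v :+ b) refl ½ V β))

      y<1 : upper y 1ℚ
      y<1 = upper-- {e} {1ℚ} { - ((+ 1) ℚ./ 3)} ½ -1/3<e evidently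

      ac : lowest < α * c
      ac = exceeds {d = rational 6} evidently (solve 2 (λ x k → x := x :- k :+ k) refl (α * c) (rational 6))

      ad : lowest < α * d
      ad = exceeds ((0≤2-V ⊞ 0≤2-V ⊞ 0≤1-β ⊞ 0≤1-β) ⊞< evidently {0ℚ} {1ℚ})
        (solve 3 (λ v b x → (con ½ :- v :- b) :* (x :+ con 1ℚ) :=
          (con ½ :- v :- b) :* (x :- con 1ℚ) :- con (rational 6) :+
          ((con (rational 2) :- v :+ (con (rational 2) :- v) :+ (con 1ℚ :- b) :+ (con 1ℚ :- b)) :+ con 1ℚ)) refl V β (ι m))

      bc : lowest < 1ℚ * c
      bc = exceeds ((0≤* (evidently-≤ ⊞ 0≤V ⊞ ℚ.<⇒≤ 0<β) (0≤ι m) ⊞ 0≤2-V ⊞ 0≤1-β) ⊞< evidently {0ℚ} {(+ 5) ℚ./ 2})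
        (solve 3 (λ v b x → con 1ℚ :* (x :- con 1ℚ) :=
          (con ½ :- v :- b) :* (x :- con 1ℚ) :- con (rational 6) :+
          ((con ½ :+ v :+ b) :* x :+ (con (rational 2) :- v) :+ (con 1ℚ :- b) :+ con ((+ 5) ℚ./ 2))) refl V β (ι m))
        where
        evidently-≤ : 0ℚ ≤ ½
        evidently-≤ = ℚ.<⇒≤ evidently

      bd : lowest < 1ℚ * d
      bd = ℚ.<-trans bc (subst₂ _<_ (sym (ℚ.*-identityˡ c)) (sym (ℚ.*-identityˡ d)) (ℚ.<-trans (below-ι m) (above-ι m)))

      g : ℕ
      -- The 11 collects 5/2 from the two lower bounds on kept hyperedges, 3/2 from β m ≤ 1 and the
      -- endpoint m - 1, 6 from `lowest`, and 1 from the endpoint g - 1.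
      g = 2 ℕ.* s ℕ.+ t ℕ.+ 11

      ιm≡ : ι m ≡ ι R + (ι kI + ι kO)
      ιm≡ = trans (cong ι (sym partition)) (sym (trans (cong (λ z → ι R + z) (ι-+ kI kO)) (ι-+ R (kI ℕ.+ kO))))

      ιg≡ : ι g ≡ rational 2 * ι s + ι t + rational 11
      ιg≡ = sym (trans (cong (λ z → z + ι t + rational 11) (ι-* 2 s))
        (trans (cong (_+ rational 11) (ι-+ (2 ℕ.* s) t)) (ι-+ (2 ℕ.* s ℕ.+ t) 11)))

      ιT≡ : ι (kO ℕ.+ s ℕ.+ t ℕ.+ 2) ≡ ι kO + ι s + ι t + rational 2
      ιT≡ = sym (trans (cong (λ z → z + ι t + rational 2) (ι-+ kO s))
        (trans (cong (_+ rational 2) (ι-+ (kO ℕ.+ s) t)) (ι-+ (kO ℕ.+ s ℕ.+ t) 2)))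

      ιhalf≡ : ι (2 ℕ.* kI ℕ.+ 1 ℕ.+ 2 ℕ.* s) ≡ rational 2 * ι kI + 1ℚ + rational 2 * ι s
      ιhalf≡ = sym (trans (cong₂ (λ x z → x + 1ℚ + z) (ι-* 2 kI) (ι-* 2 s))
        (trans (cong (_+ ι (2 ℕ.* s)) (ι-+ (2 ℕ.* kI) 1)) (ι-+ (2 ℕ.* kI ℕ.+ 1) (2 ℕ.* s))))

      removed≤ : ι R ≤ lowest + (ι g - 1ℚ)
      removed≤ = reaches
        (≤⇒0≤- (ℚ.≤-trans Vm≤ (ℚ.≤-reflexive ιT≡)) ⊞ ≤⇒0≤- βm≤1
          ⊞ 0≤* (ℚ.<⇒≤ (evidently {0ℚ} {½})) (≤⇒0≤- (ℚ.≤-trans (ι-mono-≤ half) (ℚ.≤-reflexive ιhalf≡))) ⊞ 0≤V ⊞ ℚ.<⇒≤ 0<β)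
        (trans (cong₂ (λ x z → (½ - V - β) * (x - 1ℚ) - rational 6 + (z - 1ℚ)) ιm≡ ιg≡)
          (trans (identity V β (ι R) (ι kI) (ι kO) (ι s) (ι t))
            (cong (λ x → ι R + (ι kO + ι s + ι t + rational 2 - V * x + (1ℚ - β * x)
               + ½ * (rational 2 * ι kI + 1ℚ + rational 2 * ι s - x) + V + β)) (sym ιm≡))))
        where
        identity : ∀ v b r i o s t →
          (½ - v - b) * (r + (i + o) - 1ℚ) - rational 6 + (rational 2 * s + t + rational 11 - 1ℚ) ≡
          r + (o + s + t + rational 2 - v * (r + (i + o)) + (1ℚ - b * (r + (i + o)))
            + ½ * (rational 2 * i + 1ℚ + rational 2 * s - (r + (i + o))) + v + b)
        identity = solve 7 (λ v b r i o s t →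
          (con ½ :- v :- b) :* (r :+ (i :+ o) :- con 1ℚ) :- con (rational 6) :+ (con (rational 2) :* s :+ t :+ con (rational 11) :- con 1ℚ) :=
          r :+ (o :+ s :+ t :+ con (rational 2) :- v :* (r :+ (i :+ o)) :+ (con 1ℚ :- b :* (r :+ (i :+ o)))
            :+ con ½ :* (con (rational 2) :* i :+ con 1ℚ :+ con (rational 2) :* s :- (r :+ (i :+ o))) :+ v :+ b)) refl

    size-bound : nat R ≤ᶜ (rat ½ -ᶜ e) *ᶜ nat m +ᶜ nat g
    size-bound q q<R =
      lowest , ι g - 1ℚ
      , (α , 1ℚ , c , d , α<y , y<1 , nat-lower (below-ι m) , nat-upper (above-ι m) , ac , ad , bc , bd)
      , nat-lower (below-ι g)
      , ℚ.<-≤-trans (subst (q <_) (ι≡ R) q<R) removed≤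

  -- The time bound is at least polynomial

  module TimeBound (e : Cut) (within : e Within ((+ 1) ℚ./ 3)) (m g t P : ℕ)
                   (5≤g : 5 ℕ.≤ g) (2t<P : 2 ℕ.* t ℕ.< P) where
    open +-*-Solver

    private
      gain power : Cut
      gain  = nat 1 -ᶜ nat 2 *ᶜ e ^ᶜ 2
      power = gain *ᶜ nat m +ᶜ nat g

      -- Every product of strict bounds is rounded up: 1 < 9/8, 3/8 < 1/2, 1/6 < 1/4 and 5/8 < 7/8.
      -- Its upper half makes the coefficient of m in the exponent positive.
      2e²-within : (nat 2 *ᶜ e ^ᶜ 2) Within ((+ 7) ℚ./ 8)
      2e²-within = within-* {nat 2} {e ^ᶜ 2} {(+ 5) ℚ./ 2} {(+ 1) ℚ./ 4} evidently evidently (evidently , evidently)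
        (within-* {e} {e ^ᶜ 1} {(+ 1) ℚ./ 3} {½} evidently evidently within
          (within-* {e} {e ^ᶜ 0} {(+ 1) ℚ./ 3} {(+ 9) ℚ./ 8} evidently evidently within (evidently , evidently) evidently)
          evidently)
        evidently

      0<gain : lower gain 0ℚ
      0<gain = lower-- {nat 2 *ᶜ e ^ᶜ 2} {0ℚ} {(+ 7) ℚ./ 8} 1ℚ (proj₂ 2e²-within) evidently

      gain<3 : upper gain (rational 3)
      gain<3 = upper-- {nat 2 *ᶜ e ^ᶜ 2} {rational 3} { - ((+ 7) ℚ./ 8)} 1ℚ (proj₁ 2e²-within) evidently

      c d : ℚ
      c = ι m - 1ℚ
      d = ι m + 1ℚ

      0≤3m : 0ℚ ≤ rational 3 * ι m
      0≤3m = 0≤* {rational 3} {ι m} (ℚ.<⇒≤ evidently) (0≤ι m)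

      top : ℚ
      top = rational 3 * ι m + rational 4

      0<top : 0ℚ < top
      0<top = 0≤3m ⊞< evidently {0ℚ} {rational 4}

      zero-times : ∀ {p} q → p < 0ℚ → p < 0ℚ * q
      zero-times {p} q = subst (p <_) (sym (ℚ.*-zeroˡ q))

      zero-times′ : ∀ {p} q → 0ℚ < p → 0ℚ * q < p
      zero-times′ {p} q = subst (_< p) (sym (ℚ.*-zeroˡ q))

      -- At m = 0 the corner 3 (m - 1) is -3, so -4 is a lower bound valid for every m. Together
      -- with g ≥ 5 it makes the exponent positive.
      -4<gain*m : lower (gain *ᶜ nat m) (- rational 4)
      -4<gain*m = 0ℚ , rational 3 , c , d , 0<gain , gain<3 , nat-lower (below-ι m) , nat-upper (above-ι m)
        , zero-times c evidently , zero-times d evidently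
        , exceeds (0≤3m ⊞< evidently {0ℚ} {1ℚ}) (solve 1 (λ x → con (rational 3) :* (x :- con 1ℚ) :=
            (:- con (rational 4)) :+ (con (rational 3) :* x :+ con 1ℚ)) refl (ι m))
        , exceeds (0≤3m ⊞< evidently {0ℚ} {rational 7}) (solve 1 (λ x → con (rational 3) :* (x :+ con 1ℚ) :=
            (:- con (rational 4)) :+ (con (rational 3) :* x :+ con (rational 7))) refl (ι m))

      gain*m<top : upper (gain *ᶜ nat m) top
      gain*m<top = 0ℚ , rational 3 , c , d , 0<gain , gain<3 , nat-lower (below-ι m) , nat-upper (above-ι m)
        , zero-times′ c 0<top , zero-times′ d 0<top
        , exceeds {d = rational 7} evidently (solve 1 (λ x → con (rational 3) :* x :+ con (rational 4) :=
            con (rational 3) :* (x :- con 1ℚ) :+ con (rational 7)) refl (ι m))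
        , exceeds {d = 1ℚ} evidently (solve 1 (λ x → con (rational 3) :* x :+ con (rational 4) :=
            con (rational 3) :* (x :+ con 1ℚ) :+ con 1ℚ) refl (ι m))

      0<power : lower power 0ℚ
      0<power = - rational 4 , ι g - ½ , -4<gain*m
        , nat-lower (exceeds {d = ½} evidently (solve 2 (λ x h → x := x :- h :+ h) refl (ι g) ½))
        , exceeds (≤⇒0≤- (ι-mono-≤ 5≤g) ⊞< evidently {0ℚ} {½}) (solve 1 (λ x → (:- con (rational 4)) :+ (x :- con ½) :=
            con 0ℚ :+ ((x :- con (rational 5)) :+ con ½)) refl (ι g))

      U : ℕ
      U = 3 ℕ.* m ℕ.+ 6 ℕ.+ g

      power<U : upper power (rational U)
      power<U = top , ι g + 1ℚ , gain*m<top , nat-upper (above-ι g)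
        , subst (top + (ι g + 1ℚ) <_) (sym ιU≡) (exceeds {d = 1ℚ} evidently
            (solve 2 (λ x z → con (rational 3) :* x :+ con (rational 6) :+ z :=
              con (rational 3) :* x :+ con (rational 4) :+ (z :+ con 1ℚ) :+ con 1ℚ) refl (ι m) (ι g)))
        where
        ιU≡ : rational U ≡ rational 3 * ι m + rational 6 + ι g
        ιU≡ = trans (ι≡ U) (sym (trans (cong (λ z → z + rational 6 + ι g) (ι-* 3 m))
          (trans (cong (_+ ι g) (ι-+ (3 ℕ.* m) 6)) (ι-+ (3 ℕ.* m ℕ.+ 6) g))))

      2^-positive : ∀ n → Positive (rational 2 ^ n)
      2^-positive zero    = _
      2^-positive (suc n) = ℚ.pos*pos⇒pos (rational 2) (rational 2 ^ n) {{2^-positive n}}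

      W : ℚ
      W = rational 2 ^ U + 1ℚ

      1<W : 1ℚ < W
      1<W = exceeds (ℚ.positive⁻¹ (rational 2 ^ U) {{2^-positive U}}) (ℚ.+-comm (rational 2 ^ U) 1ℚ)

      ½<2^power : lower (2^ᶜ power) ½
      ½<2^power = inj₂ (+ 0 , 0 , 0<power , evidently)

      2^power<W : upper (2^ᶜ power) W
      2^power<W = ℚ.<-trans evidently 1<W , + U , 0 , power<U
        , subst (rational 2 ^ U <_) (sym (ℚ.*-identityʳ W)) (exceeds {d = 1ℚ} evidently refl)

    -- The exponent is positive, hence the power of 2 exceeds ½. With 2 t < P the endpoints 2 t and
    -- ½ give a smallest corner equal to t; `P + 1` and `W` are the upper endpoints that interval
    -- multiplication demands.
    time-bound : nat t ≤ᶜ nat P *ᶜ 2^ᶜ power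
    time-bound q q<t = ι (2 ℕ.* t) , ι P + 1ℚ , ½ , W
      , nat-lower (ι-mono-< 2t<P) , nat-upper (above-ι P) , ½<2^power , 2^power<W
      , q<ac
      , ℚ.<-≤-trans q<ac ac≤ad
      , ℚ.<-≤-trans q<ac (ℚ.*-monoʳ-≤-nonNeg ½ a≤b)
      , ℚ.<-≤-trans q<ac (ℚ.≤-trans ac≤ad (ℚ.*-monoʳ-≤-nonNeg W {{ℚ.nonNegative (ℚ.≤-trans (ℚ.<⇒≤ evidently) ½≤W)}} a≤b))
      where
      a : ℚ
      a = ι (2 ℕ.* t)
      ½≤W : ½ ≤ W
      ½≤W = ℚ.<⇒≤ (ℚ.<-trans evidently 1<W)
      a≤b : a ≤ ι P + 1ℚ
      a≤b = ℚ.<⇒≤ (ℚ.<-trans (ι-mono-< 2t<P) (above-ι P))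
      ac≡ : ι t ≡ a * ½
      ac≡ = trans (solve 1 (λ x → x := con (rational 2) :* x :* con ½) refl (ι t)) (cong (_* ½) (ι-* 2 t))
      q<ac : q < a * ½
      q<ac = subst (q <_) (trans (ι≡ t) ac≡) q<t
      ac≤ad : a * ½ ≤ a * W
      ac≤ad = ℚ.*-monoˡ-≤-nonNeg a ½≤W

open Powers
open Cuts hiding (_^_)
open import Data.Bool.Base using (Bool; true; false; if_then_else_; not; _∧_)
open import Data.Bool.Properties using () renaming (_≟_ to _≟ᵇ_)
open import Data.Empty using (⊥)
open import Data.Fin.Base using (Fin; zero; suc; toℕ)
open import Data.Fin.Properties using (toℕ-injective; any?; suc-injective)
open import Data.Fin.Subset using (Subset; _∈_; _∩_; ∁; ∣_∣; ⁅_⁆)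
open import Data.Fin.Subset.Properties using (_∈?_; nonempty?; x∈p∩q⁻; Empty-unique; x∈⁅y⁆⇒x≡y)
open import Data.List.Base as List using (List; []; _∷_; _ʳ++_; foldr; length; replicate; null; drop; allFin; filter)
import Data.List.Membership.Propositional as List
open import Data.List.Membership.Propositional.Properties
  using (∈-map⁺; ∈-map⁻; ∈-filter⁺; ∈-filter⁻; ∈-allFin)
open import Data.List.Properties
  using (map-∘; map-cong; map-tabulate; length-map; length-tabulate; length-reverse; reverse-involutive)
open import Data.List.Relation.Binary.Pointwise.Base using (Pointwise; []; _∷_)
open import Data.List.Relation.Binary.Pointwise.Properties using (Pointwise-length)
open import Data.List.Relation.Unary.All as All using (All; []; _∷_)
import Data.List.Relation.Unary.All.Properties as All
open import Data.List.Relation.Unary.AllPairs using ([]; _∷_)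
open import Data.List.Relation.Unary.Any using (here; there)
open import Data.List.Relation.Unary.Unique.Propositional using (Unique)
import Data.List.Relation.Unary.Unique.Propositional.Properties as Unique
open import Data.Nat.Base
  using (ℕ; zero; suc; pred; NonZero; >-nonZero; >-nonZero⁻¹; _+_; _*_; _^_; _∸_; _≤_; _<_; z≤n; s≤s; _≡ᵇ_)
open import Data.Nat.Properties hiding (suc-injective)
open import Data.Nat.Tactic.RingSolver using (solve-∀)
open import Data.Product.Base using (swap)
open import Data.Rational.Base as ℚ using (ℚ; ½; 0ℚ; 1ℚ)
open import Data.Unit.Base using (⊤; tt)
open import Data.Vec.Base using (Vec; []; _∷_; lookup; tabulate; toList; fromList)
open import Data.Vec.Properties using (lookup⇒[]=; []=⇒lookup; lookup-map; toList∘fromList; tabulate-cong)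
open import Function.Base using (_∘_; id)
open import Relation.Nullary using (does)
open import Algebra.Properties.CommutativeSemigroup +-commutativeSemigroup using (interchange)

-- Polynomials

data Poly : Set where
  X           : Poly
  con         : ℕ → Poly
  _⊕_ _⊗_ _⊚_ : Poly → Poly → Poly

infixl 6 _⊕_
infixl 7 _⊗_
infixl 8 _⊚_

⟦_⟧ : Poly → ℕ → ℕ
⟦ X     ⟧ n = n
⟦ con c ⟧ n = c
⟦ p ⊕ q ⟧ n = ⟦ p ⟧ n + ⟦ q ⟧ n
⟦ p ⊗ q ⟧ n = ⟦ p ⟧ n * ⟦ q ⟧ n
⟦ p ⊚ q ⟧ n = ⟦ p ⟧ (⟦ q ⟧ n)

⟦⟧-mono : ∀ p {m n} → m ≤ n → ⟦ p ⟧ m ≤ ⟦ p ⟧ n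
⟦⟧-mono X       m≤n = m≤n
⟦⟧-mono (con c) m≤n = ≤-refl
⟦⟧-mono (p ⊕ q) m≤n = +-mono-≤ (⟦⟧-mono p m≤n) (⟦⟧-mono q m≤n)
⟦⟧-mono (p ⊗ q) m≤n = *-mono-≤ (⟦⟧-mono p m≤n) (⟦⟧-mono q m≤n)
⟦⟧-mono (p ⊚ q) m≤n = ⟦⟧-mono p (⟦⟧-mono q m≤n)

-- This is the shape of the polynomial in the theorem. One constant serves as coefficient and as
-- exponent, since both may be enlarged; the base n + 1 is positive, which makes its powers increase
-- with the exponent.
monomial-bound : ∀ p → ∃[ c ] ∀ n → ⟦ p ⟧ n ≤ c * suc n ^ c
monomial-bound X = 1 , λ n → ≤-trans (n≤1+n n)
  (≤-reflexive (sym (trans (*-identityˡ _) (*-identityʳ (suc n)))))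
monomial-bound (con c) = c , λ n →
  ≤-trans (≤-reflexive (sym (*-identityʳ c))) (*-monoʳ-≤ c (m^n>0 (suc n) c))
monomial-bound (p ⊕ q) with monomial-bound p | monomial-bound q
... | a , p≤ | b , q≤ = a + b , λ n → begin
  ⟦ p ⟧ n + ⟦ q ⟧ n                            ≤⟨ +-mono-≤ (p≤ n) (q≤ n) ⟩
  a * suc n ^ a + b * suc n ^ b                ≤⟨ +-mono-≤ (*-monoʳ-≤ a (^-monoʳ-≤ (suc n) (m≤m+n a b)))
                                                          (*-monoʳ-≤ b (^-monoʳ-≤ (suc n) (m≤n+m b a))) ⟩
  a * suc n ^ (a + b) + b * suc n ^ (a + b)    ≡⟨ *-distribʳ-+ (suc n ^ (a + b)) a b ⟨
  (a + b) * suc n ^ (a + b)                    ∎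
  where open ≤-Reasoning
monomial-bound (p ⊗ q) with monomial-bound p | monomial-bound q
... | a , p≤ | b , q≤ = a * b + (a + b) , λ n → begin
  ⟦ p ⟧ n * ⟦ q ⟧ n                            ≤⟨ *-mono-≤ (p≤ n) (q≤ n) ⟩
  (a * suc n ^ a) * (b * suc n ^ b)            ≡⟨ [m*n]*[o*p]≡[m*o]*[n*p] a (suc n ^ a) b (suc n ^ b) ⟩
  (a * b) * (suc n ^ a * suc n ^ b)            ≡⟨ cong ((a * b) *_) (^-distribˡ-+-* (suc n) a b) ⟨
  (a * b) * suc n ^ (a + b)                    ≤⟨ *-mono-≤ (m≤m+n (a * b) (a + b)) (^-monoʳ-≤ (suc n) (m≤n+m (a + b) (a * b))) ⟩
  (a * b + (a + b)) * suc n ^ (a * b + (a + b)) ∎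
  where open ≤-Reasoning
monomial-bound (p ⊚ q) with monomial-bound p | monomial-bound q
... | a , p≤ | b , q≤ = a * suc b ^ a + b * a , λ n → begin
  ⟦ p ⟧ (⟦ q ⟧ n)                              ≤⟨ p≤ (⟦ q ⟧ n) ⟩
  a * suc (⟦ q ⟧ n) ^ a                        ≤⟨ *-monoʳ-≤ a (^-monoˡ-≤ a (s≤s (q≤ n))) ⟩
  a * suc (b * suc n ^ b) ^ a                  ≤⟨ *-monoʳ-≤ a (^-monoˡ-≤ a (+-monoˡ-≤ (b * suc n ^ b) (m^n>0 (suc n) b))) ⟩
  a * (suc b * suc n ^ b) ^ a                  ≡⟨ cong (a *_) (^-distribʳ-* a (suc b) (suc n ^ b)) ⟩
  a * (suc b ^ a * (suc n ^ b) ^ a)            ≡⟨ cong (λ z → a * (suc b ^ a * z)) (^-*-assoc (suc n) b a) ⟩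
  a * (suc b ^ a * suc n ^ (b * a))            ≡⟨ *-assoc a (suc b ^ a) _ ⟨
  a * suc b ^ a * suc n ^ (b * a)              ≤⟨ *-mono-≤ (m≤m+n (a * suc b ^ a) (b * a)) (^-monoʳ-≤ (suc n) (m≤n+m (b * a) (a * suc b ^ a))) ⟩
  (a * suc b ^ a + b * a) * suc n ^ (a * suc b ^ a + b * a) ∎
  where open ≤-Reasoning

-- Executions

≡ᵇ-refl : ∀ n → (n ≡ᵇ n) ≡ true
≡ᵇ-refl zero    = refl
≡ᵇ-refl (suc n) = ≡ᵇ-refl n

≢⇒≡ᵇ-false : ∀ {m n} → m ≢ n → (m ≡ᵇ n) ≡ false
≢⇒≡ᵇ-false {zero}  {zero}  m≢n = contradiction refl m≢n
≢⇒≡ᵇ-false {zero}  {suc n} m≢n = refl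
≢⇒≡ᵇ-false {suc m} {zero}  m≢n = refl
≢⇒≡ᵇ-false {suc m} {suc n} m≢n = ≢⇒≡ᵇ-false (m≢n ∘ cong suc)

lookup-updated : ∀ (σ : Store) x v → (σ [ x ↦ v ]) x ≡ v
lookup-updated σ x v rewrite ≡ᵇ-refl x = refl

lookup-minimal : ∀ (σ : Store) {x y} v → x ≢ y → (σ [ x ↦ v ]) y ≡ σ y
lookup-minimal σ v x≢y rewrite ≢⇒≡ᵇ-false x≢y = refl

infix 4 _⟶[_]_

-- Each step must be the same for both coins, so a derivation fixes the course of the computation
-- whatever the coins are, in either mode.
data _⟶[_]_ {M} : Config M → ℕ → Config M → Set where
  done : ∀ {C} → C ⟶[ 0 ] C
  step : ∀ {C C′ C″ t} → (∀ coin → next coin C ≡ C′) → C′ ⟶[ t ] C″ → C ⟶[ suc t ] C″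

⟶-trans : ∀ {M t u} {C D E : Config M} → C ⟶[ t ] D → D ⟶[ u ] E → C ⟶[ t + u ] E
⟶-trans done         D⟶E = D⟶E
⟶-trans (step s C⟶D) D⟶E = step s (⟶-trans C⟶D D⟶E)

-- The pending commands `K` are arbitrary and the duration does not depend on them; this makes
-- executions compose.
record Execution {M} (p : Program M) (σ : Store) (σ′ : Store) : Set where
  constructor execution
  field
    duration : ℕ
    steps-to : ∀ K → ⟨ p ∷ K , σ ⟩ ⟶[ duration ] ⟨ K , σ′ ⟩

open Execution public

exec-≔ : ∀ {M} x e σ → Execution {M} (x ≔ e) σ (σ [ x ↦ eval e σ ])
exec-≔ x e σ = execution 1 λ K → step (λ _ → refl) done

exec-⨾ : ∀ {M} {p q : Program M} {σ σ′ σ″} →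
         Execution p σ σ′ → Execution q σ′ σ″ → Execution (p ⨾ q) σ σ″
exec-⨾ {q = q} P Q = execution (suc (duration P + duration Q)) λ K →
  step (λ _ → refl) (⟶-trans (steps-to P (q ∷ K)) (steps-to Q K))

exec-if-true : ∀ {M e} {p q : Program M} {σ σ′} → isTrue (eval e σ) ≡ true →
               Execution p σ σ′ → Execution (if e p q) σ σ′
exec-if-true {p = p} {q} eq P = execution (suc (duration P)) λ K →
  step (λ _ → cong (λ b → ⟨ (if b then p else q) ∷ K , _ ⟩) eq) (steps-to P K)

exec-if-false : ∀ {M e} {p q : Program M} {σ σ′} → isTrue (eval e σ) ≡ false →
                Execution q σ σ′ → Execution (if e p q) σ σ′
exec-if-false {p = p} {q} eq Q = execution (suc (duration Q)) λ K →
  step (λ _ → cong (λ b → ⟨ (if b then p else q) ∷ K , _ ⟩) eq) (steps-to Q K)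

exec-while-false : ∀ {M e} {p : Program M} {σ} → isTrue (eval e σ) ≡ false →
                   Execution (while e p) σ σ
exec-while-false {e = e} {p} eq = execution 1 λ K →
  step (λ _ → cong (λ b → ⟨ (if b then p ∷ while e p ∷ K else K) , _ ⟩) eq) done

exec-while-true : ∀ {M e} {p : Program M} {σ σ′ σ″} → isTrue (eval e σ) ≡ true →
                  Execution p σ σ′ → Execution (while e p) σ′ σ″ → Execution (while e p) σ σ″
exec-while-true {e = e} {p} eq P W = execution (suc (duration P + duration W)) λ K →
  step (λ _ → cong (λ b → ⟨ (if b then p ∷ while e p ∷ K else K) , _ ⟩) eq)
       (⟶-trans (steps-to P (while e p ∷ K)) (steps-to W K))

-- Encodings of data and polynomial-time functions

record Encodable (A : Set) : Set where
  field
    encode : A → Value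
    size   : A → ℕ

open Encodable ⦃ ... ⦄ public

-- The wrapper separates atoms, which are one machine word, from numbers, which are in unary: both
-- are natural numbers, but their encodings and sizes differ.
record Name : Set where
  constructor name
  field index : ℕ

open Name public

-- Each cell counts one unit on top of its content, so that the size bounds the length even when the
-- elements have size 0.
sizes : ∀ {A} → ⦃ Encodable A ⦄ → List A → ℕ
sizes []       = 0
sizes (x ∷ xs) = suc (size x + sizes xs)

instance
  encodable-⊤ : Encodable ⊤
  encodable-⊤ = record { encode = λ _ → atom 0 ; size = λ _ → 0 }

  encodable-Bool : Encodable Bool
  encodable-Bool = record { encode = bit ; size = λ _ → 0 }

  encodable-Name : Encodable Name
  encodable-Name = record { encode = atom ∘ index ; size = λ _ → 0 }

  encodable-List : ∀ {A} → ⦃ Encodable A ⦄ → Encodable (List A)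
  encodable-List = record { encode = list ∘ List.map encode ; size = sizes }

  -- Numbers are in unary.
  encodable-ℕ : Encodable ℕ
  encodable-ℕ = record { encode = λ n → list (List.map encode (replicate n tt)) ; size = id }

  encodable-× : ∀ {A B} → ⦃ Encodable A ⦄ → ⦃ Encodable B ⦄ → Encodable (A × B)
  encodable-× = record
    { encode = λ (x , y) → encode x ∙ encode y
    ; size   = λ (x , y) → size x + size y
    }

-- A subroutine compiled at offset d finds its argument in variable d and
-- leaves its result there; variables below d are preserved, those above
-- are scratch space.

record Computation {M} (p : Program M) (d : Var) (σ : Store) (bound : ℕ) (v : Value) : Set where
  field
    final    : Store
    runs     : Execution p σ final
    in-time  : duration runs ≤ bound
    result   : final d ≡ v
    frame    : ∀ {y} → y < d → final y ≡ σ y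

open Computation public

-- `growth` bounds the size of the result, without which the running time of a composite could not
-- be bounded in terms of its input. Quantifying over the mode makes the same code available as a
-- randomized and as a deterministic program.
record PolyTime {A B} ⦃ _ : Encodable A ⦄ ⦃ _ : Encodable B ⦄ (f : A → B) : Set where
  field
    code        : ∀ {M} → Var → Program M
    time growth : Poly
    grows       : ∀ a → size (f a) ≤ ⟦ growth ⟧ (size a)
    computes    : ∀ {M} d σ a → σ d ≡ encode a →
                  Computation (code {M} d) d σ (⟦ time ⟧ (size a)) (encode (f a))

open PolyTime public

module _ {A B} ⦃ _ : Encodable A ⦄ ⦃ _ : Encodable B ⦄ where

  by-ext : {f g : A → B} → (∀ a → f a ≡ g a) → PolyTime f → PolyTime g
  by-ext f≗g F = record
    { code     = code F
    ; time     = time F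
    ; growth   = growth F
    ; grows    = λ a → subst (λ b → size b ≤ _) (f≗g a) (grows F a)
    ; computes = λ d σ a eq → subst (λ b → Computation _ d σ _ (encode b)) (f≗g a) (computes F d σ a eq)
    }

  by-expr : {f : A → B} (e : Expr → Expr) (p : Poly) →
            (∀ a → size (f a) ≤ ⟦ p ⟧ (size a)) →
            (∀ d σ a → σ d ≡ encode a → eval (e (var d)) σ ≡ encode (f a)) → PolyTime f
  by-expr e p grows computes = record
    { code     = λ d → d ≔ e (var d)
    ; time     = con 1
    ; growth   = p
    ; grows    = grows
    ; computes = λ d σ a eq → record
        { final   = _
        ; runs    = exec-≔ d (e (var d)) σ
        ; in-time = ≤-refl
        ; result  = trans (lookup-updated σ d _) (computes d σ a eq)
        ; frame   = λ y<d → lookup-minimal σ _ (>⇒≢ y<d)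
        }
    }

  constant : (b : B) → PolyTime {A} (λ _ → b)
  constant b = by-expr (λ _ → lit (encode b)) (con (size b)) (λ _ → ≤-refl) (λ _ _ _ _ → refl)

module _ {A B} ⦃ _ : Encodable A ⦄ ⦃ _ : Encodable B ⦄ where

  fst : PolyTime {A × B} proj₁
  fst = by-expr hd X (λ _ → m≤m+n _ _) (λ _ _ _ → cong head)

  snd : PolyTime {A × B} proj₂
  snd = by-expr tl X (λ (a , b) → m≤n+m (size b) (size a)) (λ _ _ _ → cong tail)

identity : ∀ {A} ⦃ _ : Encodable A ⦄ → PolyTime {A} id
identity = by-expr id X (λ _ → ≤-refl) (λ _ _ _ eq → eq)

infixr 9 _∙∘_

_∙∘_ : ∀ {A B C} ⦃ _ : Encodable A ⦄ ⦃ _ : Encodable B ⦄ ⦃ _ : Encodable C ⦄ {g : B → C} {f : A → B} →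
       PolyTime g → PolyTime f → PolyTime (λ a → g (f a))
_∙∘_ {f = f} G F = record
  { code     = λ d → code F d ⨾ code G d
  ; time     = con 1 ⊕ (time F ⊕ time G ⊚ growth F)
  ; growth   = growth G ⊚ growth F
  ; grows    = λ a → ≤-trans (grows G (f a)) (⟦⟧-mono (growth G) (grows F a))
  ; computes = λ d σ a eq →
      let α = computes F d σ a eq
          β = computes G d (final α) (f a) (result α)
      in record
        { final   = final β
        ; runs    = exec-⨾ (runs α) (runs β)
        ; in-time = s≤s (+-mono-≤ (in-time α)
                      (≤-trans (in-time β) (⟦⟧-mono (time G) (grows F a))))
        ; result  = result β
        ; frame   = λ y<d → trans (frame β y<d) (frame α y<d)
        }
  }

module _ {A B} ⦃ _ : Encodable A ⦄ ⦃ _ : Encodable B ⦄ where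

  -- The argument stays in variable d, where the continuation finds it.
  private
    on-copy : {f : A → B} → PolyTime f → ∀ {M} d → Program M
    on-copy F d = suc d ≔ var d ⨾ code F (suc d)

    on-copy-computes : {f : A → B} (F : PolyTime f) → ∀ {M} d σ a → σ d ≡ encode a →
      Computation (on-copy F {M} d) (suc d) σ (2 + ⟦ time F ⟧ (size a)) (encode (f a))
    on-copy-computes F d σ a eq =
      let α = computes F (suc d) (σ [ suc d ↦ σ d ]) a (trans (lookup-updated σ (suc d) _) eq)
      in record
        { final   = final α
        ; runs    = exec-⨾ (exec-≔ (suc d) (var d) σ) (runs α)
        ; in-time = s≤s (s≤s (in-time α))
        ; result  = result α
        ; frame   = λ y<d → trans (frame α y<d) (lookup-minimal σ _ (>⇒≢ y<d))
        }

  ⟪_,_⟫ : ∀ {C} ⦃ _ : Encodable C ⦄ {f : A → B} {g : A → C} →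
          PolyTime f → PolyTime g → PolyTime (λ a → f a , g a)
  ⟪_,_⟫ {f = f} {g} F G = record
    { code     = λ d → on-copy F d ⨾ (suc (suc d) ≔ var d ⨾ code G (suc (suc d)))
                       ⨾ d ≔ cons (var (suc d)) (var (suc (suc d)))
    ; time     = con 7 ⊕ (time F ⊕ time G)
    ; growth   = growth F ⊕ growth G
    ; grows    = λ a → +-mono-≤ (grows F a) (grows G a)
    ; computes = λ d σ a eq →
        let α   = on-copy-computes F d σ a eq
            d≡a = trans (frame α ≤-refl) eq
            σ₁  = final α [ suc (suc d) ↦ final α d ]
            β   = computes G (suc (suc d)) σ₁ a
                    (trans (lookup-updated (final α) (suc (suc d)) _) d≡a)
            old : ∀ {y} → y < suc (suc d) → final β y ≡ final α y
            old y< = trans (frame β y<) (lookup-minimal (final α) _ (>⇒≢ y<))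
            e   = cons (var (suc d)) (var (suc (suc d)))
        in record
          { final   = final β [ d ↦ eval e (final β) ]
          ; runs    = exec-⨾ (runs α) (exec-⨾ (exec-⨾ (exec-≔ _ (var d) _) (runs β)) (exec-≔ d e (final β)))
          ; in-time = ≤-trans
              (s≤s (+-mono-≤ (in-time α) (s≤s (+-monoˡ-≤ 1 (s≤s (s≤s (in-time β)))))))
              (≤-reflexive (arith (⟦ time F ⟧ (size a)) (⟦ time G ⟧ (size a))))
          ; result  = trans (lookup-updated (final β) d _)
                        (cong₂ _∙_ (trans (old ≤-refl) (result α)) (result β))
          ; frame   = λ {y} y<d → trans (lookup-minimal (final β) _ (>⇒≢ y<d))
                        (trans (old (m<n⇒m<1+n (m<n⇒m<1+n y<d))) (frame α (m<n⇒m<1+n y<d)))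
          }
    }
    where
    arith : ∀ x y → 1 + (2 + x + (1 + (2 + y + 1))) ≡ 7 + (x + y)
    arith = solve-∀

module _ {A B} ⦃ _ : Encodable A ⦄ ⦃ _ : Encodable B ⦄ where
  conditional : {b : A → Bool} {f g : A → B} → PolyTime b → PolyTime f → PolyTime g →
                PolyTime (λ a → if b a then f a else g a)
  conditional {b} {f} {g} T F G = record
    { code     = λ d → (suc d ≔ var d ⨾ code T (suc d)) ⨾ if (var (suc d)) (code F d) (code G d)
    ; time     = con 4 ⊕ time T ⊕ (time F ⊕ time G)
    ; growth   = growth F ⊕ growth G
    ; grows    = λ a → grows′ a (b a)
    ; computes = λ {M} d σ a eq →
        let α   = computes T {M} (suc d) (σ [ suc d ↦ σ d ]) a (trans (lookup-updated σ (suc d) _) eq)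
            old : ∀ {y} → y < suc d → final α y ≡ σ y
            old y< = trans (frame α y<) (lookup-minimal σ _ (>⇒≢ y<))
            test = exec-⨾ (exec-≔ (suc d) (var d) σ) (runs α)
        in branch d σ a eq α old test (s≤s (s≤s (in-time α))) (b a) refl
    }
    where
    grows′ : ∀ a t → size (if t then f a else g a) ≤ ⟦ growth F ⟧ (size a) + ⟦ growth G ⟧ (size a)
    grows′ a true  = ≤-trans (grows F a) (m≤m+n _ _)
    grows′ a false = ≤-trans (grows G a) (m≤n+m _ _)

    branch : ∀ {M} d σ a → σ d ≡ encode a →
      (α : Computation (code T {M} (suc d)) (suc d) (σ [ suc d ↦ σ d ]) (⟦ time T ⟧ (size a)) (bit (b a))) →
      (∀ {y} → y < suc d → final α y ≡ σ y) →
      (test : Execution (suc d ≔ var d ⨾ code T {M} (suc d)) σ (final α)) →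
      duration test ≤ 2 + ⟦ time T ⟧ (size a) →
      ∀ t → b a ≡ t →
      Computation ((suc d ≔ var d ⨾ code T {M} (suc d)) ⨾ if (var (suc d)) (code F d) (code G d)) d σ
        (4 + ⟦ time T ⟧ (size a) + (⟦ time F ⟧ (size a) + ⟦ time G ⟧ (size a)))
        (encode (if t then f a else g a))
    branch {M} d σ a eq α old test test≤ true ba =
      let β = computes F {M} d (final α) a (trans (old ≤-refl) eq)
      in record
        { final   = final β
        ; runs    = exec-⨾ test (exec-if-true {e = var (suc d)} (cong isTrue (trans (result α) (cong bit ba))) (runs β))
        ; in-time = s≤s (≤-trans (+-mono-≤ test≤ (s≤s (≤-trans (in-time β) (m≤m+n _ _))))
                      (≤-reflexive (+-suc (2 + ⟦ time T ⟧ (size a)) _)))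
        ; result  = result β
        ; frame   = λ y<d → trans (frame β y<d) (old (m<n⇒m<1+n y<d))
        }
    branch {M} d σ a eq α old test test≤ false ba =
      let β = computes G {M} d (final α) a (trans (old ≤-refl) eq)
      in record
        { final   = final β
        ; runs    = exec-⨾ test (exec-if-false {e = var (suc d)} (cong isTrue (trans (result α) (cong bit ba))) (runs β))
        ; in-time = s≤s (≤-trans (+-mono-≤ test≤ (s≤s (≤-trans (in-time β) (m≤n+m _ _))))
                      (≤-reflexive (+-suc (2 + ⟦ time T ⟧ (size a)) _)))
        ; result  = result β
        ; frame   = λ y<d → trans (frame β y<d) (old (m<n⇒m<1+n y<d))
        }

-- Right folds as loops.

module _ {A} ⦃ _ : Encodable A ⦄ where

  sizes-ʳ++ : ∀ (xs ys : List A) → sizes (xs ʳ++ ys) ≡ sizes xs + sizes ys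
  sizes-ʳ++ []       ys = refl
  sizes-ʳ++ (x ∷ xs) ys = trans (sizes-ʳ++ xs (x ∷ ys)) (shuffle (sizes xs) (size x) (sizes ys))
    where
    shuffle : ∀ a b c → a + suc (b + c) ≡ suc (b + a + c)
    shuffle = solve-∀

  length≤sizes : ∀ (xs : List A) → length xs ≤ sizes xs
  length≤sizes []       = z≤n
  length≤sizes (x ∷ xs) = s≤s (≤-trans (length≤sizes xs) (m≤n+m _ (size x)))

  -- A right fold begins at the far end of the list, a loop at the near end; after a reversal, a
  -- loop with an accumulator computes the fold.
  reversal : ∀ {M} → Var → Program M
  reversal d = while (var (1 + d))
    ((2 + d) ≔ cons (hd (var (1 + d))) (var (2 + d)) ⨾ (1 + d) ≔ tl (var (1 + d)))

  reversal-runs : ∀ {M} d σ (xs ys : List A) → σ (1 + d) ≡ encode xs → σ (2 + d) ≡ encode ys →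
    Σ[ σ′ ∈ Store ] Σ[ E ∈ Execution (reversal {M} d) σ σ′ ]
      duration E ≤ length xs * 4 + 1 × σ′ (2 + d) ≡ encode (xs ʳ++ ys) ×
      (∀ {y} → y < 1 + d → σ′ y ≡ σ y)
  reversal-runs d σ [] ys xs≡ ys≡ =
    σ , exec-while-false {e = var (1 + d)} (cong isTrue xs≡) , ≤-refl , ys≡ , λ _ → refl
  reversal-runs d σ (x ∷ xs) ys xs≡ ys≡ =
    let e₁ = cons (hd (var (1 + d))) (var (2 + d))
        σ₁ = σ [ 2 + d ↦ eval e₁ σ ]
        σ₂ = σ₁ [ 1 + d ↦ tail (σ₁ (1 + d)) ]
        rest≡ = trans (lookup-updated σ₁ (1 + d) _)
                  (cong tail (trans (lookup-minimal σ _ (>⇒≢ ≤-refl)) xs≡))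
        done≡ = trans (lookup-minimal σ₁ _ (<⇒≢ ≤-refl))
                  (trans (lookup-updated σ (2 + d) _) (cong₂ _∙_ (cong head xs≡) ys≡))
        σ′ , E , E≤ , result , old = reversal-runs d σ₂ xs (x ∷ ys) rest≡ done≡
    in σ′
     , exec-while-true {e = var (1 + d)} (cong isTrue xs≡)
         (exec-⨾ (exec-≔ (2 + d) e₁ σ) (exec-≔ (1 + d) (tl (var (1 + d))) σ₁)) E
     , +-monoʳ-≤ 4 E≤
     , result
     , λ y< → trans (old y<) (trans (lookup-minimal σ₁ _ (>⇒≢ y<))
                (lookup-minimal σ _ (>⇒≢ (m<n⇒m<1+n y<))))

-- Polynomial steps do not iterate to a polynomial computation: a step could double the accumulator
-- every time. Hence the demand that all partial folds be bounded by one polynomial `p`.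
module _ {A B S} ⦃ _ : Encodable A ⦄ ⦃ _ : Encodable B ⦄ ⦃ _ : Encodable S ⦄
  {f : A → B → S → S} (F : PolyTime {(A × B) × S} (λ p → f (proj₁ (proj₁ p)) (proj₂ (proj₁ p)) (proj₂ p)))
  (p : Poly) (bounded : ∀ a s xs → size (foldr (f a) s xs) ≤ ⟦ p ⟧ (size a + (sizes xs + size s)))
  where

  private
    body : ∀ {M} → Var → Program M
    body d = (3 + d) ≔ cons (cons (var d) (hd (var (2 + d)))) (var (1 + d)) ⨾ code F (3 + d)
             ⨾ (1 + d) ≔ var (3 + d) ⨾ (2 + d) ≔ tl (var (2 + d))

    loop : ∀ {M} → Var → Program M
    loop d = while (var (2 + d)) (body d)

    step-time : Poly
    step-time = time F ⊚ (X ⊕ X ⊕ p)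

    size-in-loop : ∀ a s x xs ys → let N = size a + (sizes ((x ∷ xs) ʳ++ ys) + size s) in
      size a + size x + size (foldr (f a) s ys) ≤ N + N + ⟦ p ⟧ N
    size-in-loop a s x xs ys = +-mono-≤ (+-mono-≤ (m≤m+n (size a) _) x≤)
      (≤-trans (bounded a s ys) (⟦⟧-mono p (+-monoʳ-≤ (size a) (+-monoˡ-≤ (size s) ys≤))))
      where
      total = sizes ((x ∷ xs) ʳ++ ys)
      total≡ : total ≡ suc (size x + sizes xs) + sizes ys
      total≡ = sizes-ʳ++ (x ∷ xs) ys
      ys≤ : sizes ys ≤ total
      ys≤ = ≤-trans (m≤n+m (sizes ys) _) (≤-reflexive (sym total≡))
      x≤ : size x ≤ size a + (total + size s)
      x≤ = ≤-trans (m≤m+n (size x) (sizes xs)) (≤-trans (n≤1+n _) (≤-trans (m≤m+n _ (sizes ys))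
             (≤-trans (≤-reflexive (sym total≡)) (≤-trans (m≤m+n total (size s)) (m≤n+m _ (size a))))))

    -- Invariant: variable 1 + d holds the fold over the consumed part `ys`, and 2 + d the remaining
    -- part `xs`. The list `xs ʳ++ ys` is the same in every round, so one time bound serves for all
    -- of them.
    loop-runs : ∀ {M} d σ a s (xs ys : List B) → σ d ≡ encode a → σ (1 + d) ≡ encode (foldr (f a) s ys) →
      σ (2 + d) ≡ encode xs →
      Σ[ σ′ ∈ Store ] Σ[ E ∈ Execution (loop {M} d) σ σ′ ]
        duration E ≤ length xs * (7 + ⟦ step-time ⟧ (size a + (sizes (xs ʳ++ ys) + size s))) + 1 ×
        σ′ (1 + d) ≡ encode (foldr (f a) s (xs ʳ++ ys)) ×
        (∀ {y} → y < d → σ′ y ≡ σ y)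
    loop-runs d σ a s [] ys a≡ s≡ xs≡ =
      σ , exec-while-false {e = var (2 + d)} (cong isTrue xs≡) , ≤-refl , s≡ , λ _ → refl
    loop-runs {M} d σ a s (x ∷ xs) ys a≡ s≡ xs≡ =
      let e₁ = cons (cons (var d) (hd (var (2 + d)))) (var (1 + d))
          σ₁ = σ [ 3 + d ↦ eval e₁ σ ]
          α  = computes F {M} (3 + d) σ₁ ((a , x) , foldr (f a) s ys)
                 (trans (lookup-updated σ (3 + d) _) (cong₂ _∙_ (cong₂ _∙_ a≡ (cong head xs≡)) s≡))
          keep : ∀ {y} → y < 3 + d → final α y ≡ σ y
          keep y< = trans (frame α y<) (lookup-minimal σ _ (>⇒≢ y<))
          σ₂ = final α
          σ₃ = σ₂ [ 1 + d ↦ σ₂ (3 + d) ]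
          σ₄ = σ₃ [ 2 + d ↦ tail (σ₃ (2 + d)) ]
          a≡′ = trans (lookup-minimal σ₃ _ (>⇒≢ (n≤1+n _)))
                  (trans (lookup-minimal σ₂ _ (>⇒≢ ≤-refl)) (trans (keep (≤-trans (n≤1+n _) (n≤1+n _))) a≡))
          s≡′ = trans (lookup-minimal σ₃ _ (>⇒≢ ≤-refl)) (trans (lookup-updated σ₂ (1 + d) _) (result α))
          xs≡′ = trans (lookup-updated σ₃ (2 + d) _)
                   (cong tail (trans (lookup-minimal σ₂ _ (<⇒≢ ≤-refl)) (trans (keep ≤-refl) xs≡)))
          σ′ , E , E≤ , result′ , old = loop-runs d σ₄ a s xs (x ∷ ys) a≡′ s≡′ xs≡′
          B₁ = exec-⨾ (exec-≔ (3 + d) e₁ σ) (exec-⨾ (runs α)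
                 (exec-⨾ (exec-≔ (1 + d) (var (3 + d)) σ₂) (exec-≔ (2 + d) (tl (var (2 + d))) σ₃)))
          T  = ⟦ step-time ⟧ (size a + (sizes ((x ∷ xs) ʳ++ ys) + size s))
          α≤ : duration (runs α) ≤ T
          α≤ = ≤-trans (in-time α) (⟦⟧-mono (time F) (size-in-loop a s x xs ys))
      in σ′
       , exec-while-true {e = var (2 + d)} (cong isTrue xs≡) B₁ E
       , ≤-trans (s≤s (+-mono-≤ (s≤s (s≤s (s≤s (+-monoˡ-≤ 3 α≤)))) E≤))
           (≤-reflexive (arith T (length xs * (7 + T))))
       , result′
       , λ y< → trans (old y<) (trans (lookup-minimal σ₃ _ (>⇒≢ (m<n⇒m<1+n (m<n⇒m<1+n y<))))
                  (trans (lookup-minimal σ₂ _ (>⇒≢ (m<n⇒m<1+n y<)))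
                    (keep (m<n⇒m<1+n (m<n⇒m<1+n (m<n⇒m<1+n y<))))))
      where
      arith : ∀ t l → suc (suc (suc (suc (t + 3))) + (l + 1)) ≡ 7 + t + l + 1
      arith = solve-∀

  fold-triple : PolyTime {A × (List B × S)} (λ t → foldr (f (proj₁ t)) (proj₂ (proj₂ t)) (proj₁ (proj₂ t)))
  fold-triple = record
    { code = λ d → (2 + d) ≔ lit (atom 0) ⨾ (1 + d) ≔ hd (tl (var d)) ⨾ reversal {A = B} d
                   ⨾ (1 + d) ≔ tl (tl (var d)) ⨾ d ≔ hd (var d) ⨾ loop d ⨾ d ≔ var (1 + d)
    ; time = con 13 ⊕ X ⊗ con 4 ⊕ X ⊗ (con 7 ⊕ step-time)
    ; growth = p
    ; grows = λ (a , xs , s) → bounded a s xs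
    ; computes = λ {M} d σ (a , xs , s) eq →
        let σ₁ = σ [ 2 + d ↦ atom 0 ]
            σ₂ = σ₁ [ 1 + d ↦ head (tail (σ₁ d)) ]
            eq₁ : σ₁ d ≡ encode (a , xs , s)
            eq₁ = trans (lookup-minimal σ _ (>⇒≢ (n≤1+n _))) eq
            σ₃ , R , R≤ , reversed≡ , keep₃ = reversal-runs {M = M} d σ₂ xs []
              (trans (lookup-updated σ₁ (1 + d) _) (cong (head ∘ tail) eq₁))
              (trans (lookup-minimal σ₁ _ (<⇒≢ ≤-refl)) (lookup-updated σ (2 + d) _))
            eq₃ : σ₃ d ≡ encode (a , xs , s)
            eq₃ = trans (keep₃ ≤-refl) (trans (lookup-minimal σ₁ _ (>⇒≢ ≤-refl)) eq₁)
            σ₄ = σ₃ [ 1 + d ↦ tail (tail (σ₃ d)) ]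
            eq₄ : σ₄ d ≡ encode (a , xs , s)
            eq₄ = trans (lookup-minimal σ₃ _ (>⇒≢ ≤-refl)) eq₃
            σ₅ = σ₄ [ d ↦ head (σ₄ d) ]
            σ₆ , L , L≤ , result≡ , keep₆ = loop-runs {M = M} d σ₅ a s (xs ʳ++ []) []
              (trans (lookup-updated σ₄ d _) (cong head eq₄))
              (trans (lookup-minimal σ₄ _ (<⇒≢ ≤-refl))
                (trans (lookup-updated σ₃ (1 + d) _) (cong (tail ∘ tail) eq₃)))
              (trans (lookup-minimal σ₄ _ (<⇒≢ (n≤1+n _)))
                (trans (lookup-minimal σ₃ _ (<⇒≢ ≤-refl)) reversed≡))
            twice : (xs ʳ++ []) ʳ++ [] ≡ xs
            twice = reverse-involutive xs
            N = size a + (sizes xs + size s)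
            L≤′ : duration L ≤ N * (7 + ⟦ step-time ⟧ N) + 1
            L≤′ = ≤-trans L≤ (+-monoˡ-≤ 1 (*-mono-≤
                    (≤-trans (≤-reflexive (length-reverse xs)) (xs≤ a xs s))
                    (≤-reflexive (cong (λ zs → 7 + ⟦ step-time ⟧ (size a + (sizes zs + size s))) twice))))
            R≤′ : duration R ≤ N * 4 + 1
            R≤′ = ≤-trans R≤ (+-monoˡ-≤ 1 (*-monoˡ-≤ 4 (xs≤ a xs s)))
        in record
          { final   = σ₆ [ d ↦ σ₆ (1 + d) ]
          ; runs    = exec-⨾ (exec-≔ (2 + d) (lit (atom 0)) σ) (exec-⨾ (exec-≔ (1 + d) (hd (tl (var d))) σ₁)
                        (exec-⨾ R (exec-⨾ (exec-≔ (1 + d) (tl (tl (var d))) σ₃)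
                          (exec-⨾ (exec-≔ d (hd (var d)) σ₄)
                            (exec-⨾ L (exec-≔ d (var (1 + d)) σ₆))))))
          ; in-time = ≤-trans (total-mono R≤′ L≤′) (≤-reflexive (arith (N * 4) (N * (7 + ⟦ step-time ⟧ N))))
          ; result  = trans (lookup-updated σ₆ d _)
                        (trans result≡ (cong (λ zs → encode (foldr (f a) s zs)) twice))
          ; frame   = λ {y} y< → trans (lookup-minimal σ₆ _ (>⇒≢ y<)) (trans (keep₆ y<)
                        (trans (lookup-minimal σ₄ _ (>⇒≢ y<)) (trans (lookup-minimal σ₃ _ (>⇒≢ (m<n⇒m<1+n y<)))
                          (trans (keep₃ (m<n⇒m<1+n y<)) (trans (lookup-minimal σ₁ _ (>⇒≢ (m<n⇒m<1+n y<)))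
                            (lookup-minimal σ _ (>⇒≢ (m<n⇒m<1+n (m<n⇒m<1+n y<)))))))))
          }
    }
    where
    xs≤ : ∀ a (xs : List B) s → length xs ≤ size a + (sizes xs + size s)
    xs≤ a xs s = ≤-trans (length≤sizes xs) (≤-trans (m≤m+n _ (size s)) (m≤n+m _ (size a)))
    total-mono : ∀ {R R′ L L′} → R ≤ R′ → L ≤ L′ →
      suc (1 + suc (1 + suc (R + suc (1 + suc (1 + suc (L + 1)))))) ≤
      suc (1 + suc (1 + suc (R′ + suc (1 + suc (1 + suc (L′ + 1))))))
    total-mono R≤ L≤ = +-monoʳ-≤ 5 (+-mono-≤ R≤ (+-monoʳ-≤ 5 (+-monoˡ-≤ 1 L≤)))
    arith : ∀ r l → suc (1 + suc (1 + suc (r + 1 + suc (1 + suc (1 + suc (l + 1 + 1)))))) ≡ 13 + r + l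
    arith = solve-∀

  folded : {xs : A → List B} {s : A → S} → PolyTime xs → PolyTime s → PolyTime (λ a → foldr (f a) (s a) (xs a))
  folded XS S₀ = fold-triple ∙∘ ⟪ identity , ⟪ XS , S₀ ⟫ ⟫

-- The algorithm

isZero : ℕ → Bool
isZero zero    = true
isZero (suc _) = false

same : Name → Name → Bool
same u v = index u ≡ᵇ index v

mem : List Name → Name → Bool
mem P v = foldr (λ u b → if same v u then true else b) false P

allIn noneIn : List Name → List Name → Bool
allIn  P e = foldr (λ v b → if mem P v then b else false) true e
noneIn P e = foldr (λ v b → if mem P v then false else b) true e

-- The vertices already put inside, and those already put outside.
Split : Set
Split = List Name × List Name

factor : Split → ℕ × ℕ → Name → ℕ
factor (P , Q) (a , b) v = if mem Q v then 0 else (if mem P v then b else a)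

-- If each vertex v is put inside with probability φ v / b, then e (of size at
-- most i) comes to lie inside with probability weight i b φ e / b^i.
weight : ℕ → ℕ → (Name → ℕ) → List Name → ℕ
weight zero    b φ e       = 1
weight (suc i) b φ []      = b * weight i b φ []
weight (suc i) b φ (v ∷ e) = φ v * weight i b φ e

total : ℕ → Split → ℕ × ℕ → List (List Name) → ℕ
total r s c E = foldr (λ e n → weight r (proj₂ c) (factor s c) e + n) 0 E

square : ℕ → ℕ
square n = n * n

deficit : ℕ → Split → ℕ × ℕ → List (List Name) → ℕ
deficit r s c E = total r ([] , []) c E ∸ total r s c E

-- The Φ of the overview, scaled by b^(2 r): truncated subtraction is the positive part, and
-- exchanging the sides of the split together with the two biases yields the count for the outside.
potential : ℕ → (ℕ × ℕ) × ℕ → List (List Name) → Split → ℕ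
potential r ((a , a′) , b) E s =
  square (deficit r s (a , b) E) + square (deficit r (swap s) (a′ , b) E)

putIn putOut : Name → Split → Split
putIn  v (P , Q) = v ∷ P , Q
putOut v (P , Q) = P , v ∷ Q

assign : ℕ → (ℕ × ℕ) × ℕ → List (List Name) → Name → Split → Split
assign r c E v s =
  if mem (proj₁ s) v then s else (
  if mem (proj₂ s) v then s else (
  if isZero (potential r c E (putIn v s) ∸ potential r c E (putOut v s))
    then putIn v s else putOut v s))

split : ℕ → (ℕ × ℕ) × ℕ → List (List Name) → Split
split r c E = foldr (λ e s → foldr (assign r c E) s e) ([] , []) E

-- The least a such that a / b ≥ 2^(-1/r).
threshold : ℕ → ℕ → ℕ
threshold r b = foldr (λ _ a → if isZero (b ^ r ∸ (a ^ r + a ^ r)) then a else suc a) 0 (replicate b tt)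

-- The budgets for the inside and the outside, and the separator so far.  The
-- budgets start at m, and a kept hyperedge costs two units.
Budget : Set
Budget = ℕ × (ℕ × List Bool)

-- Paying two units out of m enforces 2 · kept ≤ m without halving m. The test `isZero (i ∸ 1)`
-- means i ≤ 1, that is, no further hyperedge can be paid for.
discard keepIn keepOut : Budget → Budget
discard (i , o , R) = i , o , true ∷ R
keepIn  (i , o , R) = if isZero (i ∸ 1) then (i , o , true ∷ R) else (i ∸ 2 , o , false ∷ R)
keepOut (i , o , R) = if isZero (o ∸ 1) then (i , o , true ∷ R) else (i , o ∸ 2 , false ∷ R)

place : List Name → List Name → Budget → Budget
place P e β = if allIn P e then keepIn β else (if noneIn P e then keepOut β else discard β)

collect : List Name → ℕ → List (List Name) → Budget
collect P m E = foldr (place P) (m , m , []) E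

coins : ℕ → ℕ → (ℕ × ℕ) × ℕ
coins r b = (threshold r b , b ∸ threshold r b) , b

-- A denominator of at least m keeps the rounding error of the bias to O(r) hyperedges. The 5 makes
-- the threshold at least 3, because 2 · 2^r < 5^r; this leaves the room a′ + 3 ≤ b used by the
-- strict bound on ε_r.
separator : ℕ → List (List Name) → List Bool
separator r E = proj₂ (proj₂ (collect (proj₁ (split r (coins r (length E + 5)) E)) (length E) E))

-- Its running time

infixr 9 _$₂_,_

_$₂_,_ : ∀ {A B C D} ⦃ _ : Encodable A ⦄ ⦃ _ : Encodable B ⦄ ⦃ _ : Encodable C ⦄ ⦃ _ : Encodable D ⦄
  {g : B × C → D} {f₁ : A → B} {f₂ : A → C} →
  PolyTime g → PolyTime f₁ → PolyTime f₂ → PolyTime (λ a → g (f₁ a , f₂ a))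
G $₂ F₁ , F₂ = G ∙∘ ⟪ F₁ , F₂ ⟫

sizes-replicate : ∀ n → sizes (replicate n tt) ≡ n
sizes-replicate zero    = refl
sizes-replicate (suc n) = cong suc (sizes-replicate n)

unaryᵖ : PolyTime (λ n → replicate n tt)
unaryᵖ = by-expr id X (λ n → ≤-reflexive (sizes-replicate n)) (λ _ _ _ eq → eq)

isZeroᵖ : PolyTime isZero
isZeroᵖ = by-expr (λ e → eqAtom e (lit (atom 0))) (con 0) (λ _ → z≤n) correct
  where
  correct : ∀ d (σ : Store) n → σ d ≡ encode n → bit (sameAtom (σ d) (atom 0)) ≡ encode (isZero n)
  correct d σ zero    eq rewrite eq = refl
  correct d σ (suc n) eq rewrite eq = refl

sucᵖ : PolyTime suc
sucᵖ = by-expr (cons (lit (atom 0))) (X ⊕ con 1) (λ n → ≤-reflexive (+-comm 1 n)) (λ _ _ _ → cong (atom 0 ∙_))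

predᵖ : PolyTime pred
predᵖ = by-expr tl X (λ n → pred[n]≤n) correct
  where
  correct : ∀ d (σ : Store) n → σ d ≡ encode n → tail (σ d) ≡ encode (pred n)
  correct d σ zero    eq rewrite eq = refl
  correct d σ (suc n) eq rewrite eq = refl

module _ {A} ⦃ _ : Encodable A ⦄ where

  consᵖ : PolyTime {A × List A} (λ p → proj₁ p ∷ proj₂ p)
  consᵖ = by-expr id (X ⊕ con 1) (λ p → ≤-reflexive (+-comm 1 _)) (λ _ _ _ eq → eq)

  nullᵖ : PolyTime {List A} null
  nullᵖ = by-expr (λ e → eqAtom e (lit (atom 0))) (con 0) (λ _ → z≤n) correct
    where
    correct : ∀ d (σ : Store) xs → σ d ≡ encode xs → bit (sameAtom (σ d) (atom 0)) ≡ encode (null xs)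
    correct d σ []      eq rewrite eq = refl
    correct d σ (_ ∷ _) eq rewrite eq = refl

  restᵖ : PolyTime {List A} (drop 1)
  restᵖ = by-expr tl X smaller correct
    where
    smaller : ∀ xs → sizes (drop 1 xs) ≤ sizes xs
    smaller []       = z≤n
    smaller (x ∷ xs) = ≤-trans (m≤n+m _ (size x)) (n≤1+n _)
    correct : ∀ d (σ : Store) xs → σ d ≡ encode xs → tail (σ d) ≡ encode (drop 1 xs)
    correct d σ []      eq rewrite eq = refl
    correct d σ (_ ∷ _) eq rewrite eq = refl

  lengthᵖ : PolyTime {List A} length
  lengthᵖ = by-ext counts (folded {f = λ _ _ n → suc n} (sucᵖ ∙∘ snd) X bounded identity (constant 0))
    where
    counts : ∀ xs → foldr (λ _ n → suc n) 0 xs ≡ length xs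
    counts []       = refl
    counts (x ∷ xs) = cong suc (counts xs)
    bounded : ∀ (a : List A) s (xs : List A) → foldr (λ _ n → suc n) s xs ≤ sizes a + (sizes xs + s)
    bounded a s []       = m≤n+m s (sizes a)
    bounded a s (x ∷ xs) = ≤-trans (s≤s (bounded a s xs)) (≤-trans (≤-reflexive (sym (+-suc (sizes a) _)))
      (+-monoʳ-≤ (sizes a) (s≤s (+-monoˡ-≤ s (m≤n+m _ (size x))))))

firstName : List Name → Name
firstName []      = name 0
firstName (v ∷ _) = v

firstNameᵖ : PolyTime firstName
firstNameᵖ = by-expr hd (con 0) (λ _ → z≤n) correct
  where
  correct : ∀ d (σ : Store) xs → σ d ≡ encode xs → head (σ d) ≡ encode (firstName xs)
  correct d σ []      eq rewrite eq = refl
  correct d σ (_ ∷ _) eq rewrite eq = refl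

sameᵖ : PolyTime {Name × Name} (λ p → same (proj₁ p) (proj₂ p))
sameᵖ = by-expr (λ e → eqAtom (hd e) (tl e)) (con 0) (λ _ → z≤n) correct
  where
  correct : ∀ d (σ : Store) p → σ d ≡ encode p →
            bit (sameAtom (head (σ d)) (tail (σ d))) ≡ encode (same (proj₁ p) (proj₂ p))
  correct d σ p eq rewrite eq = refl

memᵖ : PolyTime {List Name × Name} (λ p → mem (proj₁ p) (proj₂ p))
memᵖ = folded {f = λ (_ , v) u b → if same v u then true else b}
  (conditional (sameᵖ $₂ snd ∙∘ fst ∙∘ fst , snd ∙∘ fst) (constant true) snd)
  (con 0) (λ _ _ _ → z≤n) fst (constant false)

allInᵖ : PolyTime {List Name × List Name} (λ p → allIn (proj₁ p) (proj₂ p))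
allInᵖ = folded {f = λ (P , _) v b → if mem P v then b else false}
  (conditional (memᵖ $₂ fst ∙∘ fst ∙∘ fst , snd ∙∘ fst) snd (constant false))
  (con 0) (λ _ _ _ → z≤n) snd (constant true)

noneInᵖ : PolyTime {List Name × List Name} (λ p → noneIn (proj₁ p) (proj₂ p))
noneInᵖ = folded {f = λ (P , _) v b → if mem P v then false else b}
  (conditional (memᵖ $₂ fst ∙∘ fst ∙∘ fst , snd ∙∘ fst) (constant false) snd)
  (con 0) (λ _ _ _ → z≤n) snd (constant true)

addᵖ : PolyTime {ℕ × ℕ} (λ p → proj₁ p + proj₂ p)
addᵖ = by-ext (λ (x , y) → adds x y)
  (folded {f = λ _ _ n → suc n} (sucᵖ ∙∘ snd) X bounded (unaryᵖ ∙∘ fst) snd)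
  where
  adds : ∀ x y → foldr (λ _ n → suc n) y (replicate x tt) ≡ x + y
  adds zero    y = refl
  adds (suc x) y = cong suc (adds x y)
  bounded : ∀ (a : ℕ × ℕ) s (xs : List ⊤) → foldr (λ _ n → suc n) s xs ≤ size a + (sizes xs + s)
  bounded a s []       = m≤n+m s (size a)
  bounded a s (x ∷ xs) = ≤-trans (s≤s (bounded a s xs)) (≤-reflexive (sym (+-suc (size a) _)))

mulᵖ : PolyTime {ℕ × ℕ} (λ p → proj₁ p * proj₂ p)
mulᵖ = by-ext (λ (x , y) → muls x y)
  (folded {f = λ (_ , y) _ n → y + n} (addᵖ $₂ snd ∙∘ fst ∙∘ fst , snd) (X ⊗ X ⊕ X)
    bounded (unaryᵖ ∙∘ fst) (constant 0))
  where
  muls : ∀ x y → foldr (λ _ n → y + n) 0 (replicate x tt) ≡ x * y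
  muls zero    y = refl
  muls (suc x) y = cong (y +_) (muls x y)
  exact : ∀ y s (xs : List ⊤) → foldr (λ _ n → y + n) s xs ≡ sizes xs * y + s
  exact y s []       = refl
  exact y s (x ∷ xs) = trans (cong (y +_) (exact y s xs)) (sym (+-assoc y _ s))
  bounded : ∀ (a : ℕ × ℕ) s (xs : List ⊤) → foldr (λ _ n → proj₂ a + n) s xs ≤
            (size a + (sizes xs + s)) * (size a + (sizes xs + s)) + (size a + (sizes xs + s))
  bounded a@(x , y) s xs = ≤-trans (≤-reflexive (exact y s xs)) (+-mono-≤
    (*-mono-≤ (≤-trans (m≤m+n (sizes xs) s) (m≤n+m _ (x + y))) (≤-trans (m≤n+m y x) (m≤m+n (x + y) _)))
    (≤-trans (m≤n+m s (sizes xs)) (m≤n+m _ (x + y))))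

subᵖ : PolyTime {ℕ × ℕ} (λ p → proj₁ p ∸ proj₂ p)
subᵖ = by-ext (λ (x , y) → subs x y)
  (folded {f = λ _ _ n → pred n} (predᵖ ∙∘ snd) X bounded (unaryᵖ ∙∘ snd) fst)
  where
  subs : ∀ x y → foldr (λ _ n → pred n) x (replicate y tt) ≡ x ∸ y
  subs x zero    = refl
  subs x (suc y) = trans (cong pred (subs x y)) (pred[m∸n]≡m∸[1+n] x y)
  bounded : ∀ (a : ℕ × ℕ) s (xs : List ⊤) → foldr (λ _ n → pred n) s xs ≤ size a + (sizes xs + s)
  bounded a s []       = m≤n+m s (size a)
  bounded a s (x ∷ xs) = ≤-trans pred[n]≤n (≤-trans (bounded a s xs) (+-monoʳ-≤ (size a) (n≤1+n _)))

powᵖ : ∀ r → PolyTime (λ a → a ^ r)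
powᵖ zero    = constant 1
powᵖ (suc r) = mulᵖ $₂ identity , powᵖ r

squareᵖ : PolyTime square
squareᵖ = mulᵖ $₂ identity , identity

factorᵖ : PolyTime {(Split × (ℕ × ℕ)) × Name} (λ p → factor (proj₁ (proj₁ p)) (proj₂ (proj₁ p)) (proj₂ p))
factorᵖ = conditional (memᵖ $₂ snd ∙∘ fst ∙∘ fst , snd) (constant 0)
            (conditional (memᵖ $₂ fst ∙∘ fst ∙∘ fst , snd) (snd ∙∘ snd ∙∘ fst) (fst ∙∘ snd ∙∘ fst))

-- The recursion on `i` happens while the program is built: r is a constant, so the product unrolls
-- into loop-free code over the factors.
weightᵖ : ∀ i → PolyTime {(Split × (ℕ × ℕ)) × List Name}
  (λ p → weight i (proj₂ (proj₂ (proj₁ p))) (factor (proj₁ (proj₁ p)) (proj₂ (proj₁ p))) (proj₂ p))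
weightᵖ zero    = constant 1
weightᵖ (suc i) = by-ext (λ { (_ , []) → refl ; (_ , _ ∷ _) → refl })
  (mulᵖ $₂ conditional (nullᵖ ∙∘ snd) (snd ∙∘ snd ∙∘ fst) (factorᵖ $₂ fst , firstNameᵖ ∙∘ snd)
         , weightᵖ i ∙∘ ⟪ fst , restᵖ ∙∘ snd ⟫)

factor≤ : ∀ s a b v → factor s (a , b) v ≤ a + b
factor≤ (P , Q) a b v with mem Q v
... | true  = z≤n
... | false with mem P v
...   | true  = m≤n+m b a
...   | false = m≤m+n a b

weight≤ : ∀ i {b c φ} → b ≤ c → (∀ v → φ v ≤ c) → ∀ e → weight i b φ e ≤ c ^ i
weight≤ zero    b≤c φ≤c e       = ≤-refl
weight≤ (suc i) b≤c φ≤c []      = *-mono-≤ b≤c (weight≤ i b≤c φ≤c [])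
weight≤ (suc i) b≤c φ≤c (v ∷ e) = *-mono-≤ (φ≤c v) (weight≤ i b≤c φ≤c e)

power : ℕ → Poly
power zero    = con 1
power (suc r) = X ⊗ power r

⟦power⟧ : ∀ r n → ⟦ power r ⟧ n ≡ n ^ r
⟦power⟧ zero    n = refl
⟦power⟧ (suc r) n = cong (n *_) (⟦power⟧ r n)

-- Unary numbers force the values themselves to be polynomial. Each hyperedge contributes at most (a
-- + b)^r, a polynomial because r is fixed.
totalᵖ : ∀ r → PolyTime {(Split × (ℕ × ℕ)) × List (List Name)}
  (λ p → total r (proj₁ (proj₁ p)) (proj₂ (proj₁ p)) (proj₂ p))
totalᵖ r = folded {f = λ ((s , c) , _) e n → weight r (proj₂ c) (factor s c) e + n}
  (addᵖ $₂ weightᵖ r ∙∘ ⟪ fst ∙∘ fst ∙∘ fst , snd ∙∘ fst ⟫ , snd)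
  (X ⊗ power r ⊕ X) bounded snd (constant 0)
  where
  bounded′ : ∀ s a b n (E : List (List Name)) →
    foldr (λ e n → weight r b (factor s (a , b)) e + n) n E ≤ sizes E * (a + b) ^ r + n
  bounded′ s a b n []      = ≤-refl
  bounded′ s a b n (e ∷ E) = ≤-trans (+-mono-≤ (weight≤ r (m≤n+m b a) (factor≤ s a b) e) (bounded′ s a b n E))
    (≤-trans (≤-reflexive (sym (+-assoc _ (sizes E * (a + b) ^ r) n)))
      (+-monoˡ-≤ n (*-monoˡ-≤ ((a + b) ^ r) (s≤s (m≤n+m (sizes E) (sizes e))))))
  bounded : ∀ (x : (Split × (ℕ × ℕ)) × List (List Name)) n E →
    foldr (λ e n → weight r (proj₂ (proj₂ (proj₁ x))) (factor (proj₁ (proj₁ x)) (proj₂ (proj₁ x))) e + n) n E ≤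
    ⟦ X ⊗ power r ⊕ X ⟧ (size x + (sizes E + n))
  bounded x@((s , (a , b)) , E′) n E = ≤-trans (bounded′ s a b n E) (+-mono-≤
    (*-mono-≤ (≤-trans (m≤m+n (sizes E) n) (m≤n+m _ (size x)))
      (≤-trans (^-monoˡ-≤ r (≤-trans (m≤n+m (a + b) (size s)) (≤-trans (m≤m+n _ (sizes E′)) (m≤m+n (size x) _))))
        (≤-reflexive (sym (⟦power⟧ r _)))))
    (≤-trans (m≤n+m n (sizes E)) (m≤n+m _ (size x))))

deficitᵖ : ∀ r → PolyTime {(Split × (ℕ × ℕ)) × List (List Name)}
  (λ p → deficit r (proj₁ (proj₁ p)) (proj₂ (proj₁ p)) (proj₂ p))
deficitᵖ r = subᵖ $₂ totalᵖ r ∙∘ ⟪ ⟪ constant ([] , []) , snd ∙∘ fst ⟫ , snd ⟫ , totalᵖ r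

Instance : Set
Instance = ((ℕ × ℕ) × ℕ) × List (List Name)

potentialᵖ : ∀ r → PolyTime {Instance × Split} (λ p → potential r (proj₁ (proj₁ p)) (proj₂ (proj₁ p)) (proj₂ p))
potentialᵖ r = addᵖ
  $₂ squareᵖ ∙∘ deficitᵖ r ∙∘ ⟪ ⟪ snd , ⟪ fst ∙∘ fst ∙∘ fst ∙∘ fst , snd ∙∘ fst ∙∘ fst ⟫ ⟫ , snd ∙∘ fst ⟫
  ,  squareᵖ ∙∘ deficitᵖ r ∙∘ ⟪ ⟪ ⟪ snd ∙∘ snd , fst ∙∘ snd ⟫
                                 , ⟪ snd ∙∘ fst ∙∘ fst ∙∘ fst , snd ∙∘ fst ∙∘ fst ⟫ ⟫ , snd ∙∘ fst ⟫

putInᵖ : PolyTime {Name × Split} (λ p → putIn (proj₁ p) (proj₂ p))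
putInᵖ = ⟪ consᵖ $₂ fst , fst ∙∘ snd , snd ∙∘ snd ⟫

putOutᵖ : PolyTime {Name × Split} (λ p → putOut (proj₁ p) (proj₂ p))
putOutᵖ = ⟪ fst ∙∘ snd , consᵖ $₂ fst , snd ∙∘ snd ⟫

assignᵖ : ∀ r → PolyTime {(Instance × Name) × Split}
  (λ p → assign r (proj₁ (proj₁ (proj₁ p))) (proj₂ (proj₁ (proj₁ p))) (proj₂ (proj₁ p)) (proj₂ p))
assignᵖ r = conditional (memᵖ $₂ fst ∙∘ snd , snd ∙∘ fst) snd
  (conditional (memᵖ $₂ snd ∙∘ snd , snd ∙∘ fst) snd
    (conditional (isZeroᵖ ∙∘ subᵖ $₂ potentialᵖ r ∙∘ ⟪ fst ∙∘ fst , inside ⟫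
                                   , potentialᵖ r ∙∘ ⟪ fst ∙∘ fst , outside ⟫)
      inside outside))
  where
  inside  = putInᵖ ∙∘ ⟪ snd ∙∘ fst , snd {A = Instance × Name} {B = Split} ⟫
  outside = putOutᵖ ∙∘ ⟪ snd ∙∘ fst , snd {A = Instance × Name} {B = Split} ⟫

size-assign : ∀ r c E v s → size (assign r c E v s) ≤ suc (size s)
size-assign r c E v (P , Q) with mem P v
... | true  = n≤1+n _
... | false with mem Q v
...   | true  = n≤1+n _
...   | false with isZero (potential r c E (v ∷ P , Q) ∸ potential r c E (P , v ∷ Q))
...     | true  = ≤-refl
...     | false = ≤-reflexive (+-suc (sizes P) (sizes Q))

size-assigns : ∀ r c E s (e : List Name) → size (foldr (assign r c E) s e) ≤ sizes e + size s
size-assigns r c E s []      = ≤-refl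
size-assigns r c E s (v ∷ e) = ≤-trans (size-assign r c E v (foldr (assign r c E) s e)) (s≤s (size-assigns r c E s e))

splitᵖ : ∀ r → PolyTime {Instance} (λ p → split r (proj₁ p) (proj₂ p))
splitᵖ r = folded {f = λ (c , E) e s → foldr (assign r c E) s e}
  (folded {f = λ ((x , _) , _) v s → assign r (proj₁ x) (proj₂ x) v s}
    (assignᵖ r ∙∘ ⟪ ⟪ fst ∙∘ fst ∙∘ fst ∙∘ fst , snd ∙∘ fst ⟫ , snd ⟫)
    X (λ y s e → ≤-trans (size-assigns r (proj₁ (proj₁ (proj₁ y))) (proj₂ (proj₁ (proj₁ y))) s e) (m≤n+m (sizes e + size s) (size y))) (snd ∙∘ fst) snd)
  X (λ x s E → ≤-trans (bounded x s E) (m≤n+m (sizes E + size s) (size x))) snd (constant ([] , []))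
  where
  bounded : ∀ (x : Instance) s (E : List (List Name)) →
    size (foldr (λ e s → foldr (assign r (proj₁ x) (proj₂ x)) s e) s E) ≤ sizes E + size s
  bounded x s []      = ≤-refl
  bounded x s (e ∷ E) = ≤-trans (size-assigns r (proj₁ x) (proj₂ x) (foldr (λ e s → foldr (assign r (proj₁ x) (proj₂ x)) s e) s E) e)
    (≤-trans (+-monoʳ-≤ (sizes e) (bounded x s E)) (≤-trans (≤-reflexive (sym (+-assoc (sizes e) (sizes E) (size s)))) (n≤1+n _)))

thresholdᵖ : ∀ r → PolyTime (threshold r)
thresholdᵖ r = folded {f = λ b _ a → if isZero (b ^ r ∸ (a ^ r + a ^ r)) then a else suc a}
  (conditional (isZeroᵖ ∙∘ subᵖ $₂ powᵖ r ∙∘ fst ∙∘ fst , addᵖ $₂ powᵖ r ∙∘ snd , powᵖ r ∙∘ snd) snd (sucᵖ ∙∘ snd))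
  X bounded unaryᵖ (constant 0)
  where
  bounded : ∀ b s (xs : List ⊤) →
    foldr (λ _ a → if isZero (b ^ r ∸ (a ^ r + a ^ r)) then a else suc a) s xs ≤ b + (sizes xs + s)
  bounded b s [] = m≤n+m s b
  bounded b s (x ∷ xs)
    with foldr (λ _ a → if isZero (b ^ r ∸ (a ^ r + a ^ r)) then a else suc a) s xs | bounded b s xs
  ... | a | a≤ with isZero (b ^ r ∸ (a ^ r + a ^ r))
  ...   | true  = ≤-trans a≤ (+-monoʳ-≤ b (n≤1+n _))
  ...   | false = ≤-trans (s≤s a≤) (≤-reflexive (sym (+-suc b _)))

coinsᵖ : ∀ r → PolyTime (coins r)
coinsᵖ r = ⟪ ⟪ thresholdᵖ r , subᵖ $₂ identity , thresholdᵖ r ⟫ , identity ⟫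

discardᵖ : PolyTime discard
discardᵖ = ⟪ fst , ⟪ fst ∙∘ snd , consᵖ $₂ constant true , snd ∙∘ snd ⟫ ⟫

keepInᵖ : PolyTime keepIn
keepInᵖ = conditional (isZeroᵖ ∙∘ subᵖ $₂ fst , constant 1) discardᵖ
  ⟪ subᵖ $₂ fst , constant 2 , ⟪ fst ∙∘ snd , consᵖ $₂ constant false , snd ∙∘ snd ⟫ ⟫

keepOutᵖ : PolyTime keepOut
keepOutᵖ = conditional (isZeroᵖ ∙∘ subᵖ $₂ fst ∙∘ snd , constant 1) discardᵖ
  ⟪ fst , ⟪ subᵖ $₂ fst ∙∘ snd , constant 2 , consᵖ $₂ constant false , snd ∙∘ snd ⟫ ⟫

placeᵖ : PolyTime {(List Name × List Name) × Budget} (λ p → place (proj₁ (proj₁ p)) (proj₂ (proj₁ p)) (proj₂ p))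
placeᵖ = conditional (allInᵖ ∙∘ fst) (keepInᵖ ∙∘ snd)
  (conditional (noneInᵖ ∙∘ fst) (keepOutᵖ ∙∘ snd) (discardᵖ ∙∘ snd))

size-discard : ∀ i o R → size (discard (i , o , R)) ≡ suc (size (i , o , R))
size-discard i o R = trans (cong (i +_) (+-suc o (sizes R))) (+-suc i (o + sizes R))

size-place : ∀ P e β → size (place P e β) ≤ suc (size β)
size-place P e (i , o , R) with allIn P e
size-place P e (i , o , R) | true with isZero (i ∸ 1)
... | true  = ≤-reflexive (size-discard i o R)
... | false = ≤-trans (+-monoˡ-≤ _ (m∸n≤m i 2)) (≤-reflexive (size-discard i o R))
size-place P e (i , o , R) | false with noneIn P e
... | false = ≤-reflexive (size-discard i o R)
... | true with isZero (o ∸ 1)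
...   | true  = ≤-reflexive (size-discard i o R)
...   | false = ≤-trans (+-monoʳ-≤ i (+-monoˡ-≤ _ (m∸n≤m o 2))) (≤-reflexive (size-discard i o R))

collectᵖ : PolyTime {List Name × (ℕ × List (List Name))} (λ p → collect (proj₁ p) (proj₁ (proj₂ p)) (proj₂ (proj₂ p)))
collectᵖ = folded {f = λ (P , _) e β → place P e β} (placeᵖ ∙∘ ⟪ ⟪ fst ∙∘ fst ∙∘ fst , snd ∙∘ fst ⟫ , snd ⟫)
  X (λ y β E → ≤-trans (bounded (proj₁ y) β E) (m≤n+m (sizes E + size β) (size y))) (snd ∙∘ snd) ⟪ fst ∙∘ snd , ⟪ fst ∙∘ snd , constant [] ⟫ ⟫
  where
  bounded : ∀ P β (E : List (List Name)) → size (foldr (place P) β E) ≤ sizes E + size β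
  bounded P β []      = ≤-refl
  bounded P β (e ∷ E) = ≤-trans (size-place P e (foldr (place P) β E)) (s≤s (≤-trans (bounded P β E) (+-monoˡ-≤ (size β) (m≤n+m _ (sizes e)))))

abstract
  separatorᵖ : ∀ r → PolyTime (separator r)
  separatorᵖ r = snd ∙∘ snd ∙∘ collectᵖ ∙∘ ⟪ fst ∙∘ splitᵖ r ∙∘ ⟪ coinsᵖ r ∙∘ addᵖ $₂ lengthᵖ , constant 5 , identity ⟫
                                             , ⟪ lengthᵖ , identity ⟫ ⟫

-- Membership and counting

clash : ∀ {A : Set} {b} → b ≡ true → b ≡ false → A
clash refl ()

same-refl : ∀ v → same v v ≡ true
same-refl v = ≡ᵇ-refl (index v)

same-≢ : ∀ {u v} → u ≢ v → same u v ≡ false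
same-≢ u≢v = ≢⇒≡ᵇ-false (u≢v ∘ cong name)

same-sound : ∀ u v → same u v ≡ true → u ≡ v
same-sound (name i) (name j) eq with i ≟ j
... | yes i≡j = cong name i≡j
... | no  i≢j = contradiction (trans (sym eq) (≢⇒≡ᵇ-false i≢j)) λ ()

mem-here : ∀ v P → mem (v ∷ P) v ≡ true
mem-here v P rewrite same-refl v = refl

mem-there : ∀ {u v} P → u ≢ v → mem (v ∷ P) u ≡ mem P u
mem-there P u≢v rewrite same-≢ u≢v = refl

mem-grows : ∀ u v P → mem P u ≡ true → mem (v ∷ P) u ≡ true
mem-grows u v P eq with same u v
... | true  = refl
... | false = eq

mem-false : ∀ {v} e → mem e v ≡ false → All (v ≢_) e
mem-false [] eq = []
mem-false {v} (u ∷ e) eq with same v u in v≟u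
... | false = (λ v≡u → contradiction (trans (sym (same-refl v)) (trans (cong (same v) v≡u) v≟u)) λ ())
              ∷ mem-false e eq

𝟙 : Bool → ℕ
𝟙 b = if b then 1 else 0

count : ∀ {A : Set} → (A → Bool) → List A → ℕ
count p []       = 0
count p (x ∷ xs) = 𝟙 (p x) + count p xs

-- Weights

weight-cong : ∀ i b {φ ψ e} → All (λ v → φ v ≡ ψ v) e → weight i b φ e ≡ weight i b ψ e
weight-cong zero    b eqs        = refl
weight-cong (suc i) b []         = cong (b *_) (weight-cong i b [])
weight-cong (suc i) b (eq ∷ eqs) = cong₂ _*_ eq (weight-cong i b eqs)

-- The law of total probability for the placement of v, with denominators cleared. A duplicate-free
-- `e` contains v at most once, so its weight is linear in the factor of v.
weight-average : ∀ i {a a′ b v φ φ₁ φ₀} → a + a′ ≡ b →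
  (∀ u → u ≢ v → φ₁ u ≡ φ u) → (∀ u → u ≢ v → φ₀ u ≡ φ u) →
  φ v ≡ a → φ₁ v ≡ b → φ₀ v ≡ 0 → ∀ {e} → Unique e →
  a * weight i b φ₁ e + a′ * weight i b φ₀ e ≡ b * weight i b φ e
weight-average zero {a} {a′} a+a′≡b off₁ off₀ at at₁ at₀ _ =
  trans (sym (*-distribʳ-+ 1 a a′)) (cong (_* 1) a+a′≡b)
weight-average (suc i) {a} {a′} {b} a+a′≡b off₁ off₀ at at₁ at₀ [] =
  trans (shuffle a a′ b _ _) (cong (b *_) (weight-average i a+a′≡b off₁ off₀ at at₁ at₀ []))
  where
  shuffle : ∀ a a′ b x y → a * (b * x) + a′ * (b * y) ≡ b * (a * x + a′ * y)
  shuffle = solve-∀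
weight-average (suc i) {a} {a′} {b} {v} {φ} {φ₁} {φ₀} a+a′≡b off₁ off₀ at at₁ at₀ {u ∷ e} (u∉ ∷ uniq)
  with same u v in u≟v
... | true rewrite same-sound u v u≟v | at | at₁ | at₀
           | weight-cong i b {φ₁} {φ} (All.map (λ v≢w → off₁ _ (v≢w ∘ sym)) u∉)
           = only (weight i b φ e)
  where
  only : ∀ x → a * (b * x) + a′ * 0 ≡ b * (a * x)
  only = shuffle a a′ b
    where
    shuffle : ∀ a a′ b x → a * (b * x) + a′ * 0 ≡ b * (a * x)
    shuffle = solve-∀
... | false rewrite off₁ u (λ u≡v → contradiction (trans (sym (same-refl v)) (trans (cong (λ w → same w v) (sym u≡v)) u≟v)) λ ())
                  | off₀ u (λ u≡v → contradiction (trans (sym (same-refl v)) (trans (cong (λ w → same w v) (sym u≡v)) u≟v)) λ ())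
  = trans (shuffle a a′ (φ u) _ _) (trans (cong (φ u *_) (weight-average i a+a′≡b off₁ off₀ at at₁ at₀ uniq))
      (swap* (φ u) b _))
  where
  shuffle : ∀ a a′ f x y → a * (f * x) + a′ * (f * y) ≡ f * (a * x + a′ * y)
  shuffle = solve-∀
  swap* : ∀ f b x → f * (b * x) ≡ b * (f * x)
  swap* = solve-∀

weights : ℕ → ℕ → (Name → ℕ) → List (List Name) → ℕ
weights r b φ E = foldr (λ e n → weight r b φ e + n) 0 E

weights-average : ∀ r {a a′ b v φ φ₁ φ₀} → a + a′ ≡ b →
  (∀ u → u ≢ v → φ₁ u ≡ φ u) → (∀ u → u ≢ v → φ₀ u ≡ φ u) →
  φ v ≡ a → φ₁ v ≡ b → φ₀ v ≡ 0 → ∀ {E} → All Unique E →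
  a * weights r b φ₁ E + a′ * weights r b φ₀ E ≡ b * weights r b φ E
weights-average r {a} {a′} {b} _ _ _ _ _ _ [] rewrite *-zeroʳ a | *-zeroʳ a′ | *-zeroʳ b = refl
weights-average r {a} {a′} {b} a+a′≡b off₁ off₀ at at₁ at₀ (uniq ∷ uniqs) =
  trans (shuffle a a′ _ _ _ _) (trans
    (cong₂ _+_ (weight-average r a+a′≡b off₁ off₀ at at₁ at₀ uniq)
               (weights-average r a+a′≡b off₁ off₀ at at₁ at₀ uniqs))
    (sym (*-distribˡ-+ b _ _)))
  where
  shuffle : ∀ a a′ x y z w → a * (x + y) + a′ * (z + w) ≡ (a * x + a′ * z) + (a * y + a′ * w)
  shuffle = solve-∀

-- A hyperedge that avoids v keeps its weight, and one through v has a weight between 0 and b^r on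
-- either side; so the degree of v controls the change.
weights-change : ∀ r {b v φ ψ} → (∀ u → u ≢ v → φ u ≡ ψ u) → (∀ u → φ u ≤ b) →
  ∀ E → weights r b φ E ≤ weights r b ψ E + count (λ e → mem e v) E * b ^ r
weights-change r off φ≤b []      = z≤n
weights-change r {b} {v} {φ} {ψ} off φ≤b (e ∷ E) with mem e v in v∈e
... | false = ≤-trans (+-mono-≤
    (≤-reflexive (weight-cong r b (All.map (λ v≢u → off _ (v≢u ∘ sym)) (mem-false e v∈e))))
    (weights-change r off φ≤b E))
  (≤-reflexive (sym (+-assoc (weight r b ψ e) _ _)))
... | true  = ≤-trans (+-mono-≤ (weight≤ r ≤-refl φ≤b e) (weights-change r off φ≤b E))
  (≤-trans (m≤n+m _ (weight r b ψ e)) (≤-reflexive (shuffle (weight r b ψ e) (b ^ r) (weights r b ψ E) (count (λ e → mem e v) E * b ^ r))))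
  where
  shuffle : ∀ w p x y → w + (p + (x + y)) ≡ w + x + (p + y)
  shuffle = solve-∀

-- The potential

square-mono : ∀ {m n} → m ≤ n → square m ≤ square n
square-mono m≤n = *-mono-≤ m≤n m≤n

square-cancel : ∀ m n → square m ≤ square n → m ≤ n
square-cancel m n m²≤n² with m ≤? n
... | yes m≤n = m≤n
... | no  m≰n = contradiction m²≤n² (<⇒≱ (*-mono-< (≰⇒> m≰n) (≰⇒> m≰n)))

-- (d − δ)² ≤ d² − 2 d δ + D² for d = (t − z)₊ and δ = x − z, |δ| ≤ D, with
-- the terms moved so that no subtraction occurs.
square-shortfall : ∀ t x z D → x ≤ z + D → z ≤ x + D →
  square (t ∸ x) + 2 * (t ∸ z) * x ≤ square (t ∸ z) + 2 * (t ∸ z) * z + square D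
square-shortfall t x z D x≤ z≤ with ≤-total z x
... | inj₁ z≤x with m≤n⇒∃[o]m+o≡n z≤x
...   | p , refl rewrite sym (∸-+-assoc t z p) = begin
  square (d ∸ p) + 2 * d * (z + p)             ≡⟨ regroup (square (d ∸ p)) d z p ⟩
  square (d ∸ p) + 2 * d * p + 2 * d * z       ≤⟨ +-monoˡ-≤ (2 * d * z) (complete d p) ⟩
  square d + square p + 2 * d * z              ≤⟨ +-monoˡ-≤ (2 * d * z) (+-monoʳ-≤ (square d) (square-mono (+-cancelˡ-≤ z p D x≤))) ⟩
  square d + square D + 2 * d * z              ≡⟨ regroup′ (square d) (square D) (2 * d * z) ⟩
  square d + 2 * d * z + square D              ∎
  where
  open ≤-Reasoning
  d = t ∸ z
  regroup : ∀ e d z p → e + 2 * d * (z + p) ≡ e + 2 * d * p + 2 * d * z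
  regroup = solve-∀
  regroup′ : ∀ a b c → a + b + c ≡ a + c + b
  regroup′ = solve-∀
  complete : ∀ d p → square (d ∸ p) + 2 * d * p ≤ square d + square p
  complete d p with ≤-total p d
  ... | inj₁ p≤d with m≤n⇒∃[o]m+o≡n p≤d
  ...   | e , refl rewrite m+n∸m≡n p e = ≤-reflexive (identity₁ p e)
    where
    identity₁ : ∀ p e → e * e + 2 * (p + e) * p ≡ (p + e) * (p + e) + p * p
    identity₁ = solve-∀
  complete d p | inj₂ d≤p with m≤n⇒∃[o]m+o≡n d≤p
  ...   | e , refl rewrite m≤n⇒m∸n≡0 d≤p = ≤-trans (m≤m+n _ (e * e)) (≤-reflexive (identity₂ d e))
    where
    identity₂ : ∀ d e → 2 * d * (d + e) + e * e ≡ d * d + (d + e) * (d + e)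
    identity₂ = solve-∀
square-shortfall t x z D x≤ z≤ | inj₂ x≤z with m≤n⇒∃[o]m+o≡n x≤z
...   | p , refl rewrite sym (∸-+-assoc t x p) = begin
  square e + 2 * d * x                         ≤⟨ +-monoˡ-≤ (2 * d * x) (square-mono (m≤n+m∸n e p)) ⟩
  square (p + d) + 2 * d * x                   ≡⟨ expand p d x ⟩
  square d + 2 * d * (x + p) + square p        ≤⟨ +-monoʳ-≤ (square d + 2 * d * (x + p)) (square-mono (+-cancelˡ-≤ x p D z≤)) ⟩
  square d + 2 * d * (x + p) + square D        ∎
  where
  open ≤-Reasoning
  e = t ∸ x
  d = e ∸ p
  expand : ∀ p d x → (p + d) * (p + d) + 2 * d * x ≡ d * d + 2 * d * (x + p) + p * p
  expand = solve-∀

-- The two instances of `square-shortfall` are averaged with weights a and a′. The hypothesis on the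
-- mean makes their linear terms equal, and they cancel.
square-average : ∀ t {a a′ b x y z D} → a + a′ ≡ b → a * x + a′ * y ≡ b * z →
  x ≤ z + D → z ≤ x + D → y ≤ z + D → z ≤ y + D →
  a * square (t ∸ x) + a′ * square (t ∸ y) ≤ b * (square (t ∸ z) + square D)
square-average t {a} {a′} {b} {x} {y} {z} {D} refl mean x≤ z≤x y≤ z≤y =
  +-cancelʳ-≤ (2 * d * (b * z)) _ _ (begin
    a * square (t ∸ x) + a′ * square (t ∸ y) + 2 * d * (b * z)
      ≡⟨ cong (λ w → a * square (t ∸ x) + a′ * square (t ∸ y) + 2 * d * w) mean ⟨
    a * square (t ∸ x) + a′ * square (t ∸ y) + 2 * d * (a * x + a′ * y)
      ≡⟨ gather a a′ (square (t ∸ x)) (square (t ∸ y)) d x y ⟩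
    a * (square (t ∸ x) + 2 * d * x) + a′ * (square (t ∸ y) + 2 * d * y)
      ≤⟨ +-mono-≤ (*-monoʳ-≤ a (square-shortfall t x z D x≤ z≤x))
                  (*-monoʳ-≤ a′ (square-shortfall t y z D y≤ z≤y)) ⟩
    a * (square d + 2 * d * z + square D) + a′ * (square d + 2 * d * z + square D)
      ≡⟨ spread a a′ (square d) d z (square D) ⟩
    b * (square d + square D) + 2 * d * (b * z) ∎)
  where
  open ≤-Reasoning
  d = t ∸ z
  gather : ∀ a a′ e f d x y → a * e + a′ * f + 2 * d * (a * x + a′ * y) ≡ a * (e + 2 * d * x) + a′ * (f + 2 * d * y)
  gather = solve-∀
  spread : ∀ a a′ e d z s → a * (e + 2 * d * z + s) + a′ * (e + 2 * d * z + s) ≡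
           (a + a′) * (e + s) + 2 * d * ((a + a′) * z)
  spread = solve-∀

data Lesser (m n : ℕ) : Bool → Set where
  left  : m ≤ n → Lesser m n true
  right : n < m → Lesser m n false

lesser : ∀ m n → Lesser m n (isZero (m ∸ n))
lesser m n with m ∸ n in eq
... | zero  = left (m∸n≡0⇒m≤n eq)
... | suc _ = right (≰⇒> λ m≤n → contradiction (trans (sym eq) (m≤n⇒m∸n≡0 m≤n)) λ ())

minimum≤average : ∀ {a a′ b x y z} → .{{_ : NonZero b}} → a + a′ ≡ b → a * x + a′ * y ≤ b * z → x ≤ y → x ≤ z
minimum≤average {a} {a′} {b} {x} {y} {z} refl avg x≤y = *-cancelˡ-≤ b (begin
  (a + a′) * x       ≡⟨ *-distribʳ-+ x a a′ ⟩
  a * x + a′ * x     ≤⟨ +-monoʳ-≤ (a * x) (*-monoʳ-≤ a′ x≤y) ⟩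
  a * x + a′ * y     ≤⟨ avg ⟩
  b * z              ∎)
  where open ≤-Reasoning

factor-at-in : ∀ v s c → mem (proj₂ s) v ≡ false → factor (putIn v s) c v ≡ proj₂ c
factor-at-in v (P , Q) c v∉Q rewrite v∉Q | mem-here v P = refl

factor-at-out : ∀ v s c → factor (putOut v s) c v ≡ 0
factor-at-out v (P , Q) c rewrite mem-here v Q = refl

factor-at : ∀ v s c → mem (proj₁ s) v ≡ false → mem (proj₂ s) v ≡ false → factor s c v ≡ proj₁ c
factor-at v (P , Q) c v∉P v∉Q rewrite v∉Q | v∉P = refl

factor-off-in : ∀ v s c u → u ≢ v → factor (putIn v s) c u ≡ factor s c u
factor-off-in v (P , Q) c u u≢v rewrite mem-there P u≢v = refl

factor-off-out : ∀ v s c u → u ≢ v → factor (putOut v s) c u ≡ factor s c u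
factor-off-out v (P , Q) c u u≢v rewrite mem-there Q u≢v = refl

factor≤b : ∀ s {a b} → a ≤ b → ∀ v → factor s (a , b) v ≤ b
factor≤b (P , Q) a≤b v with mem Q v
... | true  = z≤n
... | false with mem P v
...   | true  = ≤-refl
...   | false = a≤b

module _ (r K : ℕ) {E : List (List Name)} (uniq : All Unique E)
         (degree≤ : ∀ v → count (λ e → mem e v) E ≤ K) where

  -- Putting v outside for the weights of the inside is putting it inside
  -- for those of the outside, so the same lemma serves both.
  deficit-average : ∀ {a a′ b} t v s → a + a′ ≡ b → mem (proj₁ s) v ≡ false → mem (proj₂ s) v ≡ false →
    a * square (t ∸ total r (putIn v s) (a , b) E) + a′ * square (t ∸ total r (putOut v s) (a , b) E) ≤
    b * (square (t ∸ total r s (a , b) E) + square (K * b ^ r))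
  deficit-average {a} {a′} {b} t v s a+a′≡b v∉P v∉Q = square-average t {a} {a′} a+a′≡b
    (weights-average r a+a′≡b (factor-off-in v s c) (factor-off-out v s c)
      (factor-at v s c v∉P v∉Q) (factor-at-in v s c v∉Q) (factor-at-out v s c) uniq)
    (change (putIn v s) s (factor-off-in v s c))
    (change s (putIn v s) (λ u u≢v → sym (factor-off-in v s c u u≢v)))
    (change (putOut v s) s (factor-off-out v s c))
    (change s (putOut v s) (λ u u≢v → sym (factor-off-out v s c u u≢v)))
    where
    c = a , b
    a≤b : a ≤ b
    a≤b = ≤-trans (m≤m+n a a′) (≤-reflexive a+a′≡b)
    change : ∀ s s′ → (∀ u → u ≢ v → factor s c u ≡ factor s′ c u) → total r s c E ≤ total r s′ c E + K * b ^ r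
    change s s′ off = ≤-trans (weights-change r off (factor≤b s a≤b) E)
      (+-monoʳ-≤ (total r s′ c E) (*-monoˡ-≤ (b ^ r) (degree≤ v)))

  module _ {a a′ b : ℕ} .{{_ : NonZero b}} (a+a′≡b : a + a′ ≡ b) where
    private
      c = (a , a′) , b
      D² = square (K * b ^ r)

    potential-average : ∀ v s → mem (proj₁ s) v ≡ false → mem (proj₂ s) v ≡ false →
      a * potential r c E (putIn v s) + a′ * potential r c E (putOut v s) ≤ b * (potential r c E s + 2 * D²)
    potential-average v s v∉P v∉Q = ≤-trans (≤-reflexive (gather a a′ _ _ _ _)) (≤-trans
      (+-mono-≤ (deficit-average _ v s a+a′≡b v∉P v∉Q)
                (deficit-average _ v (swap s) (trans (+-comm a′ a) a+a′≡b) v∉Q v∉P))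
      (≤-reflexive (spread b (square (deficit r s (a , b) E)) (square (deficit r (swap s) (a′ , b) E)) D²)))
      where
      gather : ∀ a a′ x y z w → a * (x + y) + a′ * (z + w) ≡ (a * x + a′ * z) + (a′ * w + a * y)
      gather = solve-∀
      spread : ∀ b x y d → b * (x + d) + b * (y + d) ≡ b * (x + y + 2 * d)
      spread = solve-∀

    potential-assign : ∀ v s → potential r c E (assign r c E v s) ≤ potential r c E s + 2 * D²
    potential-assign v s with mem (proj₁ s) v in v∉P
    ... | true  = m≤m+n _ _
    ... | false with mem (proj₂ s) v in v∉Q
    ...   | true  = m≤m+n _ _
    ...   | false with isZero (potential r c E (putIn v s) ∸ potential r c E (putOut v s))
                     | lesser (potential r c E (putIn v s)) (potential r c E (putOut v s))
    ...     | _ | left  in≤out = minimum≤average {a} {a′} {y = potential r c E (putOut v s)} a+a′≡b (potential-average v s v∉P v∉Q) in≤out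
    ...     | _ | right out<in = minimum≤average {a′} {a} {y = potential r c E (putIn v s)} (trans (+-comm a′ a) a+a′≡b)
                (≤-trans (≤-reflexive (+-comm (a′ * potential r c E (putOut v s)) _)) (potential-average v s v∉P v∉Q)) (<⇒≤ out<in)

    potential-assigns : ∀ s e → potential r c E (foldr (assign r c E) s e) ≤ potential r c E s + length e * (2 * D²)
    potential-assigns s []      = m≤m+n _ _
    potential-assigns s (v ∷ e) = ≤-trans (potential-assign v (foldr (assign r c E) s e)) (≤-trans
      (+-monoˡ-≤ (2 * D²) (potential-assigns s e))
      (≤-reflexive (trans (+-assoc (potential r c E s) _ _) (cong (potential r c E s +_) (+-comm (length e * (2 * D²)) _)))))

    potential-split : All (λ e → length e ≤ r) E → potential r c E (split r c E) ≤ length E * (r * (2 * D²))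
    potential-split = go E
      where
      start≡0 : potential r c E ([] , []) ≡ 0
      start≡0 rewrite n∸n≡0 (total r ([] , []) (a , b) E) | n∸n≡0 (total r ([] , []) (a′ , b) E) = refl
      go : ∀ F → All (λ e → length e ≤ r) F →
           potential r c E (foldr (λ e s → foldr (assign r c E) s e) ([] , []) F) ≤ length F * (r * (2 * D²))
      go []      []        = ≤-reflexive start≡0
      go (e ∷ F) (e≤ ∷ F≤) = ≤-trans (potential-assigns (foldr (λ e s → foldr (assign r c E) s e) ([] , []) F) e) (≤-trans
        (+-mono-≤ (go F F≤) (*-monoˡ-≤ (2 * D²) e≤)) (≤-reflexive (+-comm (length F * (r * (2 * D²))) _)))

-- The counts reached by the greedy split

data Covered (s : Split) (v : Name) : Set where
  inP : mem (proj₁ s) v ≡ true → Covered s v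
  inQ : mem (proj₂ s) v ≡ true → Covered s v

module _ (r : ℕ) (c : (ℕ × ℕ) × ℕ) (E : List (List Name)) where

  assign-covers : ∀ v s → Covered (assign r c E v s) v
  assign-covers v s with mem (proj₁ s) v in v∈P
  ... | true  = inP v∈P
  ... | false with mem (proj₂ s) v in v∈Q
  ...   | true  = inQ v∈Q
  ...   | false with isZero (potential r c E (putIn v s) ∸ potential r c E (putOut v s))
  ...     | true  = inP (mem-here v (proj₁ s))
  ...     | false = inQ (mem-here v (proj₂ s))

  assign-keeps : ∀ u v s → Covered s u → Covered (assign r c E v s) u
  assign-keeps u v s cov with mem (proj₁ s) v
  ... | true  = cov
  ... | false with mem (proj₂ s) v
  ...   | true  = cov
  ...   | false with isZero (potential r c E (putIn v s) ∸ potential r c E (putOut v s)) | cov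
  ...     | true  | inP u∈P = inP (mem-grows u v (proj₁ s) u∈P)
  ...     | true  | inQ u∈Q = inQ u∈Q
  ...     | false | inP u∈P = inP u∈P
  ...     | false | inQ u∈Q = inQ (mem-grows u v (proj₂ s) u∈Q)

  assigns-keep : ∀ u e s → Covered s u → Covered (foldr (assign r c E) s e) u
  assigns-keep u []      s cov = cov
  assigns-keep u (v ∷ e) s cov = assign-keeps u v (foldr (assign r c E) s e) (assigns-keep u e s cov)

  assigns-cover : ∀ e s → All (Covered (foldr (assign r c E) s e)) e
  assigns-cover []      s = []
  assigns-cover (v ∷ e) s = assign-covers v (foldr (assign r c E) s e)
    ∷ All.map (λ {u} → assign-keeps u v (foldr (assign r c E) s e)) (assigns-cover e s)

  split-covers : All (All (Covered (split r c E))) E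
  split-covers = go E
    where
    grow : List (List Name) → Split
    grow = foldr (λ e s → foldr (assign r c E) s e) ([] , [])
    go : ∀ F → All (All (Covered (grow F))) F
    go []      = []
    go (e ∷ F) = assigns-cover e (grow F) ∷ All.map (All.map (λ {u} → assigns-keep u e (grow F))) (go F)

-- Once every vertex of e is placed, each factor is b or 0, and the conditional probability has
-- become an indicator. Coverage excludes a factor a at a vertex that `allIn` counts as not inside.
weight≤allIn : ∀ i P Q {a b} → a ≤ b → ∀ e → length e ≤ i → All (Covered (P , Q)) e →
               weight i b (factor (P , Q) (a , b)) e ≤ 𝟙 (allIn P e) * b ^ i
weight≤allIn zero    P Q a≤b [] _ _ = ≤-refl
weight≤allIn (suc i) P Q a≤b [] _ _ =
  ≤-trans (weight≤ (suc i) ≤-refl (factor≤b (P , Q) a≤b) []) (≤-reflexive (sym (+-identityʳ _)))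
weight≤allIn (suc i) P Q {a} {b} a≤b (v ∷ e) (s≤s e≤) (cov ∷ covs) with mem P v in v∈P
weight≤allIn (suc i) P Q {a} {b} a≤b (v ∷ e) (s≤s e≤) (cov ∷ covs) | true =
  ≤-trans (*-mono-≤ below (weight≤allIn i P Q a≤b e e≤ covs))
          (≤-reflexive (shuffle b (𝟙 (allIn P e)) (b ^ i)))
  where
  below : (if mem Q v then 0 else b) ≤ b
  below with mem Q v
  ... | true  = z≤n
  ... | false = ≤-refl
  shuffle : ∀ x y z → x * (y * z) ≡ y * (x * z)
  shuffle = solve-∀
weight≤allIn (suc i) P Q a≤b (v ∷ e) (s≤s e≤) (inP v∈P′ ∷ covs) | false = clash v∈P′ v∈P
weight≤allIn (suc i) P Q a≤b (v ∷ e) (s≤s e≤) (inQ v∈Q ∷ covs) | false rewrite v∈Q = z≤n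

weight≤noneIn : ∀ i P Q {a b} → a ≤ b → ∀ e → length e ≤ i →
                weight i b (factor (Q , P) (a , b)) e ≤ 𝟙 (noneIn P e) * b ^ i
weight≤noneIn zero    P Q a≤b [] _ = ≤-refl
weight≤noneIn (suc i) P Q a≤b [] _ =
  ≤-trans (weight≤ (suc i) ≤-refl (factor≤b (Q , P) a≤b) []) (≤-reflexive (sym (+-identityʳ _)))
weight≤noneIn (suc i) P Q {a} {b} a≤b (v ∷ e) (s≤s e≤) with mem P v
... | true  = z≤n
... | false =
  ≤-trans (*-mono-≤ below (weight≤noneIn i P Q a≤b e e≤))
          (≤-reflexive (shuffle b (𝟙 (noneIn P e)) (b ^ i)))
  where
  shuffle : ∀ x y z → x * (y * z) ≡ y * (x * z)
  shuffle = solve-∀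
  below : (if mem Q v then b else a) ≤ b
  below with mem Q v
  ... | true  = ≤-refl
  ... | false = a≤b

weights≤count : ∀ r b φ p {E} → All (λ e → weight r b φ e ≤ 𝟙 (p e) * b ^ r) E →
                weights r b φ E ≤ count p E * b ^ r
weights≤count r b φ p [] = z≤n
weights≤count r b φ p {e ∷ E} (w≤ ∷ ws≤) =
  ≤-trans (+-mono-≤ w≤ (weights≤count r b φ p ws≤)) (≤-reflexive (sym (*-distribʳ-+ (b ^ r) (𝟙 (p e)) (count p E))))

-- A hyperedge with fewer than i vertices is padded with factors b ≥ a, so small hyperedges only
-- gain.
≤weight : ∀ i {a b φ} → a ≤ b → (∀ v → a ≤ φ v) → ∀ e → a ^ i ≤ weight i b φ e
≤weight zero    a≤b a≤φ e       = ≤-refl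
≤weight (suc i) a≤b a≤φ []      = *-mono-≤ a≤b (≤weight i a≤b a≤φ [])
≤weight (suc i) a≤b a≤φ (v ∷ e) = *-mono-≤ (a≤φ v) (≤weight i a≤b a≤φ e)

≤weights : ∀ r {a b φ} → a ≤ b → (∀ v → a ≤ φ v) → ∀ E → length E * a ^ r ≤ weights r b φ E
≤weights r a≤b a≤φ []      = z≤n
≤weights r a≤b a≤φ (e ∷ E) = +-mono-≤ (≤weight r a≤b a≤φ e) (≤weights r a≤b a≤φ E)

module _ (r K s : ℕ) {E : List (List Name)} (uniq : All Unique E) (small : All (λ e → length e ≤ r) E)
         (degree≤ : ∀ v → count (λ e → mem e v) E ≤ K)
         (s-large : length E * (r * (2 * square K)) ≤ square s)
         {a a′ b : ℕ} .{{_ : NonZero b}} (a+a′≡b : a + a′ ≡ b) where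
  private
    c = (a , a′) , b
    P = proj₁ (split r c E)
    Q = proj₂ (split r c E)

    potential≤ : potential r c E (P , Q) ≤ square (s * b ^ r)
    potential≤ = begin
      potential r c E (P , Q)                           ≤⟨ potential-split r K uniq degree≤ a+a′≡b small ⟩
      length E * (r * (2 * square (K * b ^ r)))         ≡⟨ shuffle (length E) r K (b ^ r) ⟩
      length E * (r * (2 * square K)) * square (b ^ r)  ≤⟨ *-monoˡ-≤ (square (b ^ r)) s-large ⟩
      square s * square (b ^ r)                         ≡⟨ [m*n]*[o*p]≡[m*o]*[n*p] s s (b ^ r) (b ^ r) ⟩
      square (s * b ^ r)                                ∎
      where
      open ≤-Reasoning
      shuffle : ∀ m r k x → m * (r * (2 * (k * x * (k * x)))) ≡ m * (r * (2 * (k * k))) * (x * x)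
      shuffle = solve-∀

    -- Scaled by b^r: m x^r is at most the initial expectation, which is at most the final one plus
    -- the deficit. The deficit is at most s b^r because its square is part of the potential.
    conclude : ∀ s′ x p → x ≤ b → square (deficit r s′ (x , b) E) ≤ square (s * b ^ r) →
      total r s′ (x , b) E ≤ count p E * b ^ r → length E * x ^ r ≤ (count p E + s) * b ^ r
    conclude s′ x p x≤b d²≤ total≤ = begin
      length E * x ^ r                                         ≤⟨ ≤weights r x≤b (λ _ → ≤-refl) E ⟩
      total r ([] , []) (x , b) E                              ≤⟨ m≤n+m∸n _ (total r s′ (x , b) E) ⟩
      total r s′ (x , b) E + deficit r s′ (x , b) E            ≤⟨ +-mono-≤ total≤ (square-cancel _ (s * b ^ r) d²≤) ⟩
      count p E * b ^ r + s * b ^ r                            ≡⟨ *-distribʳ-+ (b ^ r) (count p E) s ⟨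
      (count p E + s) * b ^ r                                  ∎
      where open ≤-Reasoning

    a≤b : a ≤ b
    a≤b = ≤-trans (m≤m+n a a′) (≤-reflexive a+a′≡b)

    a′≤b : a′ ≤ b
    a′≤b = ≤-trans (m≤n+m a′ a) (≤-reflexive a+a′≡b)

  many-inside : length E * a ^ r ≤ (count (allIn P) E + s) * b ^ r
  many-inside = conclude (P , Q) a (allIn P) a≤b (≤-trans (m≤m+n _ _) potential≤)
    (weights≤count r b _ (allIn P) (All.zipWith (λ (e≤ , cov) → weight≤allIn r P Q a≤b _ e≤ cov) (small , split-covers r c E)))

  many-outside : length E * a′ ^ r ≤ (count (noneIn P) E + s) * b ^ r
  many-outside = conclude (Q , P) a′ (noneIn P) a′≤b (≤-trans (m≤n+m _ (square (deficit r (P , Q) (a , b) E))) potential≤)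
    (weights≤count r b _ (noneIn P) (All.map (λ {e} → weight≤noneIn r P Q a′≤b e) small))

-- The bias

module _ (r b : ℕ) where
  private
    climb : ℕ → ℕ
    climb n = foldr (λ _ a → if isZero (b ^ r ∸ (a ^ r + a ^ r)) then a else suc a) 0 (replicate n tt)

    -- Either the search has stopped at a sufficient value, or it has moved in every round and
    -- stands at n. After b rounds it would stand at b, which is sufficient as well.
    climb-reaches : ∀ n → b ^ r ≤ climb n ^ r + climb n ^ r ⊎ climb n ≡ n
    climb-reaches zero = inj₂ refl
    climb-reaches (suc n) with isZero (b ^ r ∸ (climb n ^ r + climb n ^ r)) | lesser (b ^ r) (climb n ^ r + climb n ^ r)
    ... | _ | left  b≤ = inj₁ b≤
    ... | _ | right <b with climb-reaches n
    ...   | inj₁ b≤  = contradiction b≤ (<⇒≱ <b)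
    ...   | inj₂ eq  = inj₂ (cong suc eq)

    climb-least : ∀ n {a} → climb n ≡ suc a → a ^ r + a ^ r < b ^ r
    climb-least (suc n) eq with isZero (b ^ r ∸ (climb n ^ r + climb n ^ r)) | lesser (b ^ r) (climb n ^ r + climb n ^ r)
    ... | _ | left  _  = climb-least n eq
    ... | _ | right <b with eq
    ...   | refl = <b

    climb≤ : ∀ n → climb n ≤ n
    climb≤ zero = z≤n
    climb≤ (suc n) with isZero (b ^ r ∸ (climb n ^ r + climb n ^ r))
    ... | true  = m≤n⇒m≤1+n (climb≤ n)
    ... | false = s≤s (climb≤ n)

  threshold-reaches : b ^ r ≤ threshold r b ^ r + threshold r b ^ r
  threshold-reaches with climb-reaches b
  ... | inj₁ b≤ = b≤
  ... | inj₂ eq = ≤-trans (m≤m+n (b ^ r) (b ^ r)) (≤-reflexive (cong (λ x → x ^ r + x ^ r) (sym eq)))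

  threshold-least : ∀ {a} → threshold r b ≡ suc a → a ^ r + a ^ r < b ^ r
  threshold-least = climb-least b

  threshold≤ : threshold r b ≤ b
  threshold≤ = climb≤ b

2^<5^ : ∀ r → 2 ^ suc r + 2 ^ suc r < 5 ^ suc r
2^<5^ zero    = ≤-refl
2^<5^ (suc r) = begin-strict
  2 ^ suc (suc r) + 2 ^ suc (suc r)   ≡⟨ double (2 ^ suc r) ⟩
  2 * (2 ^ suc r + 2 ^ suc r)         <⟨ *-monoʳ-< 2 (2^<5^ r) ⟩
  2 * 5 ^ suc r                       ≤⟨ *-monoˡ-≤ (5 ^ suc r) (m≤m+n 2 3) ⟩
  5 ^ suc (suc r)                     ∎
  where
  open ≤-Reasoning
  double : ∀ x → 2 * x + 2 * x ≡ 2 * (x + x)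
  double = solve-∀

3≤threshold : ∀ r {b} → 5 ≤ b → 3 ≤ threshold (suc r) b
3≤threshold r {b} 5≤b with threshold (suc r) b | threshold-reaches (suc r) b
... | a | b≤ with 3 ≤? a
...   | yes 3≤a = 3≤a
...   | no  3≰a = contradiction b≤ (<⇒≱ (begin-strict
  a ^ suc r + a ^ suc r     ≤⟨ +-mono-≤ a≤2 a≤2 ⟩
  2 ^ suc r + 2 ^ suc r     <⟨ 2^<5^ r ⟩
  5 ^ suc r                 ≤⟨ ^-monoˡ-≤ (suc r) 5≤b ⟩
  b ^ suc r                 ∎))
  where
  open ≤-Reasoning
  a≤2 = ^-monoˡ-≤ (suc r) (≤-pred (≰⇒> 3≰a))

^-superadditive : ∀ r a b → a ^ suc r + b ^ suc r ≤ (a + b) ^ suc r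
^-superadditive r a b = ≤-trans
  (+-mono-≤ (*-monoʳ-≤ a (^-monoˡ-≤ r (m≤m+n a b))) (*-monoʳ-≤ b (^-monoˡ-≤ r (m≤n+m b a))))
  (≤-reflexive (sym (*-distribʳ-+ ((a + b) ^ r) a b)))

-- The separator

-- The empty hyperedge is both wholly inside and wholly outside. Giving the inside precedence, as
-- `place` does, makes the two classes disjoint, at the price of one hyperedge in the outside count.
outsideOnly : List Name → List Name → Bool
outsideOnly P e = if allIn P e then false else noneIn P e

kept : (List Name → Bool) → List (List Name) → List Bool → ℕ
kept p (e ∷ E) (false ∷ R) = 𝟙 (p e) + kept p E R
kept p (e ∷ E) (true  ∷ R) = kept p E R
kept p _       _           = 0

module _ (p q : List Name → Bool) (m : ℕ) where

  -- Invariant of the pass over the hyperedges. By `in-full` and `out-full`, each side has either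
  -- kept all its hyperedges or exhausted its budget and so kept about m/2 of them; both
  -- alternatives lead to the wanted lower bound.
  record Collected (E : List (List Name)) (β : Budget) : Set where
    private
      i = proj₁ β
      o = proj₁ (proj₂ β)
      R = proj₂ (proj₂ β)
    field
      in-budget  : i + 2 * kept p E R ≡ m
      out-budget : o + 2 * kept q E R ≡ m
      in-full    : kept p E R ≡ count p E ⊎ i ≤ 1
      out-full   : kept q E R ≡ count q E ⊎ o ≤ 1
      partition  : count id R + (kept p E R + kept q E R) ≡ length E
      one-sided  : Pointwise (λ e removed → removed ≡ false → p e ≡ true ⊎ q e ≡ true) E R

  open Collected public

  private
    keep-two : ∀ i {k} → 1 < i → i + 2 * k ≡ m → i ∸ 2 + 2 * suc k ≡ m
    keep-two (suc (suc i)) {k} (s≤s (s≤s _)) eq = trans (shuffle i k) eq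
      where
      shuffle : ∀ i k → i + 2 * suc k ≡ suc (suc i) + 2 * k
      shuffle = solve-∀

    still-full : ∀ i {k n : ℕ} → 1 < i → k ≡ n ⊎ i ≤ 1 → suc k ≡ suc n ⊎ i ∸ 2 ≤ 1
    still-full i 1<i (inj₁ eq)  = inj₁ (cong suc eq)
    still-full i 1<i (inj₂ i≤1) = contradiction i≤1 (<⇒≱ 1<i)

    skip-full : ∀ {i k n} b → (b ≡ true → i ≤ 1) → k ≡ n ⊎ i ≤ 1 → k ≡ 𝟙 b + n ⊎ i ≤ 1
    skip-full false h full = full
    skip-full true  h full = inj₂ (h refl)

  module _ {e : List Name} {E : List (List Name)} {i o : ℕ} {R : List Bool} (C : Collected E (i , o , R)) where

    collected-discard : (p e ≡ true → i ≤ 1) → (q e ≡ true → o ≤ 1) → Collected (e ∷ E) (i , o , true ∷ R)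
    collected-discard i≤1 o≤1 = record
      { in-budget = in-budget C ; out-budget = out-budget C
      ; in-full = skip-full (p e) i≤1 (in-full C) ; out-full = skip-full (q e) o≤1 (out-full C)
      ; partition = cong suc (partition C) ; one-sided = (λ ()) ∷ one-sided C }

    collected-in : p e ≡ true → q e ≡ false → 1 < i → Collected (e ∷ E) (i ∸ 2 , o , false ∷ R)
    collected-in pe qe 1<i .in-budget rewrite pe = keep-two i 1<i (in-budget C)
    collected-in pe qe 1<i .out-budget rewrite qe = out-budget C
    collected-in pe qe 1<i .in-full rewrite pe = still-full i 1<i (in-full C)
    collected-in pe qe 1<i .out-full rewrite qe = out-full C
    collected-in pe qe 1<i .partition rewrite pe | qe = trans (+-suc (count id R) _) (cong suc (partition C))
    collected-in pe qe 1<i .one-sided = (λ _ → inj₁ pe) ∷ one-sided C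

    collected-out : p e ≡ false → q e ≡ true → 1 < o → Collected (e ∷ E) (i , o ∸ 2 , false ∷ R)
    collected-out pe qe 1<o .in-budget rewrite pe = in-budget C
    collected-out pe qe 1<o .out-budget rewrite qe = keep-two o 1<o (out-budget C)
    collected-out pe qe 1<o .in-full rewrite pe = in-full C
    collected-out pe qe 1<o .out-full rewrite qe = still-full o 1<o (out-full C)
    collected-out pe qe 1<o .partition rewrite pe | qe =
      trans (cong (count id R +_) (+-suc _ _)) (trans (+-suc (count id R) _) (cong suc (partition C)))
    collected-out pe qe 1<o .one-sided = (λ _ → inj₂ qe) ∷ one-sided C

collected : ∀ P m E → Collected (allIn P) (outsideOnly P) m E (collect P m E)
collected P m [] = record
  { in-budget = +-identityʳ m ; out-budget = +-identityʳ m ; in-full = inj₁ refl ; out-full = inj₁ refl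
  ; partition = refl ; one-sided = [] }
collected P m (e ∷ E) = place-collected (collect P m E) (collected P m E) (allIn P e) (noneIn P e) refl refl
  where
  allIn⇒¬outsideOnly : allIn P e ≡ true → outsideOnly P e ≡ false
  allIn⇒¬outsideOnly all rewrite all = refl

  ¬allIn⇒outsideOnly : allIn P e ≡ false → outsideOnly P e ≡ noneIn P e
  ¬allIn⇒outsideOnly all rewrite all = refl

  place-collected : ∀ β → Collected (allIn P) (outsideOnly P) m E β → ∀ b b′ → allIn P e ≡ b → noneIn P e ≡ b′ →
    Collected (allIn P) (outsideOnly P) m (e ∷ E) (if b then keepIn β else (if b′ then keepOut β else discard β))
  place-collected (i , o , R) C true b′ all none with isZero (i ∸ 1) | lesser i 1
  ... | _ | left  i≤1 = collected-discard _ _ m C (λ _ → i≤1) (λ out → clash out (allIn⇒¬outsideOnly all))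
  ... | _ | right 1<i = collected-in _ _ m C all (allIn⇒¬outsideOnly all) 1<i
  place-collected (i , o , R) C false true all none with isZero (o ∸ 1) | lesser o 1
  ... | _ | left  o≤1 = collected-discard _ _ m C (λ all′ → clash all′ all) (λ _ → o≤1)
  ... | _ | right 1<o = collected-out _ _ m C all (trans (¬allIn⇒outsideOnly all) none) 1<o
  place-collected (i , o , R) C false false all none = collected-discard _ _ m C
    (λ all′ → clash all′ all) (λ out → clash out (trans (¬allIn⇒outsideOnly all) none))

noneIn≤ : ∀ P E → count (noneIn P) E ≤ count (outsideOnly P) E + count null E
noneIn≤ P []      = z≤n
noneIn≤ P (e ∷ E) = ≤-trans (+-mono-≤ (noneIn≤₁ e) (noneIn≤ P E))
  (≤-reflexive (interchange (𝟙 (outsideOnly P e)) (𝟙 (null e)) (count (outsideOnly P) E) (count null E)))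
  where
  noneIn≤₁ : ∀ e → 𝟙 (noneIn P e) ≤ 𝟙 (outsideOnly P e) + 𝟙 (null e)
  noneIn≤₁ []      = ≤-refl
  noneIn≤₁ (v ∷ e) with mem P v
  ... | true  = z≤n
  ... | false = ≤-reflexive (sym (+-identityʳ _))

-- The size of the separator

-- The inequalities on which the bound (1/2 − ε) m + o(m) rests, with
-- (a, a′, b) = (threshold, b − threshold, b) and a / b ≈ 2^(-1/r).
module _ (r′ K s : ℕ) (E : List (List Name)) (uniq : All Unique E) (small : All (λ e → length e ≤ suc r′) E)
         (degree≤ : ∀ v → count (λ e → mem e v) E ≤ K) (empty≤ : count null E ≤ 1)
         (s-large : length E * (suc r′ * (2 * square K)) ≤ square s) where
  private
    r  = suc r′
    m  = length E
    b  = m + 5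
    a  = threshold r b
    a′ = b ∸ a
    P  = proj₁ (split r (coins r b) E)
    β  = collect P m E
    C  = collected P m E
    R  = separator r E
    kI = kept (allIn P) E R
    kO = kept (outsideOnly P) E R

    a+a′≡b : a + a′ ≡ b
    a+a′≡b = m+[n∸m]≡n (threshold≤ r b)

    instance
      b≢0 : NonZero b
      b≢0 = >-nonZero (≤-trans (s≤s z≤n) (m≤n+m 5 m))

    b^r≢0 : NonZero (b ^ r)
    b^r≢0 = m^n≢0 b r

    -- This is ε_r ≤ 1/2 for the rounded bias: 2 a^r ≥ b^r, while a^r + a′^r ≤ (a + a′)^r = b^r.
    2a′^r≤b^r : a′ ^ r + a′ ^ r ≤ b ^ r
    2a′^r≤b^r = +-cancelˡ-≤ (b ^ r) _ _ (begin
      b ^ r + (a′ ^ r + a′ ^ r)               ≤⟨ +-monoˡ-≤ _ (threshold-reaches r b) ⟩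
      (a ^ r + a ^ r) + (a′ ^ r + a′ ^ r)     ≡⟨ interchange (a ^ r) (a ^ r) (a′ ^ r) (a′ ^ r) ⟩
      (a ^ r + a′ ^ r) + (a ^ r + a′ ^ r)     ≤⟨ +-mono-≤ sup sup ⟩
      b ^ r + b ^ r                           ∎)
      where
      open ≤-Reasoning
      sup : a ^ r + a′ ^ r ≤ b ^ r
      sup = ≤-trans (^-superadditive r′ a a′) (≤-reflexive (cong (_^ r) a+a′≡b))

  removed+kept : count id R + (kI + kO) ≡ m
  removed+kept = partition C

  -- With an exhausted budget 2 kI ≥ m - 1. Otherwise kI is the whole inside count, at least m
  -- (a/b)^r - s, and (a/b)^r ≥ 1/2 by the choice of the threshold.
  half-inside : m ≤ 2 * kI + 1 + 2 * s
  half-inside with in-full C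
  ... | inj₂ i≤1 = begin
    m                        ≡⟨ in-budget C ⟨
    proj₁ β + 2 * kI         ≤⟨ +-monoˡ-≤ (2 * kI) i≤1 ⟩
    1 + 2 * kI               ≡⟨ +-comm 1 (2 * kI) ⟩
    2 * kI + 1               ≤⟨ m≤m+n _ (2 * s) ⟩
    2 * kI + 1 + 2 * s       ∎
    where open ≤-Reasoning
  ... | inj₁ full = *-cancelʳ-≤ m _ (b ^ r) ⦃ b^r≢0 ⦄ (begin
    m * b ^ r                                   ≤⟨ *-monoʳ-≤ m (threshold-reaches r b) ⟩
    m * (a ^ r + a ^ r)                         ≡⟨ *-distribˡ-+ m (a ^ r) (a ^ r) ⟩
    m * a ^ r + m * a ^ r                       ≤⟨ +-mono-≤ inside inside ⟩
    (kI + s) * b ^ r + (kI + s) * b ^ r         ≤⟨ m≤m+n _ (b ^ r) ⟩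
    (kI + s) * b ^ r + (kI + s) * b ^ r + b ^ r ≡⟨ gather kI s (b ^ r) ⟩
    (2 * kI + 1 + 2 * s) * b ^ r                ∎)
    where
    open ≤-Reasoning
    inside : m * a ^ r ≤ (kI + s) * b ^ r
    inside = subst (λ x → m * a ^ r ≤ (x + s) * b ^ r) (sym full)
      (many-inside r K s uniq small degree≤ s-large a+a′≡b)
    gather : ∀ k s x → (k + s) * x + (k + s) * x + x ≡ (2 * k + 1 + 2 * s) * x
    gather = solve-∀

  -- If nothing was lost, this is the outside count less the possible empty hyperedge. If the budget
  -- ran out, kO is about m/2, which is enough by `2a′^r≤b^r`.
  outside-share : m * a′ ^ r ≤ (kO + s + 1) * b ^ r
  outside-share with out-full C
  ... | inj₁ full = begin
    m * a′ ^ r                            ≤⟨ many-outside r K s uniq small degree≤ s-large a+a′≡b ⟩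
    (count (noneIn P) E + s) * b ^ r      ≤⟨ *-monoˡ-≤ (b ^ r) (+-monoˡ-≤ s (≤-trans (noneIn≤ P E) (+-mono-≤ (≤-reflexive (sym full)) empty≤))) ⟩
    (kO + 1 + s) * b ^ r                  ≡⟨ cong (_* b ^ r) (swap-last kO 1 s) ⟩
    (kO + s + 1) * b ^ r                  ∎
    where
    open ≤-Reasoning
    swap-last : ∀ x y z → x + y + z ≡ x + z + y
    swap-last = solve-∀
  ... | inj₂ o≤1 = *-cancelˡ-≤ 2 (begin
    2 * (m * a′ ^ r)                      ≡⟨ double m (a′ ^ r) ⟩
    m * (a′ ^ r + a′ ^ r)                 ≤⟨ *-mono-≤ m≤ 2a′^r≤b^r ⟩
    (1 + 2 * kO) * b ^ r                  ≤⟨ *-monoˡ-≤ (b ^ r) (m≤m+n (1 + 2 * kO) (1 + 2 * s)) ⟩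
    (1 + 2 * kO + (1 + 2 * s)) * b ^ r    ≡⟨ gather kO s (b ^ r) ⟩
    2 * ((kO + s + 1) * b ^ r)            ∎)
    where
    open ≤-Reasoning
    m≤ : m ≤ 1 + 2 * kO
    m≤ = ≤-trans (≤-reflexive (sym (out-budget C))) (+-monoˡ-≤ (2 * kO) o≤1)
    double : ∀ m x → 2 * (m * x) ≡ m * (x + x)
    double = solve-∀
    gather : ∀ k s x → (1 + 2 * k + (1 + 2 * s)) * x ≡ 2 * ((k + s + 1) * x)
    gather = solve-∀

  outside-room : a′ + 3 ≤ b
  outside-room = ≤-trans (≤-reflexive (+-comm a′ 3)) (≤-trans (+-monoˡ-≤ a′ (3≤threshold r′ (m≤n+m 5 m))) (≤-reflexive a+a′≡b))

  -- The bound of the cut calculus for ε is (1 + 1/b) ((a′ + 3)/b)^r.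
  ε-share : m * ((b + 1) * (a′ + 3) ^ r) ≤ (kO + s + 3 * r + 2) * (b * b ^ r)
  ε-share = begin
    m * ((b + 1) * (a′ + 3) ^ r)                                 ≡⟨ expand m b ((a′ + 3) ^ r) ⟩
    m * (b * (a′ + 3) ^ r) + m * (a′ + 3) ^ r                    ≤⟨ +-mono-≤ (*-monoʳ-≤ m (^-shift r a′ 3 outside-room))
                                                                      (*-mono-≤ (m≤m+n m 5) (^-monoˡ-≤ r outside-room)) ⟩
    m * (b * a′ ^ r + 3 * r * b ^ r) + b * b ^ r                 ≡⟨ regroup m b (a′ ^ r) (3 * r) (b ^ r) ⟩
    b * (m * a′ ^ r) + m * (3 * r * b ^ r) + b * b ^ r           ≤⟨ +-monoˡ-≤ (b * b ^ r) (+-mono-≤ (*-monoʳ-≤ b outside-share)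
                                                                      (*-monoˡ-≤ (3 * r * b ^ r) (m≤m+n m 5))) ⟩
    b * ((kO + s + 1) * b ^ r) + b * (3 * r * b ^ r) + b * b ^ r ≡⟨ gather b kO s (3 * r) (b ^ r) ⟩
    (kO + s + 3 * r + 2) * (b * b ^ r)                           ∎
    where
    open ≤-Reasoning
    expand : ∀ m b x → m * ((b + 1) * x) ≡ m * (b * x) + m * x
    expand = solve-∀
    regroup : ∀ m b x t y → m * (b * x + t * y) + b * y ≡ b * (m * x) + m * (t * y) + b * y
    regroup = solve-∀
    gather : ∀ b k s t y → b * ((k + s + 1) * y) + b * (t * y) + b * y ≡ (k + s + t + 2) * (b * y)
    gather = solve-∀

-- Subsets as lists of names

mem-complete : ∀ {v e} → v List.∈ e → mem e v ≡ true
mem-complete {v} {u ∷ e} (here refl) = mem-here v e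
mem-complete {v} {u ∷ e} (there v∈e) = mem-grows v u e (mem-complete v∈e)

mem-sound : ∀ {v} e → mem e v ≡ true → v List.∈ e
mem-sound {v} (u ∷ e) eq with same v u in v≟u
... | true  = here (same-sound v u v≟u)
... | false = there (mem-sound e eq)

allIn-sound : ∀ P {v} e → allIn P e ≡ true → v List.∈ e → mem P v ≡ true
allIn-sound P (u ∷ e) eq v∈ with mem P u in u∈P
allIn-sound P (u ∷ e) eq (here refl) | true = u∈P
allIn-sound P (u ∷ e) eq (there v∈)  | true = allIn-sound P e eq v∈

noneIn-sound : ∀ P {v} e → noneIn P e ≡ true → v List.∈ e → mem P v ≡ false
noneIn-sound P (u ∷ e) eq v∈ with mem P u in u∉P
noneIn-sound P (u ∷ e) eq (here refl) | false = u∉P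
noneIn-sound P (u ∷ e) eq (there v∈)  | false = noneIn-sound P e eq v∈

outsideOnly-sound : ∀ P {v} e → outsideOnly P e ≡ true → v List.∈ e → mem P v ≡ false
outsideOnly-sound P e eq with allIn P e
... | false = noneIn-sound P e eq

vertex : ∀ {n} → Fin n → Name
vertex v = name (toℕ v)

vertex-injective : ∀ {n} {u v : Fin n} → vertex u ≡ vertex v → u ≡ v
vertex-injective eq = toℕ-injective (cong index eq)

members : ∀ {n} → Subset n → List (Fin n)
members S = filter (_∈? S) (allFin _)

names : ∀ {n} → Subset n → List Name
names S = List.map vertex (members S)

∈-names⁺ : ∀ {n} {S : Subset n} {v} → v ∈ S → vertex v List.∈ names S
∈-names⁺ {S = S} v∈S = ∈-map⁺ vertex (∈-filter⁺ (_∈? S) (∈-allFin _) v∈S)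

∈-names⁻ : ∀ {n} {S : Subset n} {u} → u List.∈ names S → ∃[ v ] u ≡ vertex v × v ∈ S
∈-names⁻ {S = S} u∈ with ∈-map⁻ vertex u∈
... | v , v∈ , refl = v , refl , proj₂ (∈-filter⁻ (_∈? S) {xs = allFin _} v∈)

vertex-∈-names⁻ : ∀ {n} {S : Subset n} {v} → vertex v List.∈ names S → v ∈ S
vertex-∈-names⁻ v∈ with ∈-names⁻ v∈
... | w , eq , w∈S = subst (_∈ _) (sym (vertex-injective eq)) w∈S

mem-names : ∀ {n} (S : Subset n) v → mem (names S) (vertex v) ≡ lookup S v
mem-names S v with lookup S v in eq
... | true  = mem-complete (∈-names⁺ (lookup⇒[]= v S eq))
... | false with mem (names S) (vertex v) in m
...   | false = refl
...   | true  = clash ([]=⇒lookup (vertex-∈-names⁻ (mem-sound {vertex v} (names S) m))) eq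

names-unique : ∀ {n} (S : Subset n) → Unique (names S)
names-unique S = Unique.map⁺ vertex-injective (Unique.filter⁺ (_∈? S) (Unique.allFin⁺ _))

members-suc : ∀ {n} s (S : Subset n) xs →
              length (filter (_∈? (s ∷ S)) (List.map suc xs)) ≡ length (filter (_∈? S) xs)
members-suc s S []       = refl
members-suc s S (x ∷ xs) with does (x ∈? S)
... | true  = cong suc (members-suc s S xs)
... | false = members-suc s S xs

length-members : ∀ {n} (S : Subset n) → length (members S) ≡ ∣ S ∣
length-members [] = refl
length-members (s ∷ S) = with-head s
  where
  others : ∀ t → length (filter (_∈? (t ∷ S)) (List.tabulate suc)) ≡ ∣ S ∣
  others t = trans (cong (length ∘ filter (_∈? (t ∷ S))) (sym (map-tabulate id suc)))
               (trans (members-suc t S (allFin _)) (length-members S))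
  with-head : ∀ t → length (members (t ∷ S)) ≡ ∣ t ∷ S ∣
  with-head true  = cong suc (others true)
  with-head false = others false

length-names : ∀ {n} (S : Subset n) → length (names S) ≡ ∣ S ∣
length-names S = trans (length-map vertex (members S)) (length-members S)

-- Counting over Fin m

∣tabulate∣-mono : ∀ {m} {f g : Fin m → Bool} → (∀ i → f i ≡ true → g i ≡ true) → ∣ tabulate f ∣ ≤ ∣ tabulate g ∣
∣tabulate∣-mono {zero}  f⇒g = z≤n
∣tabulate∣-mono {suc m} {f} {g} f⇒g with f zero | g zero | f⇒g zero
... | true  | true  | _ = s≤s (∣tabulate∣-mono (f⇒g ∘ suc))
... | true  | false | h = contradiction (h refl) λ ()
... | false | true  | _ = m≤n⇒m≤1+n (∣tabulate∣-mono (f⇒g ∘ suc))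
... | false | false | _ = ∣tabulate∣-mono (f⇒g ∘ suc)

∣tabulate∣≡0 : ∀ {m} {f : Fin m → Bool} → (∀ i → f i ≢ true) → ∣ tabulate f ∣ ≡ 0
∣tabulate∣≡0 {zero}  none = refl
∣tabulate∣≡0 {suc m} {f} none with f zero in eq
... | true  = contradiction eq (none zero)
... | false = ∣tabulate∣≡0 (none ∘ suc)

∣tabulate∣≤1 : ∀ {m} {f : Fin m → Bool} → (∀ i j → f i ≡ true → f j ≡ true → i ≡ j) → ∣ tabulate f ∣ ≤ 1
∣tabulate∣≤1 {zero}  unique = z≤n
∣tabulate∣≤1 {suc m} {f} unique with f zero in eq
... | true  = s≤s (≤-reflexive (∣tabulate∣≡0 λ i fi → contradiction (unique zero (suc i) eq fi) λ ()))
... | false = ∣tabulate∣≤1 λ i j fi fj → suc-injective (unique (suc i) (suc j) fi fj)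

count-tabulate : ∀ {A : Set} {m} (p : A → Bool) (f : Fin m → A) → count p (List.tabulate f) ≡ ∣ tabulate (p ∘ f) ∣
count-tabulate {m = zero}  p f = refl
count-tabulate {m = suc m} p f with p (f zero)
... | true  = cong suc (count-tabulate p (f ∘ suc))
... | false = count-tabulate p (f ∘ suc)

count-toList : ∀ {m} (R : Subset m) → count id (toList R) ≡ ∣ R ∣
count-toList []          = refl
count-toList (true ∷ R)  = cong suc (count-toList R)
count-toList (false ∷ R) = count-toList R

kept-tabulate : ∀ {m} p (f : Fin m → List Name) (R : Subset m) →
  kept p (List.tabulate f) (toList R) ≡ ∣ tabulate (λ e → lookup (∁ R) e ∧ p (f e)) ∣
kept-tabulate p f []          = refl
kept-tabulate p f (true ∷ R)  = kept-tabulate p (f ∘ suc) R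
kept-tabulate p f (false ∷ R) with p (f zero)
... | true  = cong suc (kept-tabulate p (f ∘ suc) R)
... | false = kept-tabulate p (f ∘ suc) R

pointwise-lookup : ∀ {A B : Set} {_~_ : A → B → Set} {m} (f : Fin m → A) (R : Vec B m) →
  Pointwise _~_ (List.tabulate f) (toList R) → ∀ i → f i ~ lookup R i
pointwise-lookup f (x ∷ R) (r ∷ rs) zero    = r
pointwise-lookup f (x ∷ R) (r ∷ rs) (suc i) = pointwise-lookup (f ∘ suc) R rs i

as-vector : ∀ {A : Set} {m} (xs : List A) → length xs ≡ m → ∃[ v ] toList {n = m} v ≡ xs
as-vector xs refl = fromList xs , toList∘fromList xs

-- Hypergraphs as lists of lists of names

module _ {n m : ℕ} (H : Hypergraph n m) where
  open Hypergraph H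

  namesOf : Fin m → List Name
  namesOf e = names (edge e)

  edgeList : List (List Name)
  edgeList = List.tabulate namesOf

  length-edgeList : length edgeList ≡ m
  length-edgeList = length-tabulate namesOf

  encode-edgeList : encode edgeList ≡ encodeHypergraph H
  encode-edgeList = cong list (trans (cong (List.map encode) (sym (map-tabulate id namesOf)))
    (trans (sym (map-∘ (allFin m))) (map-cong (λ e → cong list (sym (map-∘ (members (edge e))))) (allFin m))))

  edgeList-unique : All Unique edgeList
  edgeList-unique = All.tabulate⁺ λ e → names-unique (edge e)

  edgeList-small : ∀ {r} → EdgeSize≤ H r → All (λ e → length e ≤ r) edgeList
  edgeList-small size≤ = All.tabulate⁺ λ e → ≤-trans (≤-reflexive (length-names (edge e))) (size≤ e)

  edgeList-degree : ∀ {K} → MaxDegree≤ H K → ∀ v → count (λ e → mem e v) edgeList ≤ K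
  edgeList-degree {K} degree≤ v = ≤-trans (≤-reflexive (count-tabulate (λ e → mem e v) namesOf)) bound
    where
    bound : ∣ tabulate (λ e → mem (namesOf e) v) ∣ ≤ K
    bound with any? (λ e → mem (namesOf e) v ≟ᵇ true)
    ... | no none = ≤-trans (≤-reflexive (∣tabulate∣≡0 λ e v∈e → none (e , v∈e))) z≤n
    ... | yes (e , v∈e) with ∈-names⁻ (mem-sound {v} (namesOf e) v∈e)
    ...   | u , refl , _ = ≤-trans (≤-reflexive (cong ∣_∣ (tabulate-cong λ e → mem-names (edge e) u))) (degree≤ u)

  edgeList-empty : count null edgeList ≤ 1
  edgeList-empty = ≤-trans (≤-reflexive (count-tabulate null namesOf))
    (∣tabulate∣≤1 λ e e′ empty empty′ → distinct (trans (is-⊥ (edge e) empty) (sym (is-⊥ (edge e′) empty′))))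
    where
    is-⊥ : ∀ S → null (names S) ≡ true → S ≡ Data.Fin.Subset.⊥
    is-⊥ S empty = Empty-unique λ (v , v∈S) → absurd (∈-names⁺ v∈S) empty
      where
      absurd : ∀ {u e} {A : Set} → u List.∈ e → null e ≡ true → A
      absurd (here _) ()
      absurd (there _) ()

  module _ (P : List Name) (R : Subset m)
    (sides : ∀ e → lookup R e ≡ false → allIn P (namesOf e) ≡ true ⊎ outsideOnly P (namesOf e) ≡ true) where
    private
      F = ∁ R

      colour : Fin n → Bool
      colour v = mem P (vertex v)

      retained : ∀ {e} → lookup F e ≡ true → lookup R e ≡ false
      retained {e} eq with lookup R e | trans (sym (lookup-map e not R)) eq
      ... | false | _ = refl

      monochromatic : ∀ {e u v} → e ∈ F → u ∈ edge e → v ∈ edge e → colour u ≡ colour v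
      monochromatic {e} e∈F u∈e v∈e with sides e (retained ([]=⇒lookup e∈F))
      ... | inj₁ inside = trans (allIn-sound P (namesOf e) inside (∈-names⁺ u∈e))
                                (sym (allIn-sound P (namesOf e) inside (∈-names⁺ v∈e)))
      ... | inj₂ outside = trans (outsideOnly-sound P (namesOf e) outside (∈-names⁺ u∈e))
                                 (sym (outsideOnly-sound P (namesOf e) outside (∈-names⁺ v∈e)))

      linked-colour : ∀ {S e u v} → Linked H F S e v → u ∈ edge e → colour u ≡ colour v
      linked-colour (end e∈F _ v∈e) u∈e = monochromatic e∈F u∈e v∈e
      linked-colour {e = e} (step e′ e∈F _ (w , w∈) l) u∈e with x∈p∩q⁻ (edge e) (edge e′) w∈
      ... | w∈e , w∈e′ = trans (monochromatic e∈F u∈e w∈e) (linked-colour l w∈e′)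

      incident : ∀ {S} e → (lookup F e ∧ does (nonempty? (edge e ∩ S))) ≡ true →
                 lookup F e ≡ true × (∃[ w ] w ∈ edge e × w ∈ S)
      incident {S} e eq with lookup F e | nonempty? (edge e ∩ S) | eq
      ... | true | yes (w , w∈) | _ = refl , w , x∈p∩q⁻ (edge e) S w∈

      incident-count : ∀ {S} (p : List Name → Bool) → (∀ e {w} → lookup F e ≡ true → w ∈ edge e → w ∈ S → p (namesOf e) ≡ true) →
        ∣ incidentEdges H F S ∣ ≤ ∣ tabulate (λ e → lookup F e ∧ p (namesOf e)) ∣
      incident-count p incident⇒p = ∣tabulate∣-mono λ e inc →
        let e∈F , w , w∈e , w∈S = incident e inc
        in trans (cong (λ b → b ∧ p (namesOf e)) e∈F) (incident⇒p e e∈F w∈e w∈S)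

    -- Every retained hyperedge has a single colour, hence so has a chain of intersecting ones, and
    -- hence so has a component. A component with a vertex therefore meets retained hyperedges of
    -- its own side only, and each side has at most m/2 of them. An isolated vertex and the empty
    -- set meet none.
    balanced : 2 * ∣ tabulate (λ e → lookup F e ∧ allIn P (namesOf e)) ∣ ≤ m →
               2 * ∣ tabulate (λ e → lookup F e ∧ outsideOnly P (namesOf e)) ∣ ≤ m →
               IsBalancedSeparator H R
    balanced inside≤ outside≤ S (inj₂ (v , refl , isolated)) =
      ≤-trans (≤-reflexive (cong (2 *_) (∣tabulate∣≡0 none))) z≤n
      where
      none : ∀ e → (lookup F e ∧ does (nonempty? (edge e ∩ ⁅ v ⁆))) ≢ true
      none e inc with incident e inc
      ... | e∈F , w , w∈e , w∈v = isolated e (lookup⇒[]= e F e∈F) (subst (_∈ edge e) (x∈⁅y⁆⇒x≡y v w∈v) w∈e)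
    balanced inside≤ outside≤ S (inj₁ (connected , _)) with nonempty? S
    ... | no empty = ≤-trans (≤-reflexive (cong (2 *_) (∣tabulate∣≡0 none))) z≤n
      where
      none : ∀ e → (lookup F e ∧ does (nonempty? (edge e ∩ S))) ≢ true
      none e inc with incident e inc
      ... | _ , w , _ , w∈S = empty (w , w∈S)
    ... | yes (u , u∈S) with colour u in u-colour
    ...   | true  = ≤-trans (*-monoʳ-≤ 2 (incident-count (allIn P) inside)) inside≤
      where
      inside : ∀ e {w} → lookup F e ≡ true → w ∈ edge e → w ∈ S → allIn P (namesOf e) ≡ true
      inside e {w} e∈F w∈e w∈S with sides e (retained e∈F) | connected u w u∈S w∈S
      ... | inj₁ yes-inside | _ = yes-inside
      ... | inj₂ outside | _ , u∈e , l = clash (trans (sym (linked-colour l u∈e)) u-colour)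
                                               (outsideOnly-sound P (namesOf e) outside (∈-names⁺ w∈e))
    ...   | false = ≤-trans (*-monoʳ-≤ 2 (incident-count (outsideOnly P) outside)) outside≤
      where
      outside : ∀ e {w} → lookup F e ≡ true → w ∈ edge e → w ∈ S → outsideOnly P (namesOf e) ≡ true
      outside e {w} e∈F w∈e w∈S with sides e (retained e∈F) | connected u w u∈S w∈S
      ... | inj₂ yes-outside | _ = yes-outside
      ... | inj₁ inside | _ , u∈e , l = clash (allIn-sound P (namesOf e) inside (∈-names⁺ w∈e))
                                              (trans (sym (linked-colour l u∈e)) u-colour)

-- The error term

⌈√_⌉ : ℕ → ℕ
⌈√ zero  ⌉ = 0
⌈√ suc n ⌉ with suc n ≤? square ⌈√ n ⌉
... | yes _ = ⌈√ n ⌉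
... | no  _ = suc ⌈√ n ⌉

≤⌈√⌉² : ∀ n → n ≤ square ⌈√ n ⌉
≤⌈√⌉² zero = z≤n
≤⌈√⌉² (suc n) with suc n ≤? square ⌈√ n ⌉
... | yes n<s² = n<s²
... | no  _    = ≤-trans (s≤s (≤⌈√⌉² n)) (≤-trans (m≤m+n _ (2 * ⌈√ n ⌉)) (≤-reflexive (expand ⌈√ n ⌉)))
  where
  expand : ∀ s → suc (s * s) + 2 * s ≡ suc s * suc s
  expand = solve-∀

-- Rounding the root of a positive integer up at most doubles it.
⌈√⌉²≤ : ∀ n → square ⌈√ n ⌉ ≤ 4 * n
⌈√⌉²≤ zero = z≤n
⌈√⌉²≤ (suc n) with suc n ≤? square ⌈√ n ⌉
... | yes _    = ≤-trans (⌈√⌉²≤ n) (*-monoʳ-≤ 4 (n≤1+n n))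
... | no  n≮s² = begin
  suc s * suc s              ≡⟨ expand s ⟩
  suc (s * s + 2 * s)        ≤⟨ s≤s (+-mono-≤ s²≤n (≤-trans (*-monoʳ-≤ 2 (s≤s² s)) (*-monoʳ-≤ 2 s²≤n))) ⟩
  suc (n + 2 * n)            ≤⟨ m≤m+n _ (3 + n) ⟩
  suc (n + 2 * n) + (3 + n)  ≡⟨ total′ n ⟩
  4 * suc n                  ∎
  where
  open ≤-Reasoning
  s = ⌈√ n ⌉
  s²≤n : square s ≤ n
  s²≤n = ≤-pred (≰⇒> n≮s²)
  s≤s² : ∀ s → s ≤ s * s
  s≤s² zero    = z≤n
  s≤s² (suc s) = m≤m*n (suc s) (suc s)
  expand : ∀ s → suc s * suc s ≡ suc (s * s + 2 * s)
  expand = solve-∀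
  total′ : ∀ n → suc (n + 2 * n) + (3 + n) ≡ 4 * suc n
  total′ = solve-∀

deviation : ℕ → ℕ → ℕ → ℕ
deviation r K m = ⌈√ m * (r * (2 * square K)) ⌉

slack : ℕ → (ℕ → ℕ) → ℕ → ℕ
slack r k m = 2 * deviation r (k m) m + 3 * r + 11

slack-littleO : ∀ r k → IsLittleO-√m k → IsLittleO-m (slack r k)
-- With s the deviation, (4 c s)² ≤ 128 c² r k² m ≤ (32 c r k)² m ≤ m², so 2 c · 2 s ≤ m. The
-- constant part 2 c (3 r + 11) of the doubled inequality is absorbed by the second summand of the
-- starting point.
slack-littleO r k k=o√m c with k=o√m (32 * c * r)
... | M , k≤ = M + 2 * (c * (3 * r + 11)) , bound
  where
  open ≤-Reasoning
  bound : ∀ m → M + 2 * (c * (3 * r + 11)) ≤ m → c * slack r k m ≤ m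
  bound m M≤m = *-cancelˡ-≤ 2 (begin
    2 * (c * slack r k m)                           ≡⟨ split′ c s (3 * r) ⟩
    4 * c * s + 2 * (c * (3 * r + 11))              ≤⟨ +-mono-≤ 4cs≤m (≤-trans (m≤n+m _ M) M≤m) ⟩
    m + m                                           ≡⟨ cong (m +_) (+-identityʳ m) ⟨
    2 * m                                           ∎)
    where
    s = deviation r (k m) m
    split′ : ∀ c s t → 2 * (c * (2 * s + t + 11)) ≡ 4 * c * s + 2 * (c * (t + 11))
    split′ = solve-∀
    4cs≤m : 4 * c * s ≤ m
    4cs≤m = square-cancel (4 * c * s) m (begin
      square (4 * c * s)                            ≡⟨ square-* (4 * c) s ⟩
      square (4 * c) * square s                     ≤⟨ *-monoʳ-≤ (square (4 * c)) (⌈√⌉²≤ (m * (r * (2 * square (k m))))) ⟩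
      square (4 * c) * (4 * (m * (r * (2 * square (k m))))) ≡⟨ regroup c m r (k m) ⟩
      m * (128 * (square c * square (k m)) * r)     ≤⟨ *-monoʳ-≤ m (*-monoʳ-≤ (128 * (square c * square (k m))) (r≤r² r)) ⟩
      m * (128 * (square c * square (k m)) * square r) ≤⟨ *-monoʳ-≤ m (m≤m+n _ (896 * (square c * square (k m)) * square r)) ⟩
      m * (128 * (square c * square (k m)) * square r + 896 * (square c * square (k m)) * square r) ≡⟨ regroup′ c m r (k m) ⟩
      m * (32 * c * r * k m) ^ 2                    ≤⟨ *-monoʳ-≤ m (k≤ m (≤-trans (m≤m+n M _) M≤m)) ⟩
      square m                                      ∎)
      where
      square-* : ∀ a b → a * b * (a * b) ≡ a * a * (b * b)
      square-* = solve-∀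
      r≤r² : ∀ r → r ≤ r * r
      r≤r² zero    = z≤n
      r≤r² (suc r) = m≤m*n (suc r) (suc r)
      regroup : ∀ c m r k → 4 * c * (4 * c) * (4 * (m * (r * (2 * (k * k))))) ≡ m * (128 * (c * c * (k * k)) * r)
      regroup = solve-∀
      regroup′ : ∀ c m r k → m * (128 * (c * c * (k * k)) * (r * r) + 896 * (c * c * (k * k)) * (r * r)) ≡
                 m * (32 * c * r * k * (32 * c * r * k * 1))
      regroup′ = solve-∀

-- The separator is good

module _ (k K : ℕ) where
  private
    r′ r : ℕ
    r′ = suc k
    r  = suc r′

  -- `R` is a parameter so that the facts can be transported from the list that the algorithm
  -- returns to the vector with the same entries. Here `a` is one less than the threshold: that is
  -- the value which lies strictly below 2^(-1/r) b.
  record Estimates (m s : ℕ) (E : List (List Name)) (R : List Bool) : Set where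
    field
      P           : List Name
      a a′ b      : ℕ
      a+a′≡b      : suc a + a′ ≡ b
      a′+3≤b      : a′ + 3 ≤ b
      2a^r<b^r    : a ^ r + a ^ r < b ^ r
      m≤b         : m ≤ b
      sides       : Pointwise (λ e removed → removed ≡ false → allIn P e ≡ true ⊎ outsideOnly P e ≡ true) E R
      inside≤     : 2 * kept (allIn P) E R ≤ m
      outside≤    : 2 * kept (outsideOnly P) E R ≤ m
      partition≡  : count id R + (kept (allIn P) E R + kept (outsideOnly P) E R) ≡ m
      half        : m ≤ 2 * kept (allIn P) E R + 1 + 2 * s
      share       : m * ((b + 1) * (a′ + 3) ^ r) ≤ (kept (outsideOnly P) E R + s + 3 * r + 2) * (b * b ^ r)

    kI kO : ℕ
    kI = kept (allIn P) E R
    kO = kept (outsideOnly P) E R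

  separator-estimates : ∀ s E {m} → length E ≡ m → All Unique E → All (λ e → length e ≤ r) E →
    (∀ v → count (λ e → mem e v) E ≤ K) → count null E ≤ 1 → m * (r * (2 * square K)) ≤ square s →
    Estimates m s E (separator r E)
  separator-estimates s E refl uniq small degree≤ empty≤ s-large = from (threshold r b) refl
    where
    m = length E
    b = m + 5
    P = proj₁ (split r (coins r b) E)
    β = collect P m E
    C = collected P m E
    from : ∀ a₁ → threshold r b ≡ a₁ → Estimates m s E (separator r E)
    from zero    eq = contradiction (3≤threshold r′ (m≤n+m 5 m)) (subst (λ x → 3 ≤ x → ⊥) (sym eq) λ ())
    from (suc a) eq = record
      { P = P ; a = a ; a′ = b ∸ threshold r b ; b = b
      ; a+a′≡b = trans (cong (_+ (b ∸ threshold r b)) (sym eq)) (m+[n∸m]≡n (threshold≤ r b))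
      ; a′+3≤b = outside-room r′ K s E uniq small degree≤ empty≤ s-large
      ; 2a^r<b^r = threshold-least r b eq
      ; m≤b = m≤m+n m 5
      ; sides = one-sided C
      ; inside≤ = ≤-trans (m≤n+m _ (proj₁ β)) (≤-reflexive (in-budget C))
      ; outside≤ = ≤-trans (m≤n+m _ (proj₁ (proj₂ β))) (≤-reflexive (out-budget C))
      ; partition≡ = removed+kept r′ K s E uniq small degree≤ empty≤ s-large
      ; half = half-inside r′ K s E uniq small degree≤ empty≤ s-large
      ; share = ε-share r′ K s E uniq small degree≤ empty≤ s-large
      }

  estimates⇒size-bound : ∀ {m s E R} → Estimates m s E R →
    nat (count id R) ≤ᶜ (rat ½ -ᶜ ε r) *ᶜ nat m +ᶜ nat (2 * s + 3 * r + 11)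
  estimates⇒size-bound {m} {s} {E} {R} est = SizeBound.size-bound (ε r)
    (ε<ε-bound r′ a a′ b a+a′≡b a′+3≤b 2a^r<b^r) (proj₁ (ε-within k))
    (quotient-≤ (quotient-ι 0) V≐ z≤n) V≤2 0<β β≤1 m (count id R) kI kO s (3 * r) βm≤1 Vm≤ partition≡ half
    where
    open Estimates est
    instance
      b≢0 : NonZero b
      b≢0 = >-nonZero (≤-trans (≤-trans (s≤s z≤n) (m≤n+m 3 a′)) a′+3≤b)
      b^rb≢0 : NonZero (b ^ r * b)
      b^rb≢0 = m*n≢0 (b ^ r) b {{m^n≢0 b r}}
    V β : ℚ
    V = ε-bound r′ a a′ b a+a′≡b a′+3≤b 2a^r<b^r
    -- Positive, and β m ≤ 1 because m ≤ b.
    β = 1 ÷ b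
    V≐ : Quotient V ((a′ + 3) ^ r * (b + 1)) (b ^ r * b)
    V≐ = quotient-ε-bound r′ a a′ b a+a′≡b a′+3≤b 2a^r<b^r
    V≤2 : V ℚ.≤ rational 2
    V≤2 = quotient-≤ V≐ (quotient-ι 2) (begin
      (a′ + 3) ^ r * (b + 1) * 1      ≡⟨ *-identityʳ _ ⟩
      (a′ + 3) ^ r * (b + 1)          ≤⟨ *-mono-≤ (^-monoˡ-≤ r a′+3≤b) (+-monoʳ-≤ b (>-nonZero⁻¹ b)) ⟩
      b ^ r * (b + b)                 ≡⟨ double (b ^ r) b ⟩
      2 * (b ^ r * b)                 ∎)
      where
      open ≤-Reasoning
      double : ∀ p b → p * (b + b) ≡ 2 * (p * b)
      double = solve-∀
    0<β : 0ℚ ℚ.< β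
    0<β = quotient-< (quotient-ι 0) (quotient-÷ 1 b) ≤-refl
    β≤1 : β ℚ.≤ 1ℚ
    β≤1 = quotient-≤ (quotient-÷ 1 b) (quotient-ι 1) (≤-trans (>-nonZero⁻¹ b) (≤-reflexive (sym (*-identityˡ b))))
    βm≤1 : β ℚ.* ι m ℚ.≤ 1ℚ
    βm≤1 = quotient-≤ (quotient-* (quotient-÷ 1 b) (quotient-ι m)) (quotient-ι 1) {{m*n≢0 b 1}}
      (≤-trans (≤-reflexive (trans (*-identityʳ (1 * m)) (*-identityˡ m)))
        (≤-trans m≤b (≤-reflexive (sym (trans (*-identityˡ (b * 1)) (*-identityʳ b))))))
    Vm≤ : V ℚ.* ι m ℚ.≤ ι (kO + s + 3 * r + 2)
    Vm≤ = quotient-≤ (quotient-* V≐ (quotient-ι m)) (quotient-ι (kO + s + 3 * r + 2)) {{m*n≢0 (b ^ r * b) 1}} (begin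
      (a′ + 3) ^ r * (b + 1) * m * 1              ≡⟨ regroup ((a′ + 3) ^ r) (b + 1) m ⟩
      m * ((b + 1) * (a′ + 3) ^ r)                ≤⟨ share ⟩
      (kO + s + 3 * r + 2) * (b * b ^ r)          ≡⟨ cong ((kO + s + 3 * r + 2) *_) (trans (*-comm b (b ^ r)) (sym (*-identityʳ _))) ⟩
      (kO + s + 3 * r + 2) * (b ^ r * b * 1)      ∎)
      where
      open ≤-Reasoning
      regroup : ∀ p b m → p * b * m * 1 ≡ m * (b * p)
      regroup = solve-∀

  separator-good : ∀ {n m} (H : Hypergraph n m) → EdgeSize≤ H r → MaxDegree≤ H K →
    ∃[ R ] toList R ≡ separator r (edgeList H) × IsBalancedSeparator H R ×
      nat ∣ R ∣ ≤ᶜ (rat ½ -ᶜ ε r) *ᶜ nat m +ᶜ nat (2 * deviation r K m + 3 * r + 11)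
  separator-good {n} {m} H size≤ degree≤ = from (as-vector (separator r E) length≡)
    where
    E = edgeList H
    s = deviation r K m
    est : Estimates m s E (separator r E)
    est = separator-estimates s E (length-edgeList H) (edgeList-unique H) (edgeList-small H size≤)
      (edgeList-degree H degree≤) (edgeList-empty H) (≤⌈√⌉² (m * (r * (2 * square K))))
    length≡ : length (separator r E) ≡ m
    length≡ = trans (sym (Pointwise-length (Estimates.sides est))) (length-edgeList H)
    good : ∀ R → Estimates m s E (toList R) → IsBalancedSeparator H R ×
      nat ∣ R ∣ ≤ᶜ (rat ½ -ᶜ ε r) *ᶜ nat m +ᶜ nat (2 * s + 3 * r + 11)
    good R est = balanced H P R (pointwise-lookup (namesOf H) R sides)
        (≤-trans (≤-reflexive (cong (2 *_) (sym (kept-tabulate (allIn P) (namesOf H) R)))) inside≤)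
        (≤-trans (≤-reflexive (cong (2 *_) (sym (kept-tabulate (outsideOnly P) (namesOf H) R)))) outside≤)
      , subst (λ x → nat x ≤ᶜ (rat ½ -ᶜ ε r) *ᶜ nat m +ᶜ nat (2 * s + 3 * r + 11)) (count-toList R) (estimates⇒size-bound est)
      where open Estimates est
    from : ∃[ R ] toList {n = m} R ≡ separator r E → _
    from (R , eq) = R , eq , good R (subst (Estimates m s E) (sym eq) est)

-- Programs from polynomial-time functions

run-halted : ∀ {M N} (ω : Vec Bool N) {σ} → run {M} ω ⟨ [] , σ ⟩ ≡ ⟨ [] , σ ⟩
run-halted []      = refl
run-halted (_ ∷ ω) = run-halted ω

run-reaches : ∀ {M t} {C D : Config M} → C ⟶[ t ] D → (ω : Vec Bool t) → run ω C ≡ D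
run-reaches done          []      = refl
run-reaches (step s C⟶D) (b ∷ ω) = trans (cong (run ω) (s b)) (run-reaches C⟶D ω)

-- A halted configuration is fixed by `next`, so a run that has halted shows the same final store
-- however many coins it was offered.
halted-final : ∀ {M t σ} {C : Config M} → C ⟶[ t ] ⟨ [] , σ ⟩ → ∀ {N} (ω : Vec Bool N) →
               Halted (run ω C) → run ω C ≡ ⟨ [] , σ ⟩
halted-final done         ω       halted = run-halted ω
halted-final {C = ⟨ [] , _ ⟩} (step s C⟶D) [] halted = trans (s true) (halted-final C⟶D [] (cong stack (sym (s true))))
halted-final (step s C⟶D) (b ∷ ω) halted = trans (cong (run ω) (s b))
  (halted-final C⟶D ω (trans (cong (stack ∘ run ω) (sym (s b))) halted))

steps≤ : ∀ {M t σ} {C : Config M} → C ⟶[ t ] ⟨ [] , σ ⟩ → ∀ {N} (ω : Vec Bool N) → steps ω C ≤ t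
steps≤ done ω = z≤n
steps≤ {C = ⟨ [] , _ ⟩}    (step s C⟶D) ω       = z≤n
steps≤ {C = ⟨ _ ∷ _ , _ ⟩} (step s C⟶D) []      = z≤n
steps≤ {C = ⟨ _ ∷ _ , _ ⟩} (step s C⟶D) (b ∷ ω) = s≤s (≤-trans (≤-reflexive (cong (steps ω) (s b))) (steps≤ C⟶D ω))

sumOverCoins≤ : ∀ N {f B} → (∀ ω → f ω ≤ B) → sumOverCoins N f ≤ B * 2 ^ N
sumOverCoins≤ zero    {B = B} f≤B = ≤-trans (f≤B []) (≤-reflexive (sym (*-identityʳ B)))
sumOverCoins≤ (suc N) {B = B} f≤B = ≤-trans
  (+-mono-≤ (sumOverCoins≤ N (f≤B ∘ (false ∷_))) (sumOverCoins≤ N (f≤B ∘ (true ∷_))))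
  (≤-reflexive (double B (2 ^ N)))
  where
  double : ∀ b x → b * x + b * x ≡ b * (2 * x)
  double = solve-∀

sizes-names : ∀ (e : List Name) → sizes e ≡ length e
sizes-names []      = refl
sizes-names (_ ∷ e) = cong suc (sizes-names e)

sizes-edges : ∀ {r E} → All (λ (e : List Name) → length e ≤ r) E → sizes E ≤ length E * suc r
sizes-edges []                   = z≤n
sizes-edges {E = e ∷ _} (e≤ ∷ E≤) = s≤s (+-mono-≤ (≤-trans (≤-reflexive (sizes-names e)) e≤) (sizes-edges E≤))

module _ (k : ℕ) where
  private
    r : ℕ
    r = suc (suc k)

  program : ∀ {M} → Program M
  program = code (separatorᵖ r) 0

  -- m hyperedges of at most r names have size at most m (r + 1), which turns the running time into
  -- a function of m alone, whatever the number of vertices.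
  run-time : Poly
  run-time = time (separatorᵖ r) ⊚ (X ⊗ con (suc r))

  module _ {n m} (H : Hypergraph n m) (size≤ : EdgeSize≤ H r) where

    program-computes : ∀ {M} → Computation (program {M}) 0 ((λ _ → atom 0) [ 0 ↦ encodeHypergraph H ])
      (⟦ run-time ⟧ m) (encode (separator r (edgeList H)))
    program-computes = record
      { final = final α ; runs = runs α
      ; in-time = ≤-trans (in-time α) (⟦⟧-mono (time (separatorᵖ r))
          (≤-trans (sizes-edges (edgeList-small H size≤)) (≤-reflexive (cong (_* suc r) (length-edgeList H)))))
      ; result = result α ; frame = frame α }
      where α = computes (separatorᵖ r) 0 ((λ _ → atom 0) [ 0 ↦ encodeHypergraph H ]) (edgeList H) (sym (encode-edgeList H))

    program-duration : ∀ {M} → ℕ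
    program-duration {M} = duration (runs (program-computes {M}))

    program-steps : ∀ {M} → start (program {M}) (encodeHypergraph H) ⟶[ program-duration {M} ] ⟨ [] , final (program-computes {M}) ⟩
    program-steps = steps-to (runs program-computes) []

    program-finds : ∀ {M} {Good : Subset m → Set} →
      (∃[ R ] toList R ≡ separator r (edgeList H) × Good R) → AlwaysFinds (program {M}) H Good
    program-finds {M} (R , R≡ , good) t ω halted = R
      , trans (cong output (halted-final program-steps ω halted))
          (trans (result (program-computes {M})) (cong (λ bs → list (List.map bit bs)) (sym R≡)))
      , good

theorem3p3 :
    (r : ℕ) .{{_ : NonZero r}} → 2 ≤ r →
    (k : ℕ → ℕ) → IsLittleO-√m k →
    ∃[ g ] IsLittleO-m g ×
    (let Admissible : ∀ {n m} → Hypergraph n m → Set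
         Admissible {n} {m} H = EdgeSize≤ H r × MaxDegree≤ H (k m)
         Good : ∀ {n m} → Hypergraph n m → Subset m → Set
         Good {n} {m} H R =
           IsBalancedSeparator H R ×
           nat ∣ R ∣ ≤ᶜ (rat ½ -ᶜ ε r) *ᶜ nat m +ᶜ nat (g m)
     in
     (∀ {n m} (H : Hypergraph n m) → Admissible H → ∃[ R ] Good H R)
     ×
     (Σ[ p ∈ Program randomized ] ∃[ c ] ∀ {n m} (H : Hypergraph n m) → Admissible H →
        AlwaysFinds p H (Good H) ×
        ExpectedTime≤ p (encodeHypergraph H) (c * suc m ^ c))
     ×
     (Σ[ p ∈ Program deterministic ] ∃[ c ] ∀ {n m} (H : Hypergraph n m) → Admissible H →
        AlwaysFinds p H (Good H) ×
        ∃[ t ] HaltsIn p (encodeHypergraph H) t ×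
          nat t ≤ᶜ nat (c * suc m ^ c) *ᶜ
            2^ᶜ ((nat 1 -ᶜ nat 2 *ᶜ ε r ^ᶜ 2) *ᶜ nat m +ᶜ nat (g m))))
theorem3p3 (suc (suc j)) (s≤s (s≤s z≤n)) k k=o√m = slack r k , slack-littleO r k k=o√m
  , (λ {n} {m} H (size≤ , degree≤) → let R , _ , good = separator-good j (k m) H size≤ degree≤ in R , good)
  , (program j , c , λ {n} {m} H (size≤ , degree≤) →
      program-finds j H size≤ (separator-good j (k m) H size≤ degree≤)
      , λ N → sumOverCoins≤ N λ ω → ≤-trans (steps≤ (program-steps j H size≤) ω)
          (≤-trans (in-time (program-computes j H size≤)) (≤-trans (m≤m+n _ _) (<⇒≤ (2T<P m)))))
  , (program j , c , λ {n} {m} H (size≤ , degree≤) →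
      program-finds j H size≤ (separator-good j (k m) H size≤ degree≤)
      , program-duration j H size≤
      , (λ ω → cong stack (run-reaches (program-steps j H size≤) ω))
      , TimeBound.time-bound (ε r) (ε-within j) m (slack r k m) (program-duration j H size≤) (c * suc m ^ c)
          (≤-trans (s≤s (s≤s (s≤s (s≤s (s≤s z≤n))))) (m≤n+m 11 (2 * deviation r (k m) m + 3 * r)))
          (≤-<-trans (*-monoʳ-≤ 2 (in-time (program-computes j H size≤))) (2T<P m)))
  where
  r = suc (suc j)
  -- The polynomial 1 + 2 T makes 2 T < P strict, as the deterministic bound requires; the same P
  -- also bounds the expected time.
  bounded = monomial-bound (con 1 ⊕ con 2 ⊗ run-time j)
  c = proj₁ bounded
  2T<P : ∀ m → 2 * ⟦ run-time j ⟧ m < c * suc m ^ c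
  2T<P = proj₂ bounded
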